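{- The category $\mathcal{C}(numOp_{(g,n)})^{op}$ described in the context is quasi-Gröbner.
   Context: Quasi-Gröbner categories. Let $\mathcal{C}$ be a small category and $c$ an object. An admissible order on the morphisms out of $c$ is a choice, for every object $c'$, of a well-order on $\mathrm{Hom}(c,c')$ such that $f\prec f'$ implies $g\circ f\prec g\circ f'$ for all $g$. On morphisms out of $c$ put the preorder $f\le g$ iff $g=h\circ f$ for some $h$; $|c/\mathcal{C}|$ is the associated poset. A poset is Noetherian if every sequence $x_1,x_2,\dots$ has $i<j$ with $x_i\le x_j$. $\mathcal{C}$ is Gröbner if for every object $c$: (G1) morphisms out of $c$ admit an admissible order, and (G2) $|c/\mathcal{C}|$ is Noetherian. A functor $\Phi:\mathcal{C}\to\mathcal{D}$ has property (F) if for every object $d$ of $\mathcal{D}$ there are finitely many objects $c_i$ of $\mathcal{C}$ and morphisms $f_i:d\to\Phi(c_i)$ such that every $f:d\to\Phi(c)$ factors as $\Phi(g)\circ f_i$ for some $i$ and $g:c_i\to c$. $\mathcal{D}$ is quasi-Gröbner if there is a Gröbner $\mathcal{C}$ and an essentially surjective functor $\mathcal{C}\to\mathcal{D}$ with property (F). Operadic graphs. A graph with half-edges is finite sets $V$, $H$, an involution $inv$ on $H$ and $t:H\to V$; fixed points of $inv$ are leaves, two-element orbits are edges. An operadic graph additionally has a total order on leaves (indexed $0,1,\dots$), for each vertex $v$ a total order on $t^{ -1}(v)$, and a total order on $V$ (indexed $1,\dots,n$); considered up to isomorphism preserving all data. The genus $g(\Gamma)$ of a connected graph is its first Betti number (#edges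 $-$ #vertices $+1$). The category $\mathcal{C}(numOp_{(g,n)})^{op}$: objects are connected operadic graphs with at least one vertex (loops, multiple edges and any number of leaves allowed), endowed with a genus map $g:V\to\mathbb{N}$. If $p$ has vertices $v_1<\dots<v_n$, a morphism $p\to q$ consists of objects $q_1,\dots,q_n$ such that $q_l$ has as many leaves as $v_l$ has half-edges and $g(v_l)=\sum_{v\in V(q_l)}g(v)+g(q_l)$, together with a bijection $\bigsqcup_l V(q_l)\to V(q)$ order preserving on each $V(q_l)$, such that $q$ is obtained by substituting $q_l$ into $v_l$: the $i$-th leaf of $q_l$ is identified with the $i$-th half-edge of $v_l$; an edge of $p$ between the $i$-th half-edge of $v_j$ and the $k$-th half-edge of $v_l$ becomes an edge of $q$ between the $i$-th leaf of $q_j$ and the $k$-th leaf of $q_l$; if the $i$-th half-edge of $v_j$ is the $k$-th leaf of $p$ then the $i$-th leaf of $q_j$ is the $k$-th leaf of $q$; half-edge orders and vertex genera come from the $q_l$, and the vertex order of $q$ is transported along the bijection. Composition is iterated substitution. (This is the opposite of $\mathcal{C}(P)$ for $P$ the operad of genus-graded modular operads, restricted to operations of non-zero arity.) -}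

module Defs where

open import Algebra.Definitions using (Involutive)
open import Data.Empty using (⊥)
open import Data.Fin.Base as Fin using (Fin; zero; suc; toℕ; cast)
import Data.Fin.Properties as Fin
open import Data.Integer.Base as ℤ using (ℤ; +_)
import Data.Integer.Properties as ℤ
open import Data.Integer.Tactic.RingSolver using (solve-∀)
open import Data.List.Base using (List; []; _∷_; map; concatMap; filter; length; allFin; tabulate)
open import Data.List.Membership.Propositional using (_∈_)
open import Data.List.Membership.Propositional.Properties using (∈-map⁺; ∈-map⁻; ∈-++⁺ˡ; ∈-++⁺ʳ; ∈-++⁻; ∈-allFin; ∈-filter⁺; ∈-filter⁻; ∈-tabulate⁺; ∈-tabulate⁻)
open import Data.List.Membership.Propositional.Properties.WithK using (unique∧set⇒bag)
open import Data.List.Properties using (length-map; length-++; length-tabulate; map-∘; map-cong; map-++)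
open import Data.List.Relation.Binary.BagAndSetEquality using (∼bag⇒↭)
open import Data.List.Relation.Binary.Permutation.Propositional using (_↭_)
import Data.List.Relation.Binary.Permutation.Propositional.Properties as ↭
open import Data.List.Relation.Unary.Any using (here; there)
open import Data.List.Relation.Unary.Unique.Propositional using (Unique; []; _∷_)
import Data.List.Relation.Unary.Unique.Propositional.Properties as Unique
import Data.List.Relation.Unary.All as All
open import Data.Nat.Base as ℕ using (ℕ; zero; suc; z≤n; s≤s)
open import Data.Nat.ListAction using (sum)
open import Data.Nat.ListAction.Properties using (sum-++; sum-↭)
import Data.Nat.Properties as ℕ
import Data.Nat.Tactic.RingSolver as ℕSolver
open import Data.Product.Base using (Σ; Σ-syntax; ∃-syntax; _×_; _,_; proj₁; proj₂)
open import Data.Sum.Base using (_⊎_; inj₁; inj₂)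
open import Function.Base using (_∘_; id)
open import Function.Bundles using (_↔_; Inverse; mk↔ₛ′; mk⇔)
open import Function.Definitions using (Injective)
open import Induction.WellFounded using (WellFounded)
open import Level using (0ℓ)
open import Relation.Binary.Bundles using (Poset)
open import Relation.Binary.Construct.Closure.ReflexiveTransitive using (Star; ε; _◅_; _◅◅_)
import Relation.Binary.Construct.Interior.Symmetric as SymInterior
open import Relation.Binary.Core using (Rel)
open import Relation.Binary.Definitions using (tri<; tri≈; tri>)
open import Relation.Binary.PropositionalEquality using (_≡_; _≢_; refl; sym; trans; cong; cong₂; subst; module ≡-Reasoning)
open import Relation.Binary.Structures using (IsEquivalence; IsStrictTotalOrder)
open import Relation.Nullary using (¬_; Dec; yes; no; contradiction)
open import Relation.Nullary.Decidable using (_×-dec_; _⊎-dec_; map′)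

record Category : Set₁ where
  infix  4 _≈_
  infixr 9 _⊚_
  field
    Obj : Set
    Hom : Obj → Obj → Set
    _≈_ : ∀ {a b} → Rel (Hom a b) 0ℓ
    idₘ : ∀ {a} → Hom a a
    _⊚_ : ∀ {a b c} → Hom b c → Hom a b → Hom a c
    isEquivalence : ∀ {a b} → IsEquivalence (_≈_ {a} {b})
    identityˡ : ∀ {a b} (f : Hom a b) → idₘ ⊚ f ≈ f
    identityʳ : ∀ {a b} (f : Hom a b) → f ⊚ idₘ ≈ f
    assoc : ∀ {a b c d} (h : Hom c d) (g : Hom b c) (f : Hom a b) →
            (h ⊚ g) ⊚ f ≈ h ⊚ (g ⊚ f)
    ⊚-resp-≈ : ∀ {a b c} {g g′ : Hom b c} {f f′ : Hom a b} →
               g ≈ g′ → f ≈ f′ → g ⊚ f ≈ g′ ⊚ f′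

  module ≈ {a b : Obj} = IsEquivalence (isEquivalence {a} {b})

record Functor (C D : Category) : Set where
  private
    module C = Category C
    module D = Category D
  field
    F₀ : C.Obj → D.Obj
    F₁ : ∀ {a b} → C.Hom a b → D.Hom (F₀ a) (F₀ b)
    F-resp-≈ : ∀ {a b} {f g : C.Hom a b} → f C.≈ g → F₁ f D.≈ F₁ g
    identity : ∀ {a} → F₁ (C.idₘ {a}) D.≈ D.idₘ
    homomorphism : ∀ {a b c} (g : C.Hom b c) (f : C.Hom a b) →
                   F₁ (g C.⊚ f) D.≈ F₁ g D.⊚ F₁ f

module _ (C : Category) where
  open Category C

  record Isomorphic (a b : Obj) : Set where
    field
      to   : Hom a b
      from : Hom b a
      from-to : from ⊚ to ≈ idₘ
      to-from : to ⊚ from ≈ idₘ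

  -- A well-order is a well-founded strict total order (trichotomy is taken
  -- with respect to the equality of morphisms).
  record AdmissibleOrder (c : Obj) : Set₁ where
    field
      _≺_ : ∀ {c′} → Rel (Hom c c′) 0ℓ
      isStrictTotalOrder : ∀ {c′} → IsStrictTotalOrder (_≈_ {c} {c′}) _≺_
      wellFounded : ∀ {c′} → WellFounded (_≺_ {c′})
      ⊚-mono-≺ : ∀ {c′ c″} (g : Hom c′ c″) {f f′ : Hom c c′} →
                 f ≺ f′ → (g ⊚ f) ≺ (g ⊚ f′)

  MorphismFrom : Obj → Set
  MorphismFrom c = Σ[ c′ ∈ Obj ] Hom c c′

  _≼_ : ∀ {c} → Rel (MorphismFrom c) 0ℓ
  _≼_ (a , f) (b , g) = Σ[ h ∈ Hom a b ] g ≈ h ⊚ f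

  ≼-refl : ∀ {c} {x : MorphismFrom c} → x ≼ x
  ≼-refl {x = _ , f} = idₘ , ≈.sym (identityˡ f)

  ≼-trans : ∀ {c} {x y z : MorphismFrom c} → x ≼ y → y ≼ z → x ≼ z
  ≼-trans {x = _ , f} (h , g≈hf) (k , e≈kg) =
    k ⊚ h ,
    ≈.trans e≈kg (≈.trans (⊚-resp-≈ ≈.refl g≈hf) (≈.sym (assoc k h f)))

  -- The poset |c/C|: morphisms out of c modulo the equivalence relation
  -- f ≼ g × g ≼ f.
  coslicePoset : Obj → Poset 0ℓ 0ℓ 0ℓ
  coslicePoset c = SymInterior.poset {A = MorphismFrom c} {R = _≼_}
    (λ {x} → ≼-refl {x = x}) (λ {x} {y} {z} → ≼-trans {x = x} {y} {z})

Noetherian : Poset 0ℓ 0ℓ 0ℓ → Set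
Noetherian P = (x : ℕ → Carrier) → ∃[ i ] ∃[ j ] (i ℕ.< j × x i ≤ x j)
  where open Poset P

record IsGröbner (C : Category) : Set₁ where
  field
    G1 : ∀ c → AdmissibleOrder C c
    G2 : ∀ c → Noetherian (coslicePoset C c)

module _ {C D : Category} (Φ : Functor C D) where
  private
    module C = Category C
    module D = Category D
  open Functor Φ

  EssentiallySurjective : Set
  EssentiallySurjective = ∀ d → ∃[ c ] Isomorphic D (F₀ c) d

  record FiniteFactorization (d : D.Obj) : Set where
    field
      size : ℕ
      cᵢ   : Fin size → C.Obj
      fᵢ   : ∀ i → D.Hom d (F₀ (cᵢ i))
      factors : ∀ {c} (f : D.Hom d (F₀ c)) →
                ∃[ i ] Σ[ g ∈ C.Hom (cᵢ i) c ] f D.≈ F₁ g D.⊚ fᵢ i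

  PropertyF : Set
  PropertyF = ∀ d → FiniteFactorization d

record IsQuasiGröbner (D : Category) : Set₁ where
  field
    C : Category
    isGröbner : IsGröbner C
    Φ : Functor C D
    essentiallySurjective : EssentiallySurjective Φ
    propertyF : PropertyF Φ

-- An operadic graph has no non-trivial automorphisms, and each isomorphism
-- class has exactly one representative in which the n vertices are the
-- elements of Fin n with their usual order, the half-edges at v are the pairs
-- (v , i) ordered by i, and the leaves are listed by their index.
record OperadicGraph : Set where
  field
    #V    : ℕ
    arity : Fin #V → ℕ
    #L    : ℕ

  Vertex : Set
  Vertex = Fin #V

  HalfEdge : Set
  HalfEdge = Σ[ v ∈ Vertex ] Fin (arity v)

  t : HalfEdge → Vertex
  t = proj₁

  field
    inv            : HalfEdge → HalfEdge
    inv-involutive : Involutive _≡_ inv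
    leaf           : Fin #L → HalfEdge
    leaf-injective : Injective _≡_ _≡_ leaf
    leaf-fixed     : ∀ k → inv (leaf k) ≡ leaf k
    fixed⇒leaf     : ∀ h → inv h ≡ h → ∃[ k ] leaf k ≡ h

  _<ₕ_ : Rel HalfEdge 0ℓ
  (v , i) <ₕ (w , j) = v Fin.< w ⊎ (v ≡ w × toℕ i ℕ.< toℕ j)

  _<ₕ?_ : ∀ h h′ → Dec (h <ₕ h′)
  (v , i) <ₕ? (w , j) = (v Fin.<? w) ⊎-dec ((v Fin.≟ w) ×-dec (toℕ i ℕ.<? toℕ j))

  vertices : List Vertex
  vertices = allFin #V

  halfEdges : List HalfEdge
  halfEdges = concatMap (λ v → map (v ,_) (allFin (arity v))) vertices

  -- A two-element orbit of inv is counted through its smaller element.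
  #E : ℕ
  #E = length (filter (λ h → h <ₕ? inv h) halfEdges)

  betti : ℤ
  betti = + #E ℤ.- + #V ℤ.+ + 1

  Adjacent : Rel Vertex 0ℓ
  Adjacent v w = ∃[ h ] (t h ≡ v × t (inv h) ≡ w)

  Connected : Set
  Connected = ∀ v w → Star Adjacent v w

open OperadicGraph

-- q is obtained from p by substituting part l into the l-th vertex of p.
record Substitution (p : OperadicGraph) (part : Vertex p → OperadicGraph)
                    (q : OperadicGraph) : Set where
  field
    part-leaves : ∀ l → #L (part l) ≡ arity p l
    bijection   : (Σ[ l ∈ Vertex p ] Vertex (part l)) ↔ Vertex q

  ι : (l : Vertex p) → Vertex (part l) → Vertex q
  ι l u = Inverse.to bijection (l , u)

  field
    ι-mono-< : ∀ l {u v} → u Fin.< v → ι l u Fin.< ι l v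
    ι-arity  : ∀ l u → arity (part l) u ≡ arity q (ι l u)

  -- The half-edges of the parts, seen in q.
  γ : (l : Vertex p) → HalfEdge (part l) → HalfEdge q
  γ l (u , i) = ι l u , cast (ι-arity l u) i

  -- The half-edge (l , i) of p becomes the i-th leaf of part l.
  ψ : HalfEdge p → HalfEdge q
  ψ (l , i) = γ l (leaf (part l) (cast (sym (part-leaves l)) i))

  field
    #L-≡      : #L p ≡ #L q
    inv-inner : ∀ l h → inv (part l) h ≢ h → inv q (γ l h) ≡ γ l (inv (part l) h)
    inv-outer : ∀ h → inv q (ψ h) ≡ ψ (inv p h)
    leaf-outer : ∀ k → leaf q (cast #L-≡ k) ≡ ψ (leaf p k)

-- Isomorphism preserving all data; the bijection of vertices is forced to be
-- a cast, because it preserves the order.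
record _≅_ (p q : OperadicGraph) : Set where
  field
    #V-≡    : #V p ≡ #V q
    #L-≡    : #L p ≡ #L q
    arity-≡ : ∀ v → arity p v ≡ arity q (cast #V-≡ v)

  onVertex : Vertex p → Vertex q
  onVertex = cast #V-≡

  onHalfEdge : HalfEdge p → HalfEdge q
  onHalfEdge (v , i) = onVertex v , cast (arity-≡ v) i

  field
    inv-≡  : ∀ h → inv q (onHalfEdge h) ≡ onHalfEdge (inv p h)
    leaf-≡ : ∀ k → leaf q (cast #L-≡ k) ≡ onHalfEdge (leaf p k)

record GenusGraph : Set where
  field
    graph     : OperadicGraph
    genus     : Vertex graph → ℕ
    nonempty  : 1 ℕ.≤ #V graph
    connected : Connected graph

  totalGenus : ℤ
  totalGenus = + sum (map genus (vertices graph)) ℤ.+ betti graph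

open GenusGraph

record Hom (p q : GenusGraph) : Set where
  field
    part         : Vertex (graph p) → GenusGraph
    part-genus   : ∀ l → + genus p l ≡ totalGenus (part l)
    substitution : Substitution (graph p) (λ l → graph (part l)) (graph q)

  open Substitution substitution public

  field
    ι-genus : ∀ l u → genus q (ι l u) ≡ genus (part l) u

-- Equality of morphisms: the parts agree up to isomorphism (as operadic
-- graphs with genus map), compatibly with the bijections of vertices.
_≈ₕ_ : ∀ {p q} → Rel (Hom p q) 0ℓ
_≈ₕ_ {p} f g = ∀ l → Σ[ e ∈ graph (F.part l) ≅ graph (G.part l) ]
  ((∀ u → genus (F.part l) u ≡ genus (G.part l) (_≅_.onVertex e u)) ×
   (∀ u → F.ι l u ≡ G.ι l (_≅_.onVertex e u)))
  where
  module F = Hom f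
  module G = Hom g

pair-≡ : ∀ {n} {a : Fin n → ℕ} {h h′ : Σ[ v ∈ Fin n ] Fin (a v)} →
         proj₁ h ≡ proj₁ h′ → toℕ (proj₂ h) ≡ toℕ (proj₂ h′) → h ≡ h′
pair-≡ {h = v , _} refl eq = cong (v ,_) (Fin.toℕ-injective eq)

index : ∀ {n} {a : Fin n → ℕ} → Σ[ v ∈ Fin n ] Fin (a v) → ℕ
index = toℕ ∘ proj₂

module _ {m n : ℕ} {f : Fin m → Fin n} (mono : ∀ {i j} → i Fin.< j → f i Fin.< f j) where

  mono⇒injective : ∀ {i j} → f i ≡ f j → i ≡ j
  mono⇒injective {i} {j} eq with Fin.<-cmp i j
  ... | tri< i<j _ _ = contradiction eq (Fin.<⇒≢ (mono i<j))
  ... | tri≈ _ i≡j _ = i≡j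
  ... | tri> _ _ j<i = contradiction (sym eq) (Fin.<⇒≢ (mono j<i))

  mono⇒reflects : ∀ {i j} → f i Fin.< f j → i Fin.< j
  mono⇒reflects {i} {j} lt with Fin.<-cmp i j
  ... | tri< i<j _ _ = i<j
  ... | tri≈ _ refl _ = contradiction lt (Fin.<-irrefl refl)
  ... | tri> _ _ j<i = contradiction lt (Fin.<-asym (mono j<i))

mono⇒≤ : ∀ {m n} {f : Fin m → Fin n} → (∀ {i j} → i Fin.< j → f i Fin.< f j) →
         ∀ i → toℕ i ℕ.≤ toℕ (f i)
mono⇒≤ mono i = go mono (toℕ i) i refl
  where
  go : ∀ {m n} {f : Fin m → Fin n} → (∀ {i j} → i Fin.< j → f i Fin.< f j) →
       ∀ k i → toℕ i ≡ k → k ℕ.≤ toℕ (f i)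
  go mono zero    i       _  = z≤n
  go {suc (suc m)} mono (suc k) (suc i) eq =
    ℕ.≤-<-trans (go mono k (Fin.inject₁ i) (trans (Fin.toℕ-inject₁ i) (ℕ.suc-injective eq)))
                (mono (s≤s (ℕ.≤-reflexive (Fin.toℕ-inject₁ i))))

-- Two strictly increasing enumerations of the same subset coincide.
module _ {a b n : ℕ} {f : Fin a → Fin n} {g : Fin b → Fin n}
         (f-mono : ∀ {i j} → i Fin.< j → f i Fin.< f j)
         (g-mono : ∀ {i j} → i Fin.< j → g i Fin.< g j)
         (f⊆g : ∀ i → ∃[ j ] g j ≡ f i) (g⊆f : ∀ j → ∃[ i ] f i ≡ g j) where
  private
    to : Fin a → Fin b
    to = proj₁ ∘ f⊆g

    from : Fin b → Fin a
    from = proj₁ ∘ g⊆f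

    g-to : ∀ i → g (to i) ≡ f i
    g-to = proj₂ ∘ f⊆g

    f-from : ∀ j → f (from j) ≡ g j
    f-from = proj₂ ∘ g⊆f

    from-to : ∀ i → from (to i) ≡ i
    from-to i = mono⇒injective f-mono (trans (f-from _) (g-to i))

    to-mono : ∀ {i j} → i Fin.< j → to i Fin.< to j
    to-mono {i} {j} lt = mono⇒reflects g-mono
      (subst (Fin._< g (to j)) (sym (g-to i)) (subst (f i Fin.<_) (sym (g-to j)) (f-mono lt)))

    from-mono : ∀ {i j} → i Fin.< j → from i Fin.< from j
    from-mono {i} {j} lt = mono⇒reflects f-mono
      (subst (Fin._< f (from j)) (sym (f-from i)) (subst (g i Fin.<_) (sym (f-from j)) (g-mono lt)))

  enumerations-size : a ≡ b
  enumerations-size = ℕ.≤-antisym (Fin.injective⇒≤ (mono⇒injective to-mono))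
                                 (Fin.injective⇒≤ (mono⇒injective from-mono))

  enumerations-≡ : ∀ i → f i ≡ g (cast enumerations-size i)
  enumerations-≡ i = trans (sym (g-to i)) (cong g (Fin.toℕ-injective
    (trans (ℕ.≤-antisym (subst (λ k → toℕ (to i) ℕ.≤ toℕ k) (from-to i) (mono⇒≤ from-mono (to i)))
                        (mono⇒≤ to-mono i))
           (sym (Fin.toℕ-cast enumerations-size i)))))

record Enumeration {n : ℕ} (P : Fin n → Set) : Set where
  field
    size     : ℕ
    enum     : Fin size → Fin n
    mono     : ∀ {i j} → i Fin.< j → enum i Fin.< enum j
    sound    : ∀ i → P (enum i)
    complete : ∀ x → P x → ∃[ i ] enum i ≡ x

enumerate : ∀ {n} {P : Fin n → Set} → (∀ x → Dec (P x)) → Enumeration P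
enumerate {zero} P? = record
  { size = 0 ; enum = λ () ; mono = λ { {()} } ; sound = λ () ; complete = λ () }
enumerate {suc n} {P} P? with P? zero | enumerate (P? ∘ suc)
... | yes p₀ | E = record
  { size = suc E.size
  ; enum = enum
  ; mono = λ {i} {j} → mono {i} {j}
  ; sound = λ { zero → p₀ ; (suc i) → E.sound i }
  ; complete = λ { zero _ → zero , refl
                 ; (suc x) px → let (i , eq) = E.complete x px in suc i , cong suc eq }
  }
  where
  module E = Enumeration E

  enum : Fin (suc E.size) → Fin (suc n)
  enum zero    = zero
  enum (suc i) = suc (E.enum i)

  mono : ∀ {i j} → i Fin.< j → enum i Fin.< enum j
  mono {zero}  {suc j} _        = s≤s z≤n
  mono {suc i} {suc j} (s≤s lt) = s≤s (E.mono lt)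
... | no ¬p₀ | E = record
  { size = E.size
  ; enum = suc ∘ E.enum
  ; mono = λ lt → s≤s (E.mono lt)
  ; sound = E.sound
  ; complete = λ { zero px → contradiction px ¬p₀
                 ; (suc x) px → let (i , eq) = E.complete x px in i , cong suc eq }
  }
  where module E = Enumeration E

unique-↭ : ∀ {A : Set} {xs ys : List A} → Unique xs → Unique ys →
           (∀ {x} → x ∈ xs → x ∈ ys) → (∀ {x} → x ∈ ys → x ∈ xs) → xs ↭ ys
unique-↭ uxs uys xs⊆ys ys⊆xs =
  ∼bag⇒↭ (unique∧set⇒bag uxs uys (mk⇔ xs⊆ys ys⊆xs))

module _ {A : Set} {B : A → Set} (f : (a : A) → List (B a)) where

  pairs : List A → List (Σ A B)
  pairs = concatMap (λ a → map (a ,_) (f a))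

  ∈-pairs⁻ : ∀ xs {a b} → (a , b) ∈ pairs xs → a ∈ xs
  ∈-pairs⁻ (x ∷ xs) ab∈ with ∈-++⁻ (map (x ,_) (f x)) ab∈
  ... | inj₂ ab∈xs = there (∈-pairs⁻ xs ab∈xs)
  ... | inj₁ ab∈x with ∈-map⁻ (x ,_) ab∈x
  ...   | _ , _ , refl = here refl

  ∈-pairs⁺ : ∀ {xs a b} → a ∈ xs → b ∈ f a → (a , b) ∈ pairs xs
  ∈-pairs⁺ {x ∷ xs} (here refl) b∈ = ∈-++⁺ˡ (∈-map⁺ (x ,_) b∈)
  ∈-pairs⁺ {x ∷ xs} (there a∈) b∈ = ∈-++⁺ʳ (map (x ,_) (f x)) (∈-pairs⁺ a∈ b∈)

  pairs-unique : ∀ {xs} → Unique xs → (∀ a → Unique (f a)) → Unique (pairs xs)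
  pairs-unique []                  uf = []
  pairs-unique {x ∷ xs} (x∉ ∷ uxs) uf =
    Unique.++⁺ (Unique.map⁺ (λ { refl → refl }) (uf x)) (pairs-unique uxs uf) disjoint
    where
    disjoint : ∀ {ab} → ab ∈ map (x ,_) (f x) × ab ∈ pairs xs → ⊥
    disjoint (∈₁ , ∈₂) with ∈-map⁻ (x ,_) ∈₁
    ... | _ , _ , refl = All.lookup x∉ (∈-pairs⁻ xs ∈₂) refl

  sum-pairs : (F : Σ A B → ℕ) → ∀ xs →
              sum (map F (pairs xs)) ≡ sum (map (λ a → sum (map (λ b → F (a , b)) (f a))) xs)
  sum-pairs F []       = refl
  sum-pairs F (x ∷ xs) = trans (cong sum (map-++ F (map (x ,_) (f x)) (pairs xs)))
    (trans (sum-++ (map F (map (x ,_) (f x))) (map F (pairs xs)))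
           (cong₂ ℕ._+_ (cong sum (sym (map-∘ (f x)))) (sum-pairs F xs)))

  length-pairs : ∀ xs → length (pairs xs) ≡ sum (map (λ a → length (f a)) xs)
  length-pairs []       = refl
  length-pairs (x ∷ xs) = trans (length-++ (map tag (f x)))
    (cong₂ ℕ._+_ (length-map tag (f x)) (length-pairs xs))
    where
    tag : B x → Σ A B
    tag = x ,_

sum-map-+ : ∀ {A : Set} (f g : A → ℕ) xs →
            sum (map (λ x → f x ℕ.+ g x) xs) ≡ sum (map f xs) ℕ.+ sum (map g xs)
sum-map-+ f g []       = refl
sum-map-+ f g (x ∷ xs) = trans (cong (f x ℕ.+ g x ℕ.+_) (sum-map-+ f g xs))
  (interchange (f x) (g x) (sum (map f xs)) (sum (map g xs)))
  where
  interchange : ∀ a b c d → a ℕ.+ b ℕ.+ (c ℕ.+ d) ≡ a ℕ.+ c ℕ.+ (b ℕ.+ d)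
  interchange = ℕSolver.solve-∀

sum-map-1 : ∀ {A : Set} (xs : List A) → sum (map (λ _ → 1) xs) ≡ length xs
sum-map-1 []       = refl
sum-map-1 (_ ∷ xs) = cong suc (sum-map-1 xs)

module _ {A : Set} {P Q R : A → Set}
         (P? : ∀ x → Dec (P x)) (Q? : ∀ x → Dec (Q x)) (R? : ∀ x → Dec (R x))
         (cover : ∀ x → P x ⊎ Q x ⊎ R x)
         (¬PQ : ∀ x → P x → ¬ Q x) (¬PR : ∀ x → P x → ¬ R x) (¬QR : ∀ x → Q x → ¬ R x) where

  length-filter₃ : ∀ xs → length (filter P? xs) ℕ.+ length (filter Q? xs) ℕ.+ length (filter R? xs)
                          ≡ length xs
  length-filter₃ [] = refl
  length-filter₃ (x ∷ xs) with P? x | Q? x | R? x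
  ... | yes px | yes qx | _ = contradiction qx (¬PQ x px)
  ... | yes px | no _ | yes rx = contradiction rx (¬PR x px)
  ... | yes px | no _ | no _ = cong suc (length-filter₃ xs)
  ... | no _ | yes qx | yes rx = contradiction rx (¬QR x qx)
  ... | no _ | yes qx | no _ =
    trans (cong (ℕ._+ length (filter R? xs)) (ℕ.+-suc (length (filter P? xs)) _)) (cong suc (length-filter₃ xs))
  ... | no _ | no _ | yes rx =
    trans (ℕ.+-suc (length (filter P? xs) ℕ.+ length (filter Q? xs)) _) (cong suc (length-filter₃ xs))
  ... | no ¬p | no ¬q | no ¬r with cover x
  ...   | inj₁ px = contradiction px ¬p
  ...   | inj₂ (inj₁ qx) = contradiction qx ¬q
  ...   | inj₂ (inj₂ rx) = contradiction rx ¬r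

module GraphProperties (p : OperadicGraph) where

  _≟ₕ_ : (h h′ : HalfEdge p) → Dec (h ≡ h′)
  (v , i) ≟ₕ (w , j) = map′ (λ (eq₁ , eq₂) → pair-≡ eq₁ eq₂) (λ { refl → refl , refl })
                            ((v Fin.≟ w) ×-dec (toℕ i ℕ.≟ toℕ j))

  <ₕ-irrefl : ∀ h → ¬ (_<ₕ_ p h h)
  <ₕ-irrefl _ (inj₁ lt)       = Fin.<-irrefl refl lt
  <ₕ-irrefl _ (inj₂ (_ , lt)) = ℕ.<-irrefl refl lt

  <ₕ-asym : ∀ h h′ → _<ₕ_ p h h′ → ¬ (_<ₕ_ p h′ h)
  <ₕ-asym _ _ (inj₁ lt) (inj₁ gt)                = Fin.<-asym lt gt
  <ₕ-asym _ _ (inj₁ lt) (inj₂ (refl , _))        = Fin.<-irrefl refl lt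
  <ₕ-asym _ _ (inj₂ (refl , _)) (inj₁ gt)        = Fin.<-irrefl refl gt
  <ₕ-asym _ _ (inj₂ (_ , lt)) (inj₂ (_ , gt))    = ℕ.<-asym lt gt

  <ₕ-cover : ∀ h h′ → _<ₕ_ p h h′ ⊎ _<ₕ_ p h′ h ⊎ h′ ≡ h
  <ₕ-cover (v , i) (w , j) with Fin.<-cmp v w
  ... | tri< lt _ _ = inj₁ (inj₁ lt)
  ... | tri> _ _ gt = inj₂ (inj₁ (inj₁ gt))
  ... | tri≈ _ refl _ with ℕ.<-cmp (toℕ i) (toℕ j)
  ...   | tri< lt _ _ = inj₁ (inj₂ (refl , lt))
  ...   | tri> _ _ gt = inj₂ (inj₁ (inj₂ (refl , gt)))
  ...   | tri≈ _ eq _ = inj₂ (inj₂ (pair-≡ refl (sym eq)))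

  inv-injective : ∀ {h h′} → inv p h ≡ inv p h′ → h ≡ h′
  inv-injective {h} {h′} eq =
    trans (sym (inv-involutive p h)) (trans (cong (inv p) eq) (inv-involutive p h′))

  ∈-halfEdges : ∀ h → h ∈ halfEdges p
  ∈-halfEdges (v , i) = ∈-pairs⁺ (λ v → allFin (arity p v)) (∈-allFin v) (∈-allFin i)

  halfEdges-unique : Unique (halfEdges p)
  halfEdges-unique = pairs-unique (λ v → allFin (arity p v)) (Unique.allFin⁺ (#V p))
                                  (λ v → Unique.allFin⁺ (arity p v))

  length-halfEdges : length (halfEdges p) ≡ sum (map (arity p) (vertices p))
  length-halfEdges = trans (length-pairs (λ v → allFin (arity p v)) (vertices p))
    (cong sum (map-cong (λ v → length-tabulate {n = arity p v} id) (vertices p)))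

  private
    <inv? : ∀ h → Dec (_<ₕ_ p h (inv p h))
    <inv? h = _<ₕ?_ p h (inv p h)

    inv<? : ∀ h → Dec (_<ₕ_ p (inv p h) h)
    inv<? h = _<ₕ?_ p (inv p h) h

    fixed? : ∀ h → Dec (inv p h ≡ h)
    fixed? h = inv p h ≟ₕ h

    lower upper fixed : List (HalfEdge p)
    lower = filter <inv? (halfEdges p)
    upper = filter inv<? (halfEdges p)
    fixed = filter fixed? (halfEdges p)

    upper↭lower : map (inv p) lower ↭ upper
    upper↭lower = unique-↭
      (Unique.map⁺ inv-injective (Unique.filter⁺ <inv? halfEdges-unique))
      (Unique.filter⁺ inv<? halfEdges-unique) to from
      where
      to : ∀ {h} → h ∈ map (inv p) lower → h ∈ upper
      to h∈ with ∈-map⁻ (inv p) h∈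
      ... | h′ , h′∈ , refl = ∈-filter⁺ inv<? (∈-halfEdges _)
        (subst (λ k → _<ₕ_ p k (inv p h′)) (sym (inv-involutive p h′))
               (proj₂ (∈-filter⁻ <inv? {xs = halfEdges p} h′∈)))

      from : ∀ {h} → h ∈ upper → h ∈ map (inv p) lower
      from {h} h∈ = subst (_∈ map (inv p) lower) (inv-involutive p h)
        (∈-map⁺ (inv p) (∈-filter⁺ <inv? (∈-halfEdges (inv p h))
          (subst (_<ₕ_ p (inv p h)) (sym (inv-involutive p h))
                 (proj₂ (∈-filter⁻ inv<? {xs = halfEdges p} h∈)))))

    leaves↭fixed : tabulate (leaf p) ↭ fixed
    leaves↭fixed = unique-↭ (Unique.tabulate⁺ (leaf-injective p))
      (Unique.filter⁺ fixed? halfEdges-unique) to from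
      where
      to : ∀ {h} → h ∈ tabulate (leaf p) → h ∈ fixed
      to h∈ with ∈-tabulate⁻ h∈
      ... | k , refl = ∈-filter⁺ fixed? (∈-halfEdges _) (leaf-fixed p k)

      from : ∀ {h} → h ∈ fixed → h ∈ tabulate (leaf p)
      from {h} h∈ with fixed⇒leaf p h (proj₂ (∈-filter⁻ fixed? {xs = halfEdges p} h∈))
      ... | k , refl = ∈-tabulate⁺ k

  2#E+#L : #E p ℕ.+ #E p ℕ.+ #L p ≡ sum (map (arity p) (vertices p))
  2#E+#L = trans (cong₂ (λ x y → #E p ℕ.+ x ℕ.+ y)
      (trans (sym (length-map (inv p) lower)) (↭.↭-length upper↭lower))
      (trans (sym (length-tabulate (leaf p))) (↭.↭-length leaves↭fixed)))
    (trans (length-filter₃ <inv? inv<? fixed? (λ h → <ₕ-cover h (inv p h))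
              (λ h → <ₕ-asym h (inv p h))
              (λ h lt eq → <ₕ-irrefl h (subst (_<ₕ_ p h) eq lt))
              (λ h lt eq → <ₕ-irrefl h (subst (λ k → _<ₕ_ p k h) eq lt))
              (halfEdges p))
           length-halfEdges)

module SubstitutionProperties {p : OperadicGraph} {part : Vertex p → OperadicGraph}
                              {q : OperadicGraph} (S : Substitution p part q) where
  open Substitution S

  φ : Vertex q → Vertex p
  φ x = proj₁ (Inverse.from bijection x)

  φ-ι : ∀ l u → φ (ι l u) ≡ l
  φ-ι l u = cong proj₁ (Inverse.strictlyInverseʳ bijection (l , u))

  ι-surjective : ∀ x → ∃[ l ] ∃[ u ] ι l u ≡ x
  ι-surjective x = _ , _ , Inverse.strictlyInverseˡ bijection x

  ι-fibre : ∀ x l → φ x ≡ l → ∃[ u ] ι l u ≡ x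
  ι-fibre x _ refl = _ , Inverse.strictlyInverseˡ bijection x

  ι-injective : ∀ {l u v} → ι l u ≡ ι l v → u ≡ v
  ι-injective {l} = mono⇒injective (ι-mono-< l)

  γ-index : ∀ l h → index (γ l h) ≡ index h
  γ-index l (u , i) = Fin.toℕ-cast (ι-arity l u) i

  γ-injective : ∀ {l h h′} → γ l h ≡ γ l h′ → h ≡ h′
  γ-injective {l} {h} {h′} eq = pair-≡ (ι-injective (cong proj₁ eq))
    (trans (sym (γ-index l h)) (trans (cong index eq) (γ-index l h′)))

  γ-fibre : ∀ h l → φ (t q h) ≡ l → ∃[ h′ ] γ l h′ ≡ h
  γ-fibre (x , i) l eq with ι-fibre x l eq
  ... | u , refl = (u , cast (sym (ι-arity l u)) i) ,
                   cong (ι l u ,_) (Fin.cast-involutive (ι-arity l u) (sym (ι-arity l u)) i)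

  φ-γ : ∀ l h → φ (t q (γ l h)) ≡ l
  φ-γ l (u , _) = φ-ι l u

  φ-ψ : ∀ h → φ (t q (ψ h)) ≡ t p h
  φ-ψ (l , i) = φ-γ l (leaf (part l) (cast (sym (part-leaves l)) i))

  ψ-injective : ∀ {h h′} → ψ h ≡ ψ h′ → h ≡ h′
  ψ-injective {l , i} {m , j} eq = go (trans (sym (φ-ψ (l , i))) (trans (cong (φ ∘ t q) eq) (φ-ψ (m , j)))) eq
    where
    go : ∀ {l m} {i : Fin (arity p l)} {j : Fin (arity p m)} →
         l ≡ m → ψ (l , i) ≡ ψ (m , j) → (l , i) ≡ (m , j)
    go {l} {_} {i} {j} refl eq = pair-≡ refl
      (trans (sym (Fin.toℕ-cast _ i))
        (trans (cong toℕ (leaf-injective (part l) (γ-injective eq))) (Fin.toℕ-cast _ j)))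

  ψ-leaf : ∀ l k → ψ (l , cast (part-leaves l) k) ≡ γ l (leaf (part l) k)
  ψ-leaf l k = cong (γ l ∘ leaf (part l)) (Fin.cast-involutive (sym (part-leaves l)) (part-leaves l) k)

  fixed⇒ψ : ∀ l h → inv (part l) h ≡ h → ∃[ i ] ψ (l , i) ≡ γ l h
  fixed⇒ψ l h eq with fixed⇒leaf (part l) h eq
  ... | k , refl = cast (part-leaves l) k , ψ-leaf l k

  ψ⇒fixed : ∀ l h i → ψ (l , i) ≡ γ l h → inv (part l) h ≡ h
  ψ⇒fixed l h i eq with γ-injective eq
  ... | refl = leaf-fixed (part l) _

  internal : ∀ h → ¬ (∃[ h′ ] ψ h′ ≡ h) → φ (t q (inv q h)) ≡ φ (t q h)
  internal h h∉ψ with γ-fibre h _ refl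
  ... | h′ , eq = let l = φ (t q h) in
    trans (cong (φ ∘ t q) (trans (cong (inv q) (sym eq))
            (inv-inner l h′ λ fix → let (i , e) = fixed⇒ψ l h′ fix in h∉ψ ((l , i) , trans e eq))))
          (φ-γ l (inv (part l) h′))

  ι-path : ∀ l {u v} → Star (Adjacent (part l)) u v → Star (Adjacent q) (ι l u) (ι l v)
  ι-path l ε = ε
  ι-path l ((h , refl , refl) ◅ path) with GraphProperties._≟ₕ_ (part l) (inv (part l) h) h
  ... | yes fix = subst (λ k → Star (Adjacent q) (ι l (proj₁ h)) (ι l (proj₁ k)))
                        (sym fix) ε ◅◅ ι-path l path
  ... | no ¬fix = (γ l h , refl , cong proj₁ (inv-inner l h ¬fix)) ◅ ι-path l path

  connected-⊙ : (∀ l → Connected (part l)) → Connected p → Connected q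
  connected-⊙ part-connected p-connected x y with ι-surjective x | ι-surjective y
  ... | l , u , refl | m , v , refl = go u v (p-connected l m)
    where
    go : ∀ {l m} u v → Star (Adjacent p) l m → Star (Adjacent q) (ι l u) (ι m v)
    go {l} u v ε = ι-path l (part-connected l u v)
    go {l} u v ((h , refl , refl) ◅ path) =
      ι-path l (part-connected l u _) ◅◅
      (ψ h , refl , cong proj₁ (inv-outer h)) ◅ go _ v path

  nonempty-⊙ : (∀ l → 1 ℕ.≤ #V (part l)) → 1 ℕ.≤ #V p → 1 ℕ.≤ #V q
  nonempty-⊙ part-nonempty p-nonempty = ℕ.≤-<-trans z≤n (Fin.toℕ<n (ι l (Fin.fromℕ< (part-nonempty l))))
    where
    l : Vertex p
    l = Fin.fromℕ< p-nonempty

  sum-ι : (F : Vertex q → ℕ) →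
          sum (map F (vertices q)) ≡
          sum (map (λ l → sum (map (λ u → F (ι l u)) (vertices (part l)))) (vertices p))
  sum-ι F = trans (sym (sum-↭ (↭.map⁺ F perm)))
    (trans (cong sum (sym (map-∘ lus))) (sum-pairs us (F ∘ Inverse.to bijection) (vertices p)))
    where
    us : ∀ l → List (Vertex (part l))
    us l = vertices (part l)

    lus : List (Σ[ l ∈ Vertex p ] Vertex (part l))
    lus = pairs us (vertices p)

    perm : map (Inverse.to bijection) lus ↭ vertices q
    perm = unique-↭
      (Unique.map⁺ (λ {x} {y} eq → trans (sym (Inverse.strictlyInverseʳ bijection x))
                     (trans (cong (Inverse.from bijection) eq) (Inverse.strictlyInverseʳ bijection y)))
                   (pairs-unique us (Unique.allFin⁺ _) (λ l → Unique.allFin⁺ _)))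
      (Unique.allFin⁺ _) (λ _ → ∈-allFin _)
      (λ {x} _ → subst (_∈ map (Inverse.to bijection) lus) (Inverse.strictlyInverseˡ bijection x)
        (∈-map⁺ (Inverse.to bijection) (∈-pairs⁺ us (∈-allFin _) (∈-allFin _))))

  private
    Σₚ : (Vertex p → ℕ) → ℕ
    Σₚ F = sum (map F (vertices p))

    Σₚ-cong : ∀ {F G : Vertex p → ℕ} → (∀ l → F l ≡ G l) → Σₚ F ≡ Σₚ G
    Σₚ-cong eq = cong sum (map-cong eq (vertices p))

    sum-1 : ∀ n → sum (map (λ _ → 1) (allFin n)) ≡ n
    sum-1 n = trans (sum-map-1 (allFin n)) (length-tabulate {n = n} id)

    double-injective : ∀ a b → a ℕ.+ a ≡ b ℕ.+ b → a ≡ b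
    double-injective a b eq = ℕ.*-cancelˡ-≡ a b 2
      (trans (cong (a ℕ.+_) (ℕ.+-identityʳ a)) (trans eq (cong (b ℕ.+_) (sym (ℕ.+-identityʳ b)))))

  #V-⊙ : #V q ≡ Σₚ (λ l → #V (part l))
  #V-⊙ = trans (sym (sum-1 (#V q))) (trans (sum-ι (λ _ → 1)) (Σₚ-cong (λ l → sum-1 (#V (part l)))))

  #E-⊙ : #E q ≡ Σₚ (λ l → #E (part l)) ℕ.+ #E p
  #E-⊙ = double-injective _ _ (ℕ.+-cancelʳ-≡ (#L q) _ _ (begin
    #E q ℕ.+ #E q ℕ.+ #L q
      ≡⟨ GraphProperties.2#E+#L q ⟩
    sum (map (arity q) (vertices q))
      ≡⟨ sum-ι (arity q) ⟩
    Σₚ (λ l → sum (map (λ u → arity q (ι l u)) (vertices (part l))))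
      ≡⟨ Σₚ-cong (λ l → cong sum (map-cong (λ u → sym (ι-arity l u)) (vertices (part l)))) ⟩
    Σₚ (λ l → sum (map (arity (part l)) (vertices (part l))))
      ≡⟨ Σₚ-cong (λ l → trans (sym (GraphProperties.2#E+#L (part l)))
                              (cong (#E (part l) ℕ.+ #E (part l) ℕ.+_) (part-leaves l))) ⟩
    Σₚ (λ l → #E (part l) ℕ.+ #E (part l) ℕ.+ arity p l)
      ≡⟨ sum-map-+ (λ l → #E (part l) ℕ.+ #E (part l)) (arity p) (vertices p) ⟩
    Σₚ (λ l → #E (part l) ℕ.+ #E (part l)) ℕ.+ Σₚ (arity p)
      ≡⟨ cong₂ ℕ._+_ (sum-map-+ (#E ∘ part) (#E ∘ part) (vertices p))
                     (sym (GraphProperties.2#E+#L p)) ⟩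
    ΣE ℕ.+ ΣE ℕ.+ (#E p ℕ.+ #E p ℕ.+ #L p)
      ≡⟨ rearrange ΣE (#E p) (#L p) ⟩
    (ΣE ℕ.+ #E p) ℕ.+ (ΣE ℕ.+ #E p) ℕ.+ #L p
      ≡⟨ cong ((ΣE ℕ.+ #E p) ℕ.+ (ΣE ℕ.+ #E p) ℕ.+_) #L-≡ ⟩
    (ΣE ℕ.+ #E p) ℕ.+ (ΣE ℕ.+ #E p) ℕ.+ #L q ∎))
    where
    open ≡-Reasoning

    ΣE : ℕ
    ΣE = Σₚ (#E ∘ part)

    rearrange : ∀ a b c → a ℕ.+ a ℕ.+ (b ℕ.+ b ℕ.+ c) ≡ (a ℕ.+ b) ℕ.+ (a ℕ.+ b) ℕ.+ c
    rearrange = ℕSolver.solve-∀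

  -- If every part has the total genus prescribed by p, then p and q have the
  -- same total genus.
  module _ (gₚ : Vertex p → ℕ) (gᵤ : ∀ l → Vertex (part l) → ℕ) (g : Vertex q → ℕ)
           (g-ι : ∀ l u → g (ι l u) ≡ gᵤ l u)
           (g-part : ∀ l → + gₚ l ≡ + sum (map (gᵤ l) (vertices (part l))) ℤ.+ betti (part l)) where
    private
      Σg : ∀ l → ℕ
      Σg l = sum (map (gᵤ l) (vertices (part l)))

      local : ∀ l → gₚ l ℕ.+ #V (part l) ≡ Σg l ℕ.+ #E (part l) ℕ.+ 1
      local l = ℤ.+-injective (trans (cong (ℤ._+ + #V (part l)) (g-part l))
                                     (rearrange (+ Σg l) (+ #E (part l)) (+ #V (part l))))
        where
        rearrange : ∀ s e v → s ℤ.+ (e ℤ.- v ℤ.+ + 1) ℤ.+ v ≡ s ℤ.+ e ℤ.+ + 1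
        rearrange = solve-∀

      global : Σₚ gₚ ℕ.+ #V q ≡ sum (map g (vertices q)) ℕ.+ Σₚ (#E ∘ part) ℕ.+ #V p
      global = begin
        Σₚ gₚ ℕ.+ #V q
          ≡⟨ cong (Σₚ gₚ ℕ.+_) #V-⊙ ⟩
        Σₚ gₚ ℕ.+ Σₚ (#V ∘ part)
          ≡⟨ sum-map-+ gₚ (#V ∘ part) (vertices p) ⟨
        Σₚ (λ l → gₚ l ℕ.+ #V (part l))
          ≡⟨ Σₚ-cong local ⟩
        Σₚ (λ l → Σg l ℕ.+ #E (part l) ℕ.+ 1)
          ≡⟨ sum-map-+ (λ l → Σg l ℕ.+ #E (part l)) (λ _ → 1) (vertices p) ⟩
        Σₚ (λ l → Σg l ℕ.+ #E (part l)) ℕ.+ Σₚ (λ _ → 1)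
          ≡⟨ cong₂ ℕ._+_ (sum-map-+ Σg (#E ∘ part) (vertices p)) (sum-1 (#V p)) ⟩
        Σₚ Σg ℕ.+ Σₚ (#E ∘ part) ℕ.+ #V p
          ≡⟨ cong (λ k → k ℕ.+ Σₚ (#E ∘ part) ℕ.+ #V p) Σg≡ ⟨
        sum (map g (vertices q)) ℕ.+ Σₚ (#E ∘ part) ℕ.+ #V p ∎
        where
        open ≡-Reasoning

        Σg≡ : sum (map g (vertices q)) ≡ Σₚ Σg
        Σg≡ = trans (sum-ι g) (Σₚ-cong (λ l → cong sum (map-cong (g-ι l) (vertices (part l)))))

    totalGenus-⊙ : + Σₚ gₚ ℤ.+ betti p ≡ + sum (map g (vertices q)) ℤ.+ betti q
    totalGenus-⊙ = begin
      + Σₚ gₚ ℤ.+ (+ #E p ℤ.- + #V p ℤ.+ + 1)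
        ≡⟨ before (+ Σₚ gₚ) (+ #E p) (+ #V p) (+ #V q) ⟩
      (+ Σₚ gₚ ℤ.+ + #V q) ℤ.+ (+ #E p ℤ.- + #V p ℤ.- + #V q ℤ.+ + 1)
        ≡⟨ cong (λ k → k ℤ.+ (+ #E p ℤ.- + #V p ℤ.- + #V q ℤ.+ + 1)) (cong +_ global) ⟩
      (+ G ℤ.+ + ΣE ℤ.+ + #V p) ℤ.+ (+ #E p ℤ.- + #V p ℤ.- + #V q ℤ.+ + 1)
        ≡⟨ after (+ G) (+ ΣE) (+ #E p) (+ #V p) (+ #V q) ⟩
      + G ℤ.+ (+ ΣE ℤ.+ + #E p ℤ.- + #V q ℤ.+ + 1)
        ≡⟨ cong (λ k → + G ℤ.+ (+ k ℤ.- + #V q ℤ.+ + 1)) #E-⊙ ⟨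
      + G ℤ.+ (+ #E q ℤ.- + #V q ℤ.+ + 1) ∎
      where
      open ≡-Reasoning

      G ΣE : ℕ
      G  = sum (map g (vertices q))
      ΣE = Σₚ (#E ∘ part)

      before : ∀ s e v w → s ℤ.+ (e ℤ.- v ℤ.+ + 1) ≡ (s ℤ.+ w) ℤ.+ (e ℤ.- v ℤ.- w ℤ.+ + 1)
      before = solve-∀

      after : ∀ g s e v w → (g ℤ.+ s ℤ.+ v) ℤ.+ (e ℤ.- v ℤ.- w ℤ.+ + 1) ≡ g ℤ.+ (s ℤ.+ e ℤ.- w ℤ.+ + 1)
      after = solve-∀

-- A substitution is determined by its maps φ and ψ.
module _ {p : OperadicGraph} {part part′ : Vertex p → OperadicGraph} {q : OperadicGraph}
         (S : Substitution p part q) (S′ : Substitution p part′ q) where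
  private
    module S = Substitution S
    module S′ = Substitution S′
    module SP = SubstitutionProperties S
    module SP′ = SubstitutionProperties S′

  module _ (φ-≡ : ∀ x → SP.φ x ≡ SP′.φ x) (ψ-≡ : ∀ h → S.ψ h ≡ S′.ψ h) where
    module _ (l : Vertex p) where
      private
        S⊆S′ : ∀ u → ∃[ v ] S′.ι l v ≡ S.ι l u
        S⊆S′ u = SP′.ι-fibre _ l (trans (sym (φ-≡ _)) (SP.φ-ι l u))

        S′⊆S : ∀ u → ∃[ v ] S.ι l v ≡ S′.ι l u
        S′⊆S u = SP.ι-fibre _ l (trans (φ-≡ _) (SP′.φ-ι l u))

      size-≡ : #V (part l) ≡ #V (part′ l)
      size-≡ = enumerations-size (S.ι-mono-< l) (S′.ι-mono-< l) S⊆S′ S′⊆S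

      ι-≡ : ∀ u → S.ι l u ≡ S′.ι l (cast size-≡ u)
      ι-≡ = enumerations-≡ (S.ι-mono-< l) (S′.ι-mono-< l) S⊆S′ S′⊆S

      part-arity-≡ : ∀ u → arity (part l) u ≡ arity (part′ l) (cast size-≡ u)
      part-arity-≡ u = trans (S.ι-arity l u) (trans (cong (arity q) (ι-≡ u)) (sym (S′.ι-arity l _)))

      private
        half : HalfEdge (part l) → HalfEdge (part′ l)
        half (u , i) = cast size-≡ u , cast (part-arity-≡ u) i

        γ-half : ∀ h → S′.γ l (half h) ≡ S.γ l h
        γ-half (u , i) = pair-≡ (sym (ι-≡ u))
          (trans (SP′.γ-index l (half (u , i)))
            (trans (Fin.toℕ-cast (part-arity-≡ u) i) (sym (SP.γ-index l (u , i)))))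

        half-inv : ∀ h → inv (part′ l) (half h) ≡ half (inv (part l) h)
        half-inv h = by-cases (GraphProperties._≟ₕ_ (part l) (inv (part l) h) h)
          where
          open ≡-Reasoning

          fix′ : inv (part l) h ≡ h → inv (part′ l) (half h) ≡ half h
          fix′ fix = let (i , eq) = SP.fixed⇒ψ l h fix in
            SP′.ψ⇒fixed l (half h) i (trans (sym (ψ-≡ (l , i))) (trans eq (sym (γ-half h))))

          ¬fix′ : inv (part l) h ≢ h → inv (part′ l) (half h) ≢ half h
          ¬fix′ ¬fix fix = let (i , eq) = SP′.fixed⇒ψ l (half h) fix in
            ¬fix (SP.ψ⇒fixed l h i (trans (ψ-≡ (l , i)) (trans eq (γ-half h))))

          by-cases : Dec (inv (part l) h ≡ h) → inv (part′ l) (half h) ≡ half (inv (part l) h)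
          by-cases (yes fix) = trans (fix′ fix) (cong half (sym fix))
          by-cases (no ¬fix) = SP′.γ-injective (begin
            S′.γ l (inv (part′ l) (half h)) ≡⟨ S′.inv-inner l (half h) (¬fix′ ¬fix) ⟨
            inv q (S′.γ l (half h))         ≡⟨ cong (inv q) (γ-half h) ⟩
            inv q (S.γ l h)                 ≡⟨ S.inv-inner l h ¬fix ⟩
            S.γ l (inv (part l) h)          ≡⟨ γ-half (inv (part l) h) ⟨
            S′.γ l (half (inv (part l) h))  ∎)

        half-leaf : ∀ k → leaf (part′ l) (cast (trans (S.part-leaves l) (sym (S′.part-leaves l))) k)
                          ≡ half (leaf (part l) k)
        half-leaf k = SP′.γ-injective (begin
          S′.γ l (leaf (part′ l) (cast _ k))
            ≡⟨ cong (S′.γ l ∘ leaf (part′ l)) (Fin.cast-trans (S.part-leaves l) (sym (S′.part-leaves l)) k) ⟨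
          S′.ψ (l , cast (S.part-leaves l) k) ≡⟨ ψ-≡ _ ⟨
          S.ψ (l , cast (S.part-leaves l) k)  ≡⟨ SP.ψ-leaf l k ⟩
          S.γ l (leaf (part l) k)             ≡⟨ γ-half (leaf (part l) k) ⟨
          S′.γ l (half (leaf (part l) k))     ∎)
          where open ≡-Reasoning

      part-≅ : part l ≅ part′ l
      part-≅ = record
        { #V-≡ = size-≡
        ; #L-≡ = trans (S.part-leaves l) (sym (S′.part-leaves l))
        ; arity-≡ = part-arity-≡
        ; inv-≡ = half-inv
        ; leaf-≡ = half-leaf
        }

  module _ (e : ∀ l → part l ≅ part′ l) (ι-≡ : ∀ l u → S.ι l u ≡ S′.ι l (_≅_.onVertex (e l) u)) where

    ≅⇒φ-≡ : ∀ x → SP.φ x ≡ SP′.φ x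
    ≅⇒φ-≡ x with SP.ι-surjective x
    ... | l , u , refl = trans (SP.φ-ι l u) (sym (trans (cong SP′.φ (ι-≡ l u)) (SP′.φ-ι l _)))

    ≅⇒ψ-≡ : ∀ h → S.ψ h ≡ S′.ψ h
    ≅⇒ψ-≡ (l , i) = begin
      S.γ l (leaf (part l) i′)              ≡⟨ γ-≡ (leaf (part l) i′) ⟩
      S′.γ l (onHalfEdge (leaf (part l) i′)) ≡⟨ cong (S′.γ l) (leaf-≡ i′) ⟨
      S′.γ l (leaf (part′ l) (cast #L-≡ i′))
        ≡⟨ cong (S′.γ l ∘ leaf (part′ l)) (Fin.cast-trans (sym (S.part-leaves l)) #L-≡ i) ⟩
      S′.ψ (l , i) ∎
      where
      open ≡-Reasoning
      open _≅_ (e l)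

      i′ : Fin (#L (part l))
      i′ = cast (sym (S.part-leaves l)) i

      γ-≡ : ∀ h → S.γ l h ≡ S′.γ l (onHalfEdge h)
      γ-≡ (u , j) = pair-≡ (ι-≡ l u) (trans (SP.γ-index l (u , j))
        (sym (trans (SP′.γ-index l (onHalfEdge (u , j))) (Fin.toℕ-cast (arity-≡ u) j))))

-- The maps φ and ψ of a substitution, without the parts.
record Collapse (p q : OperadicGraph) : Set where
  field
    φ : Vertex q → Vertex p
    ψ : HalfEdge p → HalfEdge q
    φ-ψ         : ∀ h → φ (t q (ψ h)) ≡ t p h
    ψ-injective : ∀ {h h′} → ψ h ≡ ψ h′ → h ≡ h′
    ψ-inv       : ∀ h → inv q (ψ h) ≡ ψ (inv p h)
    #L-≡        : #L p ≡ #L q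
    ψ-leaf      : ∀ k → leaf q (cast #L-≡ k) ≡ ψ (leaf p k)
    internal    : ∀ h → ¬ (∃[ h′ ] ψ h′ ≡ h) → φ (t q (inv q h)) ≡ φ (t q h)

  ψ-fibre : ∀ {h h′} l → ψ h′ ≡ h → φ (t q h) ≡ l → ∃[ i ] ψ (l , i) ≡ h
  ψ-fibre {h′ = m , i} l refl eq with trans (sym (φ-ψ (m , i))) eq
  ... | refl = i , refl

  ψ? : ∀ h → Dec (∃[ h′ ] ψ h′ ≡ h)
  ψ? h = map′ (λ (i , eq) → _ , eq) (λ (_ , eq) → ψ-fibre _ eq refl)
              (Fin.any? (λ i → GraphProperties._≟ₕ_ q (ψ (φ (t q h) , i)) h))

collapse : ∀ {p part q} → Substitution p part q → Collapse p q
collapse S = record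
  { φ = φ ; ψ = ψ ; φ-ψ = φ-ψ ; ψ-injective = ψ-injective ; ψ-inv = inv-outer
  ; #L-≡ = #L-≡ ; ψ-leaf = leaf-outer ; internal = internal }
  where
  open Substitution S
  open SubstitutionProperties S using (φ; φ-ψ; ψ-injective; internal)

_⊙_ : ∀ {p q r} → Collapse q r → Collapse p q → Collapse p r
_⊙_ {p} {q} {r} G F = record
  { φ = F.φ ∘ G.φ
  ; ψ = G.ψ ∘ F.ψ
  ; φ-ψ = λ h → trans (cong F.φ (G.φ-ψ (F.ψ h))) (F.φ-ψ h)
  ; ψ-injective = F.ψ-injective ∘ G.ψ-injective
  ; ψ-inv = λ h → trans (G.ψ-inv (F.ψ h)) (cong G.ψ (F.ψ-inv h))
  ; #L-≡ = trans F.#L-≡ G.#L-≡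
  ; ψ-leaf = λ k → trans (cong (leaf r) (sym (Fin.cast-trans F.#L-≡ G.#L-≡ k)))
                         (trans (G.ψ-leaf (cast F.#L-≡ k)) (cong G.ψ (F.ψ-leaf k)))
  ; internal = internal
  }
  where
  module F = Collapse F
  module G = Collapse G

  internal : ∀ h → ¬ (∃[ h′ ] G.ψ (F.ψ h′) ≡ h) → F.φ (G.φ (t r (inv r h))) ≡ F.φ (G.φ (t r h))
  internal h ∉ψ with G.ψ? h
  ... | no ∉ψ′ = cong F.φ (G.internal h ∉ψ′)
  ... | yes (h′ , refl) = begin
    F.φ (G.φ (t r (inv r (G.ψ h′)))) ≡⟨ cong (F.φ ∘ G.φ ∘ t r) (G.ψ-inv h′) ⟩
    F.φ (G.φ (t r (G.ψ (inv q h′)))) ≡⟨ cong F.φ (G.φ-ψ (inv q h′)) ⟩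
    F.φ (t q (inv q h′))             ≡⟨ F.internal h′ (λ { (k , refl) → ∉ψ (k , refl) }) ⟩
    F.φ (t q h′)                     ≡⟨ cong F.φ (G.φ-ψ h′) ⟨
    F.φ (G.φ (t r (G.ψ h′)))         ∎
    where open ≡-Reasoning

-- The parts of the substitution with given φ and ψ: the l-th part is cut out
-- of q by the vertices over l, and its leaves are the half-edges ψ (l , i).
module Parts {p q : OperadicGraph} (C : Collapse p q) where
  open Collapse C

  module _ (l : Vertex p) where
    private
      module E = Enumeration (enumerate (λ x → φ x Fin.≟ l))

      HE : Set
      HE = Σ[ w ∈ Fin E.size ] Fin (arity q (E.enum w))

    push : HE → HalfEdge q
    push (w , i) = E.enum w , i

    push-injective : ∀ {h h′} → push h ≡ push h′ → h ≡ h′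
    push-injective {_ , _} {_ , _} eq = pair-≡ (mono⇒injective E.mono (cong proj₁ eq)) (cong index eq)

    private
      over : ∀ h → φ (t q (push h)) ≡ l
      over (w , _) = E.sound w

    pull : ∀ h → φ (t q h) ≡ l → ∃[ h′ ] push h′ ≡ h
    pull (x , i) eq with E.complete x eq
    ... | w , refl = (w , i) , refl

    private
      inv-with : ∀ h → Dec (∃[ h′ ] ψ h′ ≡ push h) → HE
      inv-with h (yes _) = h
      inv-with h (no ∉ψ) = proj₁ (pull (inv q (push h)) (trans (internal (push h) ∉ψ) (over h)))

    -- Opaque only to keep conversion checking fast; invₗ-leaf and invₗ-inner
    -- characterise it.
    opaque
      invₗ : HE → HE
      invₗ h = inv-with h (ψ? (push h))

      invₗ-leaf : ∀ h → (∃[ h′ ] ψ h′ ≡ push h) → invₗ h ≡ h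
      invₗ-leaf h ∈ψ with ψ? (push h)
      ... | yes _ = refl
      ... | no ∉ψ = contradiction ∈ψ ∉ψ

      invₗ-inner : ∀ h → ¬ (∃[ h′ ] ψ h′ ≡ push h) → push (invₗ h) ≡ inv q (push h)
      invₗ-inner h ∉ψ with ψ? (push h)
      ... | yes ∈ψ = contradiction ∈ψ ∉ψ
      ... | no _ = proj₂ (pull (inv q (push h)) _)

    private
      ∉ψ-inv : ∀ h → ¬ (∃[ h′ ] ψ h′ ≡ h) → ¬ (∃[ h′ ] ψ h′ ≡ inv q h)
      ∉ψ-inv h ∉ψ (h′ , eq) =
        ∉ψ (inv p h′ , trans (sym (ψ-inv h′)) (trans (cong (inv q) eq) (inv-involutive q h)))

      invₗ-involutive : ∀ h → invₗ (invₗ h) ≡ h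
      invₗ-involutive h = go (ψ? (push h))
        where
        go : Dec (∃[ h′ ] ψ h′ ≡ push h) → invₗ (invₗ h) ≡ h
        go (yes ∈ψ) = trans (cong invₗ (invₗ-leaf h ∈ψ)) (invₗ-leaf h ∈ψ)
        go (no ∉ψ)  = push-injective (begin
          push (invₗ (invₗ h)) ≡⟨ invₗ-inner (invₗ h) (λ (h′ , eq) →
                                   ∉ψ-inv (push h) ∉ψ (h′ , trans eq (invₗ-inner h ∉ψ))) ⟩
          inv q (push (invₗ h))  ≡⟨ cong (inv q) (invₗ-inner h ∉ψ) ⟩
          inv q (inv q (push h)) ≡⟨ inv-involutive q (push h) ⟩
          push h                 ∎)
          where open ≡-Reasoning

      leafₗ : Fin (arity p l) → HE
      leafₗ i = proj₁ (pull (ψ (l , i)) (φ-ψ (l , i)))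

    push-leaf : ∀ i → push (leafₗ i) ≡ ψ (l , i)
    push-leaf i = proj₂ (pull (ψ (l , i)) (φ-ψ (l , i)))

    private
      leafₗ-injective : ∀ {i j} → leafₗ i ≡ leafₗ j → i ≡ j
      leafₗ-injective {i} {j} eq with ψ-injective (trans (sym (push-leaf i)) (trans (cong push eq) (push-leaf j)))
      ... | refl = refl

      fixed⇒leafₗ : ∀ h → invₗ h ≡ h → ∃[ i ] leafₗ i ≡ h
      fixed⇒leafₗ h fix = go (ψ? (push h))
        where
        go : Dec (∃[ h′ ] ψ h′ ≡ push h) → ∃[ i ] leafₗ i ≡ h
        go (yes (h′ , eq)) = let (i , eq′) = ψ-fibre l eq (over h) in
          i , push-injective (trans (push-leaf i) eq′)
        go (no ∉ψ) with fixed⇒leaf q (push h) (trans (sym (invₗ-inner h ∉ψ)) (cong push fix))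
        ... | k , eq = contradiction
          (leaf p (cast (sym #L-≡) k) ,
           trans (sym (ψ-leaf _)) (trans (cong (leaf q) (Fin.cast-involutive #L-≡ (sym #L-≡) k)) eq)) ∉ψ

    cut : OperadicGraph
    cut = record
      { #V = E.size
      ; arity = arity q ∘ E.enum
      ; #L = arity p l
      ; inv = invₗ
      ; inv-involutive = invₗ-involutive
      ; leaf = leafₗ
      ; leaf-injective = leafₗ-injective
      ; leaf-fixed = λ i → invₗ-leaf (leafₗ i) ((l , i) , sym (push-leaf i))
      ; fixed⇒leaf = fixed⇒leafₗ
      }

    κ : Vertex cut → Vertex q
    κ = E.enum

    κ-mono-< : ∀ {u v} → u Fin.< v → κ u Fin.< κ v
    κ-mono-< = E.mono

    κ-fibre : ∀ x → φ x ≡ l → ∃[ u ] κ u ≡ x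
    κ-fibre = E.complete

    φ-κ : ∀ u → φ (κ u) ≡ l
    φ-κ = E.sound

  private
    γ′ : ∀ l → HalfEdge (cut l) → HalfEdge q
    γ′ l (u , i) = κ l u , cast refl i

    γ′-push : ∀ l h → γ′ l h ≡ push l h
    γ′-push l (u , i) = cong (κ l u ,_) (Fin.cast-is-id refl i)

    ψ′-ψ : ∀ h → γ′ (proj₁ h) (leaf (cut (proj₁ h)) (cast refl (proj₂ h))) ≡ ψ h
    ψ′-ψ (l , i) = trans (γ′-push l _) (trans (cong (push l ∘ leaf (cut l)) (Fin.cast-is-id refl i))
                                             (push-leaf l i))

    inner : ∀ l h → inv (cut l) h ≢ h → inv q (γ′ l h) ≡ γ′ l (inv (cut l) h)
    inner l h ¬fix = trans (cong (inv q) (γ′-push l h))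
      (trans (sym (invₗ-inner l h (λ ∈ψ → ¬fix (invₗ-leaf l h ∈ψ))))
             (sym (γ′-push l (inv (cut l) h))))

    bij-from : ∀ x → Σ[ l ∈ Vertex p ] Vertex (cut l)
    bij-from x = φ x , proj₁ (κ-fibre (φ x) x refl)

    bij-from-to : ∀ y → bij-from (κ (proj₁ y) (proj₂ y)) ≡ y
    bij-from-to (l , u) with κ l u in eq | φ-κ l u
    ... | x | refl = cong (φ x ,_) (mono⇒injective (κ-mono-< _) (trans (proj₂ (κ-fibre (φ x) x refl)) (sym eq)))

  reconstruct : Substitution p cut q
  reconstruct = record
    { part-leaves = λ _ → refl
    ; bijection = mk↔ₛ′ (λ (l , u) → κ l u) bij-from (λ x → proj₂ (κ-fibre (φ x) x refl)) bij-from-to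
    ; ι-mono-< = κ-mono-<
    ; ι-arity = λ _ _ → refl
    ; #L-≡ = #L-≡
    ; inv-inner = inner
    ; inv-outer = λ h → trans (cong (inv q) (ψ′-ψ h)) (trans (ψ-inv h) (sym (ψ′-ψ (inv p h))))
    ; leaf-outer = λ k → trans (ψ-leaf k) (sym (ψ′-ψ (leaf p k)))
    }

  reconstruct-ψ : ∀ h → Substitution.ψ reconstruct h ≡ ψ h
  reconstruct-ψ = ψ′-ψ

-- Substituting twice, in q and then in the result r, amounts to substituting
-- once in p, the l-th part being obtained by substituting part′ (ι l u) into
-- each vertex u of part l.
module Iterated {p : OperadicGraph} {part : Vertex p → OperadicGraph} {q : OperadicGraph}
                {part′ : Vertex q → OperadicGraph} {r : OperadicGraph}
                (F : Substitution p part q) (G : Substitution q part′ r) where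
  private
    module F = Substitution F
    module G = Substitution G
    module FP = SubstitutionProperties F
    module GP = SubstitutionProperties G

  open Parts (collapse G ⊙ collapse F) public

  module _ (l : Vertex p) where
    private
      ι-over : ∀ u x → FP.φ (GP.φ (G.ι (F.ι l u) x)) ≡ l
      ι-over u x = trans (cong FP.φ (GP.φ-ι (F.ι l u) x)) (FP.φ-ι l u)

      ι₂ : (u : Vertex (part l)) → Vertex (part′ (F.ι l u)) → Vertex (cut l)
      ι₂ u x = proj₁ (κ-fibre l (G.ι (F.ι l u) x) (ι-over u x))

      κ-ι₂ : ∀ u x → κ l (ι₂ u x) ≡ G.ι (F.ι l u) x
      κ-ι₂ u x = proj₂ (κ-fibre l (G.ι (F.ι l u) x) (ι-over u x))

      ι₂′ : (Σ[ u ∈ Vertex (part l) ] Vertex (part′ (F.ι l u))) → Vertex (cut l)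
      ι₂′ (u , x) = ι₂ u x

      ι₂-injective : ∀ {y y′} → ι₂′ y ≡ ι₂′ y′ → y ≡ y′
      ι₂-injective {u , x} {u′ , x′} eq =
        go (FP.ι-injective (trans (sym (GP.φ-ι _ x)) (trans (cong GP.φ eq′) (GP.φ-ι _ x′)))) eq′
        where
        eq′ : G.ι (F.ι l u) x ≡ G.ι (F.ι l u′) x′
        eq′ = trans (sym (κ-ι₂ u x)) (trans (cong (κ l) eq) (κ-ι₂ u′ x′))

        go : ∀ {u u′ x x′} → u ≡ u′ → G.ι (F.ι l u) x ≡ G.ι (F.ι l u′) x′ → (u , x) ≡ (u′ , x′)
        go {u} refl eq = cong (u ,_) (GP.ι-injective eq)

      ι₂-surjective : ∀ w → ∃[ y ] ι₂′ y ≡ w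
      ι₂-surjective w with FP.ι-fibre (GP.φ (κ l w)) l (φ-κ l w)
      ... | u , eq with GP.ι-fibre (κ l w) (F.ι l u) (sym eq)
      ...   | x , eq′ = (u , x) , mono⇒injective (κ-mono-< l) (trans (κ-ι₂ u x) eq′)

      leaves₂ : ∀ u → #L (part′ (F.ι l u)) ≡ arity (part l) u
      leaves₂ u = trans (G.part-leaves (F.ι l u)) (sym (F.ι-arity l u))

      arity₂ : ∀ u x → arity (part′ (F.ι l u)) x ≡ arity (cut l) (ι₂ u x)
      arity₂ u x = trans (G.ι-arity (F.ι l u) x) (cong (arity r) (sym (κ-ι₂ u x)))

      mono₂ : ∀ u {x y} → x Fin.< y → ι₂ u x Fin.< ι₂ u y
      mono₂ u {x} {y} lt = mono⇒reflects (κ-mono-< l)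
        (subst (Fin._< κ l (ι₂ u y)) (sym (κ-ι₂ u x))
          (subst (G.ι (F.ι l u) x Fin.<_) (sym (κ-ι₂ u y)) (G.ι-mono-< (F.ι l u) lt)))

      γ₂ : ∀ u → HalfEdge (part′ (F.ι l u)) → HalfEdge (cut l)
      γ₂ u (x , i) = ι₂ u x , cast (arity₂ u x) i

      push-γ₂ : ∀ u h → push l (γ₂ u h) ≡ G.γ (F.ι l u) h
      push-γ₂ u (x , i) = pair-≡ (κ-ι₂ u x)
        (trans (Fin.toℕ-cast (arity₂ u x) i) (sym (Fin.toℕ-cast (G.ι-arity (F.ι l u) x) i)))

      ψ₂ : HalfEdge (part l) → HalfEdge (cut l)
      ψ₂ (u , i) = γ₂ u (leaf (part′ (F.ι l u)) (cast (sym (leaves₂ u)) i))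

      push-ψ₂ : ∀ h → push l (ψ₂ h) ≡ G.ψ (F.γ l h)
      push-ψ₂ (u , i) = trans (push-γ₂ u (leaf (part′ (F.ι l u)) (cast (sym (leaves₂ u)) i)))
        (cong (λ k → G.γ (F.ι l u) (leaf (part′ (F.ι l u)) k))
              (sym (Fin.cast-trans (F.ι-arity l u) (sym (G.part-leaves (F.ι l u))) i)))

      inner₂ : ∀ u h → inv (part′ (F.ι l u)) h ≢ h →
               inv (cut l) (γ₂ u h) ≡ γ₂ u (inv (part′ (F.ι l u)) h)
      inner₂ u h ¬fix = push-injective l (begin
        push l (inv (cut l) (γ₂ u h)) ≡⟨ invₗ-inner l (γ₂ u h) ∉ψ ⟩
        inv r (push l (γ₂ u h))       ≡⟨ cong (inv r) (push-γ₂ u h) ⟩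
        inv r (G.γ (F.ι l u) h)       ≡⟨ G.inv-inner (F.ι l u) h ¬fix ⟩
        G.γ (F.ι l u) h⁻              ≡⟨ push-γ₂ u h⁻ ⟨
        push l (γ₂ u h⁻)              ∎)
        where
        open ≡-Reasoning

        h⁻ : HalfEdge (part′ (F.ι l u))
        h⁻ = inv (part′ (F.ι l u)) h

        ∉ψ : ¬ (∃[ h′ ] G.ψ (F.ψ h′) ≡ push l (γ₂ u h))
        ∉ψ (h′ , eq) =
          let (i , eq″) = Collapse.ψ-fibre (collapse G) {h = G.γ (F.ι l u) h} (F.ι l u)
                            (trans eq (push-γ₂ u h)) (GP.φ-γ (F.ι l u) h)
          in ¬fix (GP.ψ⇒fixed (F.ι l u) h i eq″)

      outer₂ : ∀ h → inv (cut l) (ψ₂ h) ≡ ψ₂ (inv (part l) h)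
      outer₂ h = by-cases (GraphProperties._≟ₕ_ (part l) (inv (part l) h) h)
        where
        open ≡-Reasoning

        ∈ψ : inv (part l) h ≡ h → ∃[ h′ ] G.ψ (F.ψ h′) ≡ push l (ψ₂ h)
        ∈ψ fix = let (i , eq) = FP.fixed⇒ψ l h fix in (l , i) , trans (cong G.ψ eq) (sym (push-ψ₂ h))

        ∉ψ : inv (part l) h ≢ h → ¬ (∃[ h′ ] G.ψ (F.ψ h′) ≡ push l (ψ₂ h))
        ∉ψ ¬fix (h′ , eq) =
          let (i , eq″) = Collapse.ψ-fibre (collapse F) {h = F.γ l h} l
                            (GP.ψ-injective (trans eq (push-ψ₂ h))) (FP.φ-γ l h)
          in ¬fix (FP.ψ⇒fixed l h i eq″)

        by-cases : Dec (inv (part l) h ≡ h) → inv (cut l) (ψ₂ h) ≡ ψ₂ (inv (part l) h)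
        by-cases (yes fix) = trans (invₗ-leaf l (ψ₂ h) (∈ψ fix)) (cong ψ₂ (sym fix))
        by-cases (no ¬fix) = push-injective l (begin
          push l (inv (cut l) (ψ₂ h))    ≡⟨ invₗ-inner l (ψ₂ h) (∉ψ ¬fix) ⟩
          inv r (push l (ψ₂ h))          ≡⟨ cong (inv r) (push-ψ₂ h) ⟩
          inv r (G.ψ (F.γ l h))          ≡⟨ G.inv-outer (F.γ l h) ⟩
          G.ψ (inv q (F.γ l h))          ≡⟨ cong G.ψ (F.inv-inner l h ¬fix) ⟩
          G.ψ (F.γ l (inv (part l) h))   ≡⟨ push-ψ₂ (inv (part l) h) ⟨
          push l (ψ₂ (inv (part l) h))   ∎)

      leaf₂ : ∀ k → leaf (cut l) (cast (F.part-leaves l) k) ≡ ψ₂ (leaf (part l) k)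
      leaf₂ k = push-injective l (trans (push-leaf l (cast (F.part-leaves l) k))
        (trans (cong G.ψ (FP.ψ-leaf l k)) (sym (push-ψ₂ (leaf (part l) k)))))

    cut-substitution : Substitution (part l) (λ u → part′ (F.ι l u)) (cut l)
    cut-substitution = record
      { part-leaves = leaves₂
      ; bijection = mk↔ₛ′ ι₂′ (proj₁ ∘ ι₂-surjective) (proj₂ ∘ ι₂-surjective)
          (λ y → ι₂-injective (proj₂ (ι₂-surjective (ι₂′ y))))
      ; ι-mono-< = mono₂
      ; ι-arity = arity₂
      ; #L-≡ = F.part-leaves l
      ; inv-inner = inner₂
      ; inv-outer = outer₂
      ; leaf-outer = leaf₂
      }

    κ-cut-ι : ∀ u x → κ l (Substitution.ι cut-substitution u x) ≡ G.ι (F.ι l u) x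
    κ-cut-ι = κ-ι₂

corolla : ℕ → OperadicGraph
corolla n = record
  { #V = 1
  ; arity = λ _ → n
  ; #L = n
  ; inv = id
  ; inv-involutive = λ _ → refl
  ; leaf = zero ,_
  ; leaf-injective = λ { refl → refl }
  ; leaf-fixed = λ _ → refl
  ; fixed⇒leaf = λ { (zero , i) _ → i , refl }
  }

genusCorolla : ℕ → ℕ → GenusGraph
genusCorolla g n = record
  { graph = corolla n
  ; genus = λ _ → g
  ; nonempty = ℕ.≤-refl
  ; connected = λ { zero zero → ε }
  }

corolla-genus : ∀ g n → + g ≡ totalGenus (genusCorolla g n)
corolla-genus g n = begin
  + g                                         ≡⟨ ℤ.+-identityʳ (+ g) ⟨
  + g ℤ.+ + 0                                 ≡⟨ cong₂ (λ a e → + a ℤ.+ (+ e ℤ.- + 1 ℤ.+ + 1)) (ℕ.+-identityʳ g) #E≡0 ⟨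
  + (g ℕ.+ 0) ℤ.+ betti (corolla n)           ∎
  where
  open ≡-Reasoning

  #E≡0 : #E (corolla n) ≡ 0
  #E≡0 = ℕ.m+n≡0⇒m≡0 _ (ℕ.+-cancelʳ-≡ n _ 0
    (trans (GraphProperties.2#E+#L (corolla n)) (ℕ.+-identityʳ n)))

idₕ : ∀ {p} → Hom p p
idₕ {p} = record
  { part = λ l → genusCorolla (genus p l) (arity (graph p) l)
  ; part-genus = λ l → corolla-genus (genus p l) (arity (graph p) l)
  ; substitution = record
    { part-leaves = λ _ → refl
    ; bijection = mk↔ₛ′ proj₁ (_, zero) (λ _ → refl) (λ { (_ , zero) → refl })
    ; ι-mono-< = λ { _ {zero} {zero} () }
    ; ι-arity = λ _ _ → refl
    ; #L-≡ = refl
    ; inv-inner = λ _ _ ¬fix → contradiction refl ¬fix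
    ; inv-outer = λ (l , i) → trans (cong (inv (graph p)) (ψ-id (l , i))) (sym (ψ-id (inv (graph p) (l , i))))
    ; leaf-outer = λ k → trans (cong (leaf (graph p)) (Fin.cast-is-id refl k)) (sym (ψ-id (leaf (graph p) k)))
    }
  ; ι-genus = λ _ _ → refl
  }
  where
  ψ-id : ∀ (h : HalfEdge (graph p)) → (proj₁ h , cast refl (cast refl (proj₂ h))) ≡ h
  ψ-id (l , i) = cong (l ,_) (Fin.cast-involutive refl refl i)

-- Composition is iterated substitution: see Iterated.cut-substitution.
_∘ₕ_ : ∀ {p q r} → Hom q r → Hom p q → Hom p r
_∘ₕ_ {p} {q} {r} g f = record
  { part = part
  ; part-genus = λ l → trans (f.part-genus l)
      (S.totalGenus-⊙ l (genus (f.part l)) (λ u → genus (g.part (f.ι l u))) (genus r ∘ I.κ l)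
        (λ u x → trans (cong (genus r) (I.κ-cut-ι l u x)) (g.ι-genus (f.ι l u) x))
        (λ u → trans (cong +_ (sym (f.ι-genus l u))) (g.part-genus (f.ι l u))))
  ; substitution = I.reconstruct
  ; ι-genus = λ _ _ → refl
  }
  where
  module f = Hom f
  module g = Hom g
  module I = Iterated f.substitution g.substitution
  module S (l : Vertex (graph p)) = SubstitutionProperties (I.cut-substitution l)

  part : Vertex (graph p) → GenusGraph
  part l = record
    { graph = I.cut l
    ; genus = genus r ∘ I.κ l
    ; nonempty = S.nonempty-⊙ l (λ u → nonempty (g.part (f.ι l u))) (nonempty (f.part l))
    ; connected = S.connected-⊙ l (λ u → connected (g.part (f.ι l u))) (connected (f.part l))
    }

module _ {p q : GenusGraph} where

  φₕ : Hom p q → Vertex (graph q) → Vertex (graph p)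
  φₕ f = SubstitutionProperties.φ (Hom.substitution f)

  record _∼_ (f g : Hom p q) : Set where
    constructor _,_
    field
      φ-∼ : ∀ x → φₕ f x ≡ φₕ g x
      ψ-∼ : ∀ h → Hom.ψ f h ≡ Hom.ψ g h

  open _∼_ public

  ∼⇒≈ : ∀ {f g} → f ∼ g → f ≈ₕ g
  ∼⇒≈ {f} {g} (φ-≡ , ψ-≡) l =
    part-≅ F G φ-≡ ψ-≡ l ,
    (λ u → trans (sym (Hom.ι-genus f l u)) (trans (cong (genus q) (ι-≡ F G φ-≡ ψ-≡ l u)) (Hom.ι-genus g l _))) ,
    ι-≡ F G φ-≡ ψ-≡ l
    where
    F = Hom.substitution f
    G = Hom.substitution g

  ≈⇒∼ : ∀ {f g} → f ≈ₕ g → f ∼ g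
  ≈⇒∼ {f} {g} eq =
    ≅⇒φ-≡ F G (proj₁ ∘ eq) (λ l → proj₂ (proj₂ (eq l))) ,
    ≅⇒ψ-≡ F G (proj₁ ∘ eq) (λ l → proj₂ (proj₂ (eq l)))
    where
    F = Hom.substitution f
    G = Hom.substitution g

  ≈ₕ-isEquivalence : IsEquivalence (_≈ₕ_ {p} {q})
  ≈ₕ-isEquivalence = record
    { refl = λ {f} → ∼⇒≈ {f} {f} ((λ _ → refl) , λ _ → refl)
    ; sym = λ {f} {g} eq → let (a , b) = ≈⇒∼ {f} {g} eq in
        ∼⇒≈ {g} {f} ((λ x → sym (a x)) , λ h → sym (b h))
    ; trans = λ {f} {g} {h} eq eq′ → let (a , b) = ≈⇒∼ {f} {g} eq ; (c , d) = ≈⇒∼ {g} {h} eq′ in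
        ∼⇒≈ {f} {h} ((λ x → trans (a x) (c x)) , λ k → trans (b k) (d k))
    }

ψ-∘ₕ : ∀ {p q r} (g : Hom q r) (f : Hom p q) h → Hom.ψ (g ∘ₕ f) h ≡ Hom.ψ g (Hom.ψ f h)
ψ-∘ₕ g f = Iterated.reconstruct-ψ (Hom.substitution f) (Hom.substitution g)

ψ-idₕ : ∀ p h → Hom.ψ (idₕ {p}) h ≡ h
ψ-idₕ p (l , i) = cong (l ,_) (Fin.cast-involutive refl refl i)

-- C(numOp_(g,n))^op
numOpᵒᵖ : Category
numOpᵒᵖ = record
  { Obj = GenusGraph
  ; Hom = Hom
  ; _≈_ = _≈ₕ_
  ; idₘ = idₕ
  ; _⊚_ = _∘ₕ_
  ; isEquivalence = ≈ₕ-isEquivalence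
  ; identityˡ = λ {p} {q} f → ∼⇒≈ {f = idₕ ∘ₕ f} {f}
      ((λ _ → refl) , λ h → trans (ψ-∘ₕ idₕ f h) (ψ-idₕ q (Hom.ψ f h)))
  ; identityʳ = λ {p} {q} f → ∼⇒≈ {f = f ∘ₕ idₕ} {f}
      ((λ _ → refl) , λ h → trans (ψ-∘ₕ f idₕ h) (cong (Hom.ψ f) (ψ-idₕ p h)))
  ; assoc = λ h g f → ∼⇒≈ {f = (h ∘ₕ g) ∘ₕ f} {h ∘ₕ (g ∘ₕ f)}
      ((λ _ → refl) , λ k → trans (ψ-∘ₕ (h ∘ₕ g) f k) (trans (ψ-∘ₕ h g (Hom.ψ f k))
        (sym (trans (ψ-∘ₕ h (g ∘ₕ f) k) (cong (Hom.ψ h) (ψ-∘ₕ g f k))))))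
  ; ⊚-resp-≈ = λ {_} {_} {_} {g} {g′} {f} {f′} eq eq′ →
      let (a , b) = ≈⇒∼ {f = g} {g′} eq ; (c , d) = ≈⇒∼ {f = f} {f′} eq′ in
      ∼⇒≈ {f = g ∘ₕ f} {g′ ∘ₕ f′}
        ((λ x → trans (cong (φₕ f) (a x)) (c (φₕ g′ x))) ,
         λ h → trans (ψ-∘ₕ g f h) (trans (cong (Hom.ψ g) (d h))
           (trans (b (Hom.ψ f′ h)) (sym (ψ-∘ₕ g′ f′ h)))))
  }

{-# OPTIONS --safe #-}
module Submission where

-- A morphism p → q amounts to a contraction of q onto p, and contractions of
-- trees are governed by Kruskal's theorem. Cover the category by that of
-- marked plane trees: choose a rooted spanning tree, record the leaves, the
-- halves of the remaining edges and the units of genus as marks, and encode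
-- the tree as a binary tree whose tips are the vertices (fork a b joins the
-- roots of a and b by an edge and keeps the root of b). Morphisms of marked
-- trees are Higman embeddings that drop unmarked branches only.
--
-- (G1) Embeddings are compared lexicographically. (G2) An embedding of a
-- decomposes, along a, into words of dropped branches, so Higman's lemma over
-- Kruskal's theorem for binary trees applies; everything is done with
-- inductively defined almost-full relations. (F) Given a contraction of a
-- marked tree onto d, drop every branch without marks and without edges of d;
-- the number of vertices left is bounded by the marks and edges, and so is the
-- number of marks because total genus and leaves are preserved.

-- The graph category fails (G1) itself: exchanging the two halves of a loop is an endomorphism σ
-- with σ ∘ σ equal to the identity, and either of id ≺ σ and σ ≺ id would imply the other. A shape
-- has no embedding into itself except the identity, so plane trees remove this obstacle. What a
-- spanning tree does not see is stored as markings of its tips. Morphisms preserve the number of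
-- leaves and the total genus, so only finitely many sets of markings can occur over a given source;
-- embeddings fix this set and add only trees that carry no marking. Contracting such a tree into a
-- vertex leaves the genus of the vertex and all remaining edges intact, which is why unmarked
-- branches may be dropped. All unbounded growth thus happens in bare binary trees, so Kruskal's
-- theorem is applied without labels. Nothing is lost by forgetting the orders of vertices and
-- half-edges, because graphs that differ only in these orders are isomorphic in the category.

open import Defs
open import Algebra.Properties.Semiring.Sum as Sum using ()
open import Data.Bool.Base using (Bool; true; false; not)
open import Data.Bool.Properties using (not-involutive)
open import Data.Empty using (⊥)
open import Data.Fin.Base as Fin using (Fin; zero; suc; toℕ; cast; punchIn; splitAt; join; finToFun; funToFin)
import Data.Fin.Properties as Fin
open import Data.Integer.Base as ℤ using (ℤ; +_)
import Data.Integer.Properties as ℤ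
import Data.Integer.Tactic.RingSolver as ℤSolver
open import Data.List.Base using (List; []; _∷_; [_]; map; concatMap; allFin; tabulate; length; lookup; upTo; cartesianProductWith)
open import Data.List.Membership.Propositional using (_∈_; lose)
open import Data.List.Membership.Propositional.Properties using (∈-allFin; ∈-map⁺; ∈-concatMap⁺; ∈-upTo⁺; ∈-cartesianProductWith⁺)
open import Data.List.Relation.Unary.All using (All; []; _∷_)
open import Data.List.Relation.Unary.Any using (here; there) renaming (index to ∈-index)
open import Data.List.Relation.Unary.Any.Properties using (lookup-index)
open import Data.Nat.Base as ℕ using (ℕ; zero; suc; z≤n; s≤s)
open import Data.Nat.ListAction using () renaming (sum to sumᴸ)
import Data.Nat.Properties as ℕ
import Data.Nat.Tactic.RingSolver as ℕSolver
open import Data.Product.Base using (Σ; Σ-syntax; ∃-syntax; _×_; _,_; proj₁; proj₂; map₁)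
open import Data.Sum.Base using (_⊎_; inj₁; inj₂; [_,_]′) renaming (map to ⊎-map)
open import Data.Sum.Properties using (inj₁-injective; inj₂-injective)
open import Data.Unit.Base using (⊤; tt)
open import Function.Base using (_∘_; id; _on_)
open import Induction.WellFounded using (WellFounded; Acc; acc)
open import Level using (0ℓ)
open import Relation.Binary.Construct.Closure.ReflexiveTransitive using (Star; ε; _◅_; _◅◅_; gmap; reverse)
import Relation.Binary.Construct.On as On
open import Relation.Binary.Core using (Rel; _⇒_)
open import Relation.Binary.Definitions using (Decidable; Trichotomous; Tri; tri<; tri≈; tri>)
open import Relation.Binary.PropositionalEquality using (_≡_; _≢_; _≗_; refl; sym; trans; cong; cong₂; subst; isEquivalence; module ≡-Reasoning)
open import Relation.Binary.Structures using (IsStrictTotalOrder)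
open import Relation.Nullary using (¬_; Dec; yes; no; contradiction)
open import Relation.Nullary.Decidable using (_×-dec_; _⊎-dec_; _→-dec_; ¬?; map′; does; dec-true)

-- Almost-full relations

infixl 6 _⇑_

-- What remains to be met once x has been read: a pair also counts as good when its first member
-- already lies above x.
_⇑_ : ∀ {A : Set} → Rel A 0ℓ → A → Rel A 0ℓ
(R ⇑ x) y z = R y z ⊎ R x y

-- The inductive form of "every infinite sequence has i < j with R (s i) (s j)";
-- unlike the latter it is constructively closed under products, words and trees.
data AF {A : Set} (R : Rel A 0ℓ) : Set where
  now   : (∀ x y → R x y) → AF R
  later : (∀ x → AF (R ⇑ x)) → AF R

AF⇒good : ∀ {A : Set} {R : Rel A 0ℓ} → AF R → (s : ℕ → A) → ∃[ i ] ∃[ j ] (i ℕ.< j × R (s i) (s j))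
AF⇒good (now full)   s = 0 , 1 , s≤s z≤n , full _ _
AF⇒good (later next) s with AF⇒good (next (s 0)) (s ∘ suc)
... | i , j , i<j , inj₁ r = suc i , suc j , s≤s i<j , r
... | i , j , i<j , inj₂ r = 0 , suc i , s≤s z≤n , r

AF-mono : ∀ {A : Set} {R S : Rel A 0ℓ} → R ⇒ S → AF R → AF S
AF-mono R⊆S (now full)   = now λ x y → R⊆S (full x y)
AF-mono R⊆S (later next) = later λ x → AF-mono (⊎-map R⊆S R⊆S) (next x)

AF-comap : ∀ {A B : Set} {R : Rel B 0ℓ} (f : A → B) → AF R → AF (R on f)
AF-comap f (now full)   = now λ x y → full (f x) (f y)
AF-comap f (later next) = later λ x → AF-comap f (next (f x))

-- Coquand's constructive Ramsey theorem, for relations weakened by a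
-- proposition, by a predicate of the first argument, and by a relation.
module _ {A : Set} where
  private
    distrib : ∀ {T P Q : Set} → T ⊎ P → T ⊎ Q → T ⊎ (P × Q)
    distrib (inj₁ t) _        = inj₁ t
    distrib (inj₂ _) (inj₁ t) = inj₁ t
    distrib (inj₂ p) (inj₂ q) = inj₂ (p , q)

  AF-∩₀ : ∀ {R S T : Rel A 0ℓ} {P Q : Set} → AF R → AF S →
          (∀ {x y} → R x y → T x y ⊎ P) → (∀ {x y} → S x y → T x y ⊎ Q) →
          AF (λ x y → T x y ⊎ (P × Q))
  AF-∩₀ (now full) s R⊆ S⊆ = AF-mono (λ {x} {y} r → distrib (R⊆ (full x y)) (S⊆ r)) s
  AF-∩₀ {T = T} (later next) s R⊆ S⊆ = later λ x →
    AF-mono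
      (λ { (inj₁ (inj₁ t)) → inj₁ (inj₁ t) ; (inj₁ (inj₂ t)) → inj₂ (inj₁ t) ; (inj₂ pq) → inj₁ (inj₂ pq) })
      (AF-∩₀ {T = T ⇑ x} (next x) s
        (λ { (inj₁ r) → ⊎-map inj₁ id (R⊆ r) ; (inj₂ r) → ⊎-map inj₂ id (R⊆ r) })
        (λ r → ⊎-map inj₁ id (S⊆ r)))

  AF-∩₁ : ∀ {R S T : Rel A 0ℓ} {P Q : A → Set} → AF R → AF S →
          (∀ {x y} → R x y → T x y ⊎ P x) → (∀ {x y} → S x y → T x y ⊎ Q x) →
          AF (λ x y → T x y ⊎ (P x × Q x))
  AF-∩₁ (now full) s R⊆ S⊆ = AF-mono (λ {x} {y} r → distrib (R⊆ (full x y)) (S⊆ r)) s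
  AF-∩₁ r@(later _) (now full) R⊆ S⊆ = AF-mono (λ {x} {y} r → distrib (R⊆ r) (S⊆ (full x y))) r
  AF-∩₁ {T = T} {P} {Q} r@(later next) s@(later next′) R⊆ S⊆ = later λ x →
    AF-mono
      (λ { (inj₁ (inj₁ (inj₁ t))) → inj₁ (inj₁ t) ; (inj₁ (inj₁ (inj₂ t))) → inj₂ (inj₁ t)
         ; (inj₁ (inj₂ pq)) → inj₁ (inj₂ pq) ; (inj₂ pq) → inj₂ (inj₂ pq) })
      -- With x fixed, `P x` and `Q x` are propositions. Each recursive call advances only one of
      -- the two almost-full trees and allows one of these propositions as an extra disjunct;
      -- `AF-∩₀` turns the two disjuncts into their conjunction.
      (AF-∩₀ {T = λ y z → (T ⇑ x) y z ⊎ (P y × Q y)} {P x} {Q x}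
        (AF-∩₁ {T = λ y z → (T ⇑ x) y z ⊎ P x} {P} {Q} (next x) s
          (λ { (inj₁ r) → ⊎-map (inj₁ ∘ inj₁) id (R⊆ r)
             ; (inj₂ r) → inj₁ (⊎-map inj₂ id (R⊆ r)) })
          (λ r → ⊎-map (inj₁ ∘ inj₁) id (S⊆ r)))
        (AF-∩₁ {T = λ y z → (T ⇑ x) y z ⊎ Q x} {P} {Q} r (next′ x)
          (λ r → ⊎-map (inj₁ ∘ inj₁) id (R⊆ r))
          (λ { (inj₁ r) → ⊎-map (inj₁ ∘ inj₁) id (S⊆ r)
             ; (inj₂ r) → inj₁ (⊎-map inj₂ id (S⊆ r)) }))
        (λ { (inj₁ (inj₁ t)) → inj₁ (inj₁ t) ; (inj₁ (inj₂ p)) → inj₂ p ; (inj₂ pq) → inj₁ (inj₂ pq) })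
        (λ { (inj₁ (inj₁ t)) → inj₁ (inj₁ t) ; (inj₁ (inj₂ q)) → inj₂ q ; (inj₂ pq) → inj₁ (inj₂ pq) }))

  AF-∩₂ : ∀ {R S T P Q : Rel A 0ℓ} → AF R → AF S →
          (∀ {x y} → R x y → T x y ⊎ P x y) → (∀ {x y} → S x y → T x y ⊎ Q x y) →
          AF (λ x y → T x y ⊎ (P x y × Q x y))
  AF-∩₂ (now full) s R⊆ S⊆ = AF-mono (λ {x} {y} r → distrib (R⊆ (full x y)) (S⊆ r)) s
  AF-∩₂ r@(later _) (now full) R⊆ S⊆ = AF-mono (λ {x} {y} r → distrib (R⊆ r) (S⊆ (full x y))) r
  AF-∩₂ {T = T} {P} {Q} r@(later next) s@(later next′) R⊆ S⊆ = later λ x →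
    AF-mono
      (λ { (inj₁ (inj₁ (inj₁ t))) → inj₁ (inj₁ t) ; (inj₁ (inj₁ (inj₂ t))) → inj₂ (inj₁ t)
         ; (inj₁ (inj₂ pq)) → inj₁ (inj₂ pq) ; (inj₂ pq) → inj₂ (inj₂ pq) })
      (AF-∩₁ {T = λ y z → (T ⇑ x) y z ⊎ (P y z × Q y z)} {P x} {Q x}
        (AF-∩₂ {T = λ y z → (T ⇑ x) y z ⊎ P x y} {P} {Q} (next x) s
          (λ { (inj₁ r) → ⊎-map (inj₁ ∘ inj₁) id (R⊆ r)
             ; (inj₂ r) → inj₁ (⊎-map inj₂ id (R⊆ r)) })
          (λ r → ⊎-map (inj₁ ∘ inj₁) id (S⊆ r)))
        (AF-∩₂ {T = λ y z → (T ⇑ x) y z ⊎ Q x y} {P} {Q} r (next′ x)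
          (λ r → ⊎-map (inj₁ ∘ inj₁) id (R⊆ r))
          (λ { (inj₁ r) → ⊎-map (inj₁ ∘ inj₁) id (S⊆ r)
             ; (inj₂ r) → inj₁ (⊎-map inj₂ id (S⊆ r)) }))
        (λ { (inj₁ (inj₁ t)) → inj₁ (inj₁ t) ; (inj₁ (inj₂ p)) → inj₂ p ; (inj₂ pq) → inj₁ (inj₂ pq) })
        (λ { (inj₁ (inj₁ t)) → inj₁ (inj₁ t) ; (inj₁ (inj₂ q)) → inj₂ q ; (inj₂ pq) → inj₁ (inj₂ pq) }))

  AF-∩ : ∀ {R S : Rel A 0ℓ} → AF R → AF S → AF (λ x y → R x y × S x y)
  AF-∩ {R} {S} r s = AF-mono (λ { (inj₂ rs) → rs ; (inj₁ ()) })
    (AF-∩₂ {T = λ _ _ → ⊥} {R} {S} r s inj₂ inj₂)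

AF-× : ∀ {A B : Set} {R : Rel A 0ℓ} {S : Rel B 0ℓ} → AF R → AF S →
       AF {A × B} (λ x y → R (proj₁ x) (proj₁ y) × S (proj₂ x) (proj₂ y))
AF-× r s = AF-∩ (AF-comap proj₁ r) (AF-comap proj₂ s)

-- Two levels of `later` suffice because two of any three Booleans agree.
AF-Bool : AF {Bool} _≡_
AF-Bool = later λ x → later λ y → now (cases x y)
  where
  cases : ∀ x y z w → ((z ≡ w) ⊎ (x ≡ z)) ⊎ ((y ≡ z) ⊎ (x ≡ y))
  cases false false _     _ = inj₂ (inj₂ refl)
  cases true  true  _     _ = inj₂ (inj₂ refl)
  cases false true  false _ = inj₁ (inj₂ refl)
  cases false true  true  _ = inj₂ (inj₁ refl)
  cases true  false true  _ = inj₁ (inj₂ refl)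
  cases true  false false _ = inj₂ (inj₁ refl)

-- Restriction to complements

_∖_ : ∀ {A : Set} → Rel A 0ℓ → (P : A → Set) → Rel (Σ[ x ∈ A ] ¬ P x) 0ℓ
R ∖ P = R on proj₁

module _ {A : Set} where

  -- An element of P is related to all later ones by the added disjunct, so only sequences outside P
  -- remain, and the hypothesis handles these.
  AF-weaken : ∀ {R : Rel A 0ℓ} {P : A → Set} → (∀ x → Dec (P x)) → AF (R ∖ P) →
              AF (λ x y → R x y ⊎ P x)
  AF-weaken {R} {P} P? af = later λ x → step af x (P? x)
    where
    step : ∀ {R : Rel A 0ℓ} → AF (R ∖ P) → ∀ x → Dec (P x) → AF ((λ y z → R y z ⊎ P y) ⇑ x)
    step _ x (yes px) = now λ _ _ → inj₂ (inj₂ px)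
    step {R} (now full) x (no ¬px) = now λ y _ → at y (P? y)
      where
      at : ∀ y {z} → Dec (P y) → ((λ y z → R y z ⊎ P y) ⇑ x) y z
      at y (yes py) = inj₁ (inj₂ py)
      at y (no ¬py) = inj₂ (inj₁ (full (x , ¬px) (y , ¬py)))
    step {R} (later next) x (no ¬px) = AF-mono
      (λ { (inj₁ (inj₁ r)) → inj₁ (inj₁ r) ; (inj₁ (inj₂ r)) → inj₂ (inj₁ r) ; (inj₂ p) → inj₁ (inj₂ p) })
      (later λ y → step {R ⇑ x} (next (x , ¬px)) y (P? y))

  -- After x, any y with `R x y` makes a good pair at once, so only the elements not above x need
  -- attention. Higman's lemma and Kruskal's theorem both start here and proceed by structural
  -- induction on the excluded word or tree.
  AF-exclude : ∀ {R : Rel A 0ℓ} → Decidable R → (∀ x → AF (R ∖ R x)) → AF R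
  AF-exclude R? af = later λ x → AF-weaken (R? x) (af x)

-- Relations on a two-sided sum

data Side : Set where
  left right : Side

module _ {A : Side → Set} (R : ∀ s → Rel (A s) 0ℓ) where

  data SideSum : Rel (Σ Side A) 0ℓ where
    same : ∀ {s x y} → R s x y → SideSum (s , x) (s , y)

  -- The relation is the intersection of three almost-full ones: equality of sides, and the relation
  -- of either side declared true as soon as an element of the other side is involved.
  AF-SideSum : (∀ s → AF (R s)) → AF SideSum
  AF-SideSum af = AF-mono combine
      (AF-∩ (AF-comap isLeft AF-Bool) (AF-∩ (onlyLeft (af left)) (onlyRight (af right))))
    where
    isLeft : Σ Side A → Bool
    isLeft (left  , _) = true
    isLeft (right , _) = false

    OnlyLeft : Rel (A left) 0ℓ → Rel (Σ Side A) 0ℓ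
    OnlyLeft Q (left , x) (left , y) = Q x y
    OnlyLeft Q _          _          = ⊤

    OnlyRight : Rel (A right) 0ℓ → Rel (Σ Side A) 0ℓ
    OnlyRight Q (right , x) (right , y) = Q x y
    OnlyRight Q _           _           = ⊤

    shiftLeft : ∀ {Q} x y z → OnlyLeft (Q ⇑ x) y z → (OnlyLeft Q ⇑ (left , x)) y z
    shiftLeft x (left , _) (left , _) p = p
    shiftLeft x (left , _) (right , _) _ = inj₁ tt
    shiftLeft x (right , _) _ _ = inj₁ tt

    onlyLeft : ∀ {Q} → AF Q → AF (OnlyLeft Q)
    onlyLeft (now full) = now λ where
      (left  , x) (left  , y) → full x y
      (left  , _) (right , _) → tt
      (right , _) _           → tt
    onlyLeft (later next) = later λ where
      (left , x) → AF-mono (λ {y} {z} → shiftLeft x y z) (onlyLeft (next x))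
      (right , _) → now λ _ _ → inj₂ tt

    shiftRight : ∀ {Q} x y z → OnlyRight (Q ⇑ x) y z → (OnlyRight Q ⇑ (right , x)) y z
    shiftRight x (right , _) (right , _) p = p
    shiftRight x (right , _) (left , _) _ = inj₁ tt
    shiftRight x (left , _) _ _ = inj₁ tt

    onlyRight : ∀ {Q} → AF Q → AF (OnlyRight Q)
    onlyRight (now full) = now λ where
      (right , x) (right , y) → full x y
      (right , _) (left  , _) → tt
      (left  , _) _           → tt
    onlyRight (later next) = later λ where
      (right , x) → AF-mono (λ {y} {z} → shiftRight x y z) (onlyRight (next x))
      (left , _) → now λ _ _ → inj₂ tt

    combine : ∀ {x y} → isLeft x ≡ isLeft y × OnlyLeft (R left) x y × OnlyRight (R right) x y → SideSum x y
    combine {left  , _} {left  , _} (_ , r , _) = same r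
    combine {right , _} {right , _} (_ , _ , r) = same r
    combine {left  , _} {right , _} (() , _)
    combine {right , _} {left  , _} (() , _)

  SideSum-dec : (∀ s → Decidable (R s)) → Decidable SideSum
  SideSum-dec R? (left  , x) (left  , y) = map′ same (λ { (same r) → r }) (R? left x y)
  SideSum-dec R? (right , x) (right , y) = map′ same (λ { (same r) → r }) (R? right x y)
  SideSum-dec R? (left  , _) (right , _) = no λ ()
  SideSum-dec R? (right , _) (left  , _) = no λ ()

-- Higman's lemma

module _ {A : Set} (R : Rel A 0ℓ) where

  data Subword : Rel (List A) 0ℓ where
    []   : Subword [] []
    skip : ∀ {xs y ys} → Subword xs ys → Subword xs (y ∷ ys)
    keep : ∀ {x xs y ys} → R x y → Subword xs ys → Subword (x ∷ xs) (y ∷ ys)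

  []-subword : ∀ ys → Subword [] ys
  []-subword []       = []
  []-subword (_ ∷ ys) = skip ([]-subword ys)

module _ {A : Set} {R : Rel A 0ℓ} (R? : Decidable R) where

  subword? : Decidable (Subword R)
  subword? []       ys       = yes ([]-subword R ys)
  subword? (x ∷ xs) []       = no λ ()
  subword? (x ∷ xs) (y ∷ ys) = map′
    (λ { (inj₁ s) → skip s ; (inj₂ (r , s)) → keep r s })
    (λ { (skip s) → inj₁ s ; (keep r s) → inj₂ (r , s) })
    (subword? (x ∷ xs) ys ⊎-dec (R? x y ×-dec subword? xs ys))

  private
    Avoiding : A → Set
    Avoiding x = Σ[ u ∈ List A ] All (λ y → ¬ R x y) u

    -- A word that does not contain x ∷ w is a word avoiding x, possibly
    -- followed by a letter and a word that does not contain w.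
    Split : A → List A → Side → Set
    Split x w left  = Avoiding x
    Split x w right = Avoiding x × A × (Σ[ v ∈ List A ] ¬ Subword R w v)

    SplitRel : ∀ x w s → Rel (Split x w s) 0ℓ
    SplitRel x w left  (u , _)           (u′ , _)             = Subword R u u′
    SplitRel x w right ((u , _) , z , v) ((u′ , _) , z′ , v′) =
      Subword R u u′ × R z z′ × Subword R (proj₁ v) (proj₁ v′)

    -- The graph of the decomposition. Recursion on two such derivations proves `splits-reflects`
    -- without unfolding the decisions made by `split`.
    data Splits (x : A) (w : List A) : List A → Σ Side (Split x w) → Set where
      done   : Splits x w [] (left , [] , [])
      letter : ∀ z v → Splits x w (z ∷ proj₁ v) (right , ([] , []) , z , v)
      left   : ∀ {v u a} y ¬r → Splits x w v (left , u , a) → Splits x w (y ∷ v) (left , y ∷ u , ¬r ∷ a)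
      right  : ∀ {v u a z v′} y ¬r → Splits x w v (right , (u , a) , z , v′) →
               Splits x w (y ∷ v) (right , (y ∷ u , ¬r ∷ a) , z , v′)

    split : ∀ x w v → ¬ Subword R (x ∷ w) v → ∃[ s ] Splits x w v s
    split x w []      _  = _ , done
    split x w (y ∷ v) ¬s with R? x y
    ... | yes r = _ , letter y (v , λ s → ¬s (keep r s))
    ... | no ¬r with split x w v (λ s → ¬s (skip s))
    ...   | (left , _)  , sp = _ , left y ¬r sp
    ...   | (right , _) , sp = _ , right y ¬r sp

    splits-reflects : ∀ {x w v v′ s s′} → Splits x w v s → Splits x w v′ s′ →
                      SideSum (SplitRel x w) s s′ → Subword R v v′
    splits-reflects done           done            (same [])                  = []
    splits-reflects p              (left _ _ q)    (same (skip s))            = skip (splits-reflects p q (same s))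
    splits-reflects (left _ _ p)   (left _ _ q)    (same (keep r s))          = keep r (splits-reflects p q (same s))
    splits-reflects (letter _ _)   (letter _ _)    (same ([] , r , t))        = keep r t
    splits-reflects p              (right _ _ q)   (same (skip s , rt))       = skip (splits-reflects p q (same (s , rt)))
    splits-reflects (right _ _ p)  (right _ _ q)   (same (keep r s , rt))     = keep r (splits-reflects p q (same (s , rt)))

  -- Induction on the excluded word, nested in the induction on `AF R` of `higman`: the latter
  -- provides `af-avoiding`, the former the tails that do not contain w.
  higman-step : AF R → (∀ x → AF (Subword R on (proj₁ {B = All (λ y → ¬ R x y)}))) → AF (Subword R)
  higman-step af-R af-avoiding = AF-exclude subword? excluded
    where
    excluded : ∀ w → AF (Subword R ∖ Subword R w)
    excluded []      = now λ (v , ¬s) _ → contradiction ([]-subword R v) ¬s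
    excluded (x ∷ w) = AF-mono
      (λ {(v , ¬s)} {(v′ , ¬s′)} → splits-reflects (proj₂ (split x w v ¬s)) (proj₂ (split x w v′ ¬s′)))
      (AF-comap (λ (v , ¬s) → proj₁ (split x w v ¬s)) (AF-SideSum (SplitRel x w) λ
        { left → af-avoiding x ; right → AF-× (af-avoiding x) (AF-× af-R (excluded w)) }))

-- Induction on `AF R`. On words all of whose letters fail `R x`, a subword for `R ⇑ x` is a subword
-- for `R`, so the hypothesis for `next x` applies; if `R` is full, only the empty word is of this
-- kind.
higman : ∀ {A : Set} {R : Rel A 0ℓ} → Decidable R → AF R → AF (Subword R)
higman {A} {R} R? af@(now full) = higman-step R? af λ x → now λ
  { ([] , _)          (v , _) → []-subword R v
  ; (y ∷ _ , ¬r ∷ _)  _       → contradiction (full x y) ¬r }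
higman {A} {R} R? af@(later next) = higman-step R? af λ x →
  AF-mono (λ {u} {v} → restrict u v) (AF-comap proj₁ (higman (λ y z → R? y z ⊎-dec R? x y) (next x)))
  where
  restrict : ∀ {x} (u v : Σ[ u ∈ List A ] All (λ y → ¬ R x y) u) →
             Subword (R ⇑ x) (proj₁ u) (proj₁ v) → Subword R (proj₁ u) (proj₁ v)
  restrict ([] , _)          ([] , _)         []                = []
  restrict u                 (_ ∷ v , _ ∷ b)  (skip s)          = skip (restrict u (v , b) s)
  restrict (_ ∷ u , _ ∷ a)   (_ ∷ v , _ ∷ b)  (keep (inj₁ r) s) = keep r (restrict (u , a) (v , b) s)
  restrict (_ ∷ u , ¬r ∷ a)  (_ ∷ v , _ ∷ b)  (keep (inj₂ r) s) = contradiction r ¬r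

-- Kruskal's theorem for binary trees

data BinaryTree : Set where
  tip : BinaryTree
  fork : BinaryTree → BinaryTree → BinaryTree

infix 4 _≤ᵗ_

data _≤ᵗ_ : Rel BinaryTree 0ℓ where
  tip   : tip ≤ᵗ tip
  fork   : ∀ {a b a′ b′} → a ≤ᵗ a′ → b ≤ᵗ b′ → fork a b ≤ᵗ fork a′ b′
  dropˡ  : ∀ {a a′ b′} → a ≤ᵗ b′ → a ≤ᵗ fork a′ b′
  dropʳ  : ∀ {a a′ b′} → a ≤ᵗ a′ → a ≤ᵗ fork a′ b′

tip-≤ᵗ : ∀ a → tip ≤ᵗ a
tip-≤ᵗ tip       = tip
tip-≤ᵗ (fork _ b) = dropˡ (tip-≤ᵗ b)

_≤ᵗ?_ : Decidable _≤ᵗ_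
tip     ≤ᵗ? a          = yes (tip-≤ᵗ a)
fork _ _ ≤ᵗ? tip       = no λ ()
fork a b ≤ᵗ? fork a′ b′ = map′
  (λ { (inj₁ (p , q)) → fork p q ; (inj₂ (inj₁ p)) → dropˡ p ; (inj₂ (inj₂ p)) → dropʳ p })
  (λ { (fork p q) → inj₁ (p , q) ; (dropˡ p) → inj₂ (inj₁ p) ; (dropʳ p) → inj₂ (inj₂ p) })
  (((a ≤ᵗ? a′) ×-dec (b ≤ᵗ? b′)) ⊎-dec ((fork a b ≤ᵗ? b′) ⊎-dec (fork a b ≤ᵗ? a′)))

private
  pick : ∀ {A : Set} → A → A → Side → A
  pick a b left  = a
  pick a b right = b

  -- At every fork of a tree that does not contain fork a b, the left child
  -- does not contain a or the right child does not contain b; such children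
  -- are the letters of a word, which continues with the other child.
  Letter : BinaryTree → BinaryTree → Side → Set
  Letter a b s = Σ[ c ∈ BinaryTree ] ¬ (pick a b s ≤ᵗ c)

  LetterRel : ∀ a b s → Rel (Letter a b s) 0ℓ
  LetterRel a b s = _≤ᵗ_ ∖ (pick a b s ≤ᵗ_)

  data Spelling (a b : BinaryTree) : BinaryTree → List (Σ Side (Letter a b)) → Set where
    tip  : Spelling a b tip []
    left  : ∀ {c d w} a≰c → Spelling a b d w → Spelling a b (fork c d) ((left , c , a≰c) ∷ w)
    right : ∀ {c d w} b≰d → Spelling a b c w → Spelling a b (fork c d) ((right , d , b≰d) ∷ w)

  spell : ∀ a b c → ¬ (fork a b ≤ᵗ c) → ∃[ w ] Spelling a b c w
  spell a b tip       _  = [] , tip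
  spell a b (fork c d) ¬p with a ≤ᵗ? c | b ≤ᵗ? d
  ... | no a≰c  | _       = _ , left a≰c (proj₂ (spell a b d (¬p ∘ dropˡ)))
  ... | yes _   | no b≰d  = _ , right b≰d (proj₂ (spell a b c (¬p ∘ dropʳ)))
  ... | yes a≤c | yes b≤d = contradiction (fork a≤c b≤d) ¬p

  spelling-reflects : ∀ {a b c c′ w w′} → Spelling a b c w → Spelling a b c′ w′ →
                      Subword (SideSum (LetterRel a b)) w w′ → c ≤ᵗ c′
  spelling-reflects {c′ = c′} tip q         _                 = tip-≤ᵗ c′
  spelling-reflects p           (left _ q)  (skip s)          = dropˡ (spelling-reflects p q s)
  spelling-reflects p           (right _ q) (skip s)          = dropʳ (spelling-reflects p q s)
  spelling-reflects (left _ p)  (left _ q)  (keep (same r) s) = fork r (spelling-reflects p q s)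
  spelling-reflects (right _ p) (right _ q) (keep (same r) s) = fork (spelling-reflects p q s) r

-- Induction on the excluded tree. A tree without `fork a b` is spelled by letters that avoid a or
-- avoid b, which are almost full by induction, and Higman's lemma carries this to words.
AF-≤ᵗ : AF _≤ᵗ_
AF-≤ᵗ = AF-exclude _≤ᵗ?_ excluded
  where
  excluded : ∀ t → AF (_≤ᵗ_ ∖ (t ≤ᵗ_))
  excluded tip       = now λ (c , ¬p) _ → contradiction (tip-≤ᵗ c) ¬p
  excluded (fork a b) = AF-mono (λ {(c , ¬p)} {(c′ , ¬p′)} → spelling-reflects (proj₂ (spell a b c ¬p)) (proj₂ (spell a b c′ ¬p′)))
    (AF-comap (λ (c , ¬p) → proj₁ (spell a b c ¬p))
      (higman (SideSum-dec (LetterRel a b) (λ _ x y → proj₁ x ≤ᵗ? proj₁ y))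
        (AF-SideSum (LetterRel a b) (λ { left → excluded a ; right → excluded b }))))

-- Shapes

-- A tip is marked when the vertex carries leaves, halves of edges outside the
-- tree, or positive genus.
data Shape : Set where
  tip  : Bool → Shape
  fork : Shape → Shape → Shape

data Unmarked : Shape → Set where
  tip  : Unmarked (tip false)
  fork : ∀ {a b} → Unmarked a → Unmarked b → Unmarked (fork a b)

-- Makes embeddings with the same drops equal, although composition rebuilds the proofs that the
-- dropped branches are unmarked.
unmarked-unique : ∀ {a} (u v : Unmarked a) → u ≡ v
unmarked-unique tip        tip          = refl
unmarked-unique (fork u v) (fork u′ v′) = cong₂ fork (unmarked-unique u u′) (unmarked-unique v v′)

infix 4 _⊑_ _≺_

-- Dropping a branch stands for contracting it, together with the edge of its fork, into the root of
-- the branch that stays.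
data _⊑_ : Rel Shape 0ℓ where
  tip   : ∀ {m} → tip m ⊑ tip m
  fork  : ∀ {a b a′ b′} → a ⊑ a′ → b ⊑ b′ → fork a b ⊑ fork a′ b′
  dropˡ : ∀ {a a′ b′} → Unmarked a′ → a ⊑ b′ → a ⊑ fork a′ b′
  dropʳ : ∀ {a a′ b′} → Unmarked b′ → a ⊑ a′ → a ⊑ fork a′ b′

⊑-unmarked : ∀ {a b} → a ⊑ b → Unmarked a → Unmarked b
⊑-unmarked tip         u          = u
⊑-unmarked (fork f g)  (fork u v) = fork (⊑-unmarked f u) (⊑-unmarked g v)
⊑-unmarked (dropˡ v f) u          = fork v (⊑-unmarked f u)
⊑-unmarked (dropʳ v f) u          = fork (⊑-unmarked f u) v

⊑-id : ∀ a → a ⊑ a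
⊑-id (tip _)    = tip
⊑-id (fork a b) = fork (⊑-id a) (⊑-id b)

infixr 9 _⊙ₛ_

_⊙ₛ_ : ∀ {a b c} → b ⊑ c → a ⊑ b → a ⊑ c
tip       ⊙ₛ f           = f
dropˡ u g ⊙ₛ f           = dropˡ u (g ⊙ₛ f)
dropʳ u g ⊙ₛ f           = dropʳ u (g ⊙ₛ f)
fork g h  ⊙ₛ fork f k    = fork (g ⊙ₛ f) (h ⊙ₛ k)
fork g h  ⊙ₛ dropˡ u f   = dropˡ (⊑-unmarked g u) (h ⊙ₛ f)
fork g h  ⊙ₛ dropʳ u f   = dropʳ (⊑-unmarked h u) (g ⊙ₛ f)

⊙ₛ-identityˡ : ∀ {a b} (f : a ⊑ b) → ⊑-id b ⊙ₛ f ≡ f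
⊙ₛ-identityˡ tip         = refl
⊙ₛ-identityˡ (fork f g)  = cong₂ fork (⊙ₛ-identityˡ f) (⊙ₛ-identityˡ g)
⊙ₛ-identityˡ (dropˡ u f) = cong₂ dropˡ (unmarked-unique _ u) (⊙ₛ-identityˡ f)
⊙ₛ-identityˡ (dropʳ u f) = cong₂ dropʳ (unmarked-unique _ u) (⊙ₛ-identityˡ f)

⊙ₛ-identityʳ : ∀ {a b} (f : a ⊑ b) → f ⊙ₛ ⊑-id a ≡ f
⊙ₛ-identityʳ tip         = refl
⊙ₛ-identityʳ (fork f g)  = cong₂ fork (⊙ₛ-identityʳ f) (⊙ₛ-identityʳ g)
⊙ₛ-identityʳ (dropˡ u f) = cong (dropˡ u) (⊙ₛ-identityʳ f)
⊙ₛ-identityʳ (dropʳ u f) = cong (dropʳ u) (⊙ₛ-identityʳ f)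

⊙ₛ-assoc : ∀ {a b c d} (h : c ⊑ d) (g : b ⊑ c) (f : a ⊑ b) → (h ⊙ₛ g) ⊙ₛ f ≡ h ⊙ₛ (g ⊙ₛ f)
⊙ₛ-assoc tip         g           f           = refl
⊙ₛ-assoc (dropˡ u h) g           f           = cong (dropˡ u) (⊙ₛ-assoc h g f)
⊙ₛ-assoc (dropʳ u h) g           f           = cong (dropʳ u) (⊙ₛ-assoc h g f)
⊙ₛ-assoc (fork h k)  (dropˡ u g) f           = cong (dropˡ _) (⊙ₛ-assoc k g f)
⊙ₛ-assoc (fork h k)  (dropʳ u g) f           = cong (dropʳ _) (⊙ₛ-assoc h g f)
⊙ₛ-assoc (fork h k)  (fork g i)  (fork f j)  = cong₂ fork (⊙ₛ-assoc h g f) (⊙ₛ-assoc k i j)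
⊙ₛ-assoc (fork h k)  (fork g i)  (dropˡ u f) = cong₂ dropˡ (unmarked-unique _ _) (⊙ₛ-assoc k i f)
⊙ₛ-assoc (fork h k)  (fork g i)  (dropʳ u f) = cong₂ dropʳ (unmarked-unique _ _) (⊙ₛ-assoc h g f)

-- The admissible order on embeddings

-- Postcomposition with g adds drops that depend on g alone and otherwise keeps the constructors of
-- f in place, so it preserves a comparison that ranks the constructors and then recurses.
data _≺_ : ∀ {a b} → Rel (a ⊑ b) 0ℓ where
  fork≺dropˡ  : ∀ {a b a′ b′ u} {f : a ⊑ a′} {g : b ⊑ b′} {h : fork a b ⊑ b′} → fork f g ≺ dropˡ u h
  fork≺dropʳ  : ∀ {a b a′ b′ u} {f : a ⊑ a′} {g : b ⊑ b′} {h : fork a b ⊑ a′} → fork f g ≺ dropʳ u h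
  dropˡ≺dropʳ : ∀ {a a′ b′ u v} {f : a ⊑ b′} {g : a ⊑ a′} → dropˡ u f ≺ dropʳ v g
  fork₁       : ∀ {a b a′ b′} {f f′ : a ⊑ a′} {g g′ : b ⊑ b′} → f ≺ f′ → fork f g ≺ fork f′ g′
  fork₂       : ∀ {a b a′ b′} {f : a ⊑ a′} {g g′ : b ⊑ b′} → g ≺ g′ → fork f g ≺ fork f g′
  dropˡ       : ∀ {a a′ b′} {u : Unmarked a′} {f f′ : a ⊑ b′} → f ≺ f′ → dropˡ u f ≺ dropˡ u f′
  dropʳ       : ∀ {a a′ b′} {u : Unmarked b′} {f f′ : a ⊑ a′} → f ≺ f′ → dropʳ u f ≺ dropʳ u f′

≺-irrefl : ∀ {a b} {f : a ⊑ b} → ¬ (f ≺ f)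
≺-irrefl (fork₁ p) = ≺-irrefl p
≺-irrefl (fork₂ p) = ≺-irrefl p
≺-irrefl (dropˡ p) = ≺-irrefl p
≺-irrefl (dropʳ p) = ≺-irrefl p

≺-trans : ∀ {a b} {f g h : a ⊑ b} → f ≺ g → g ≺ h → f ≺ h
≺-trans fork≺dropˡ  dropˡ≺dropʳ = fork≺dropʳ
≺-trans fork≺dropˡ  (dropˡ _)   = fork≺dropˡ
≺-trans fork≺dropʳ  (dropʳ _)   = fork≺dropʳ
≺-trans dropˡ≺dropʳ (dropʳ _)   = dropˡ≺dropʳ
≺-trans (fork₁ _)   fork≺dropˡ  = fork≺dropˡ
≺-trans (fork₁ _)   fork≺dropʳ  = fork≺dropʳ
≺-trans (fork₁ p)   (fork₁ q)   = fork₁ (≺-trans p q)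
≺-trans (fork₁ p)   (fork₂ _)   = fork₁ p
≺-trans (fork₂ _)   fork≺dropˡ  = fork≺dropˡ
≺-trans (fork₂ _)   fork≺dropʳ  = fork≺dropʳ
≺-trans (fork₂ _)   (fork₁ q)   = fork₁ q
≺-trans (fork₂ p)   (fork₂ q)   = fork₂ (≺-trans p q)
≺-trans (dropˡ _)   dropˡ≺dropʳ = dropˡ≺dropʳ
≺-trans (dropˡ p)   (dropˡ q)   = dropˡ (≺-trans p q)
≺-trans (dropʳ p)   (dropʳ q)   = dropʳ (≺-trans p q)

private
  below : ∀ {a b} {f g : a ⊑ b} → f ≺ g → Tri (f ≺ g) (f ≡ g) (g ≺ f)
  below p = tri< p (λ { refl → ≺-irrefl p }) (λ q → ≺-irrefl (≺-trans p q))

  above : ∀ {a b} {f g : a ⊑ b} → g ≺ f → Tri (f ≺ g) (f ≡ g) (g ≺ f)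
  above p = tri> (λ q → ≺-irrefl (≺-trans p q)) (λ { refl → ≺-irrefl p }) p

≺-compare : ∀ {a b} → Trichotomous _≡_ (_≺_ {a} {b})
≺-compare tip         tip           = tri≈ ≺-irrefl refl ≺-irrefl
≺-compare (fork _ _)  (dropˡ _ _)   = below fork≺dropˡ
≺-compare (fork _ _)  (dropʳ _ _)   = below fork≺dropʳ
≺-compare (dropˡ _ _) (dropʳ _ _)   = below dropˡ≺dropʳ
≺-compare (dropˡ _ _) (fork _ _)    = above fork≺dropˡ
≺-compare (dropʳ _ _) (fork _ _)    = above fork≺dropʳ
≺-compare (dropʳ _ _) (dropˡ _ _)   = above dropˡ≺dropʳ
≺-compare (dropˡ u f) (dropˡ v g) with unmarked-unique u v | ≺-compare f g
... | refl | tri< p _ _    = below (dropˡ p)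
... | refl | tri≈ _ refl _ = tri≈ ≺-irrefl refl ≺-irrefl
... | refl | tri> _ _ p    = above (dropˡ p)
≺-compare (dropʳ u f) (dropʳ v g) with unmarked-unique u v | ≺-compare f g
... | refl | tri< p _ _    = below (dropʳ p)
... | refl | tri≈ _ refl _ = tri≈ ≺-irrefl refl ≺-irrefl
... | refl | tri> _ _ p    = above (dropʳ p)
≺-compare (fork f g) (fork f′ g′) with ≺-compare f f′ | ≺-compare g g′
... | tri< p _ _    | _             = below (fork₁ p)
... | tri> _ _ p    | _             = above (fork₁ p)
... | tri≈ _ refl _ | tri< p _ _    = below (fork₂ p)
... | tri≈ _ refl _ | tri≈ _ refl _ = tri≈ ≺-irrefl refl ≺-irrefl
... | tri≈ _ refl _ | tri> _ _ p    = above (fork₂ p)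

≺-isStrictTotalOrder : ∀ {a b} → IsStrictTotalOrder _≡_ (_≺_ {a} {b})
≺-isStrictTotalOrder = record
  { isStrictPartialOrder = record
    { isEquivalence = isEquivalence
    ; irrefl = λ { refl → ≺-irrefl }
    ; trans = ≺-trans
    ; <-resp-≈ = (λ { refl p → p }) , (λ { refl p → p })
    }
  ; compare = ≺-compare
  }

private
  acc-fork : ∀ {a b a′ b′} {f : a ⊑ a′} {g : b ⊑ b′} → Acc _≺_ f → (∀ (g : b ⊑ b′) → Acc _≺_ g) →
             Acc _≺_ g → Acc _≺_ (fork f g)
  acc-fork {b = b} {b′ = b′} {f = f} (acc rs) acc-g = inner
    where
    inner : ∀ {g : b ⊑ b′} → Acc _≺_ g → Acc _≺_ (fork f g)
    inner (acc rs′) = acc λ where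
      (fork₁ {g = g} p) → acc-fork (rs p) acc-g (acc-g g)
      (fork₂ p)         → inner (rs′ p)

  acc-dropˡ : ∀ {a a′ b′} {u : Unmarked a′} {f : a ⊑ b′} →
              (∀ {c d} {f : c ⊑ a′} {g : d ⊑ b′} → Acc _≺_ (fork f g)) →
              Acc _≺_ f → Acc _≺_ (dropˡ {a} u f)
  acc-dropˡ acc-fg (acc rs) = acc λ where
    fork≺dropˡ → acc-fg
    (dropˡ p)  → acc-dropˡ acc-fg (rs p)

  acc-dropʳ : ∀ {a a′ b′} {u : Unmarked b′} {f : a ⊑ a′} →
              (∀ {c d} {f : c ⊑ a′} {g : d ⊑ b′} → Acc _≺_ (fork f g)) →
              (∀ {u f} → Acc _≺_ (dropˡ {a} {a′} {b′} u f)) →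
              Acc _≺_ f → Acc _≺_ (dropʳ {a} u f)
  acc-dropʳ acc-fg acc-f (acc rs) = acc λ where
    fork≺dropʳ  → acc-fg
    dropˡ≺dropʳ → acc-f
    (dropʳ p)   → acc-dropʳ acc-fg acc-f (rs p)

-- Induction on the target: every constructor passes to branches of the target, whereas a drop
-- leaves the source unchanged.
≺-wellFounded : ∀ {a b} → WellFounded (_≺_ {a} {b})
≺-wellFounded {b = tip _} tip = acc λ ()
≺-wellFounded {b = fork a′ b′} f = go f
  where
  forks : ∀ {c d} {f : c ⊑ a′} {g : d ⊑ b′} → Acc _≺_ (fork f g)
  forks {f = f} {g} = acc-fork (≺-wellFounded f) ≺-wellFounded (≺-wellFounded g)

  dropsˡ : ∀ {a u} {f : a ⊑ b′} → Acc _≺_ (dropˡ {a} {a′} u f)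
  dropsˡ {f = f} = acc-dropˡ forks (≺-wellFounded f)

  go : ∀ {a} (f : a ⊑ fork a′ b′) → Acc _≺_ f
  go (fork _ _)  = forks
  go (dropˡ _ _) = dropsˡ
  go (dropʳ _ f) = acc-dropʳ forks dropsˡ (≺-wellFounded f)

⊙ₛ-mono-≺ : ∀ {a b c} (g : b ⊑ c) {f f′ : a ⊑ b} → f ≺ f′ → g ⊙ₛ f ≺ g ⊙ₛ f′
⊙ₛ-mono-≺ tip         p           = p
⊙ₛ-mono-≺ (dropˡ _ g) p           = dropˡ (⊙ₛ-mono-≺ g p)
⊙ₛ-mono-≺ (dropʳ _ g) p           = dropʳ (⊙ₛ-mono-≺ g p)
⊙ₛ-mono-≺ (fork g h)  fork≺dropˡ  = fork≺dropˡ
⊙ₛ-mono-≺ (fork g h)  fork≺dropʳ  = fork≺dropʳ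
⊙ₛ-mono-≺ (fork g h)  dropˡ≺dropʳ = dropˡ≺dropʳ
⊙ₛ-mono-≺ (fork g h)  (fork₁ p)   = fork₁ (⊙ₛ-mono-≺ g p)
⊙ₛ-mono-≺ (fork g h)  (fork₂ p)   = fork₂ (⊙ₛ-mono-≺ h p)
⊙ₛ-mono-≺ (fork g h)  (dropˡ p)   = dropˡ (⊙ₛ-mono-≺ h p)
⊙ₛ-mono-≺ (fork g h)  (dropʳ p)   = dropʳ (⊙ₛ-mono-≺ g p)

-- Embeddings of a fixed shape are almost full under factorization

erase : ∀ {a} → Unmarked a → BinaryTree
erase tip        = tip
erase (fork u v) = fork (erase u) (erase v)

-- Every branch of an unmarked shape is unmarked, so an embedding of bare trees drops nothing
-- forbidden.
erase-reflects : ∀ {a b} (u : Unmarked a) (v : Unmarked b) → erase u ≤ᵗ erase v → a ⊑ b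
erase-reflects tip        tip        tip         = tip
erase-reflects (fork u v) (fork u′ v′) (fork p q) = fork (erase-reflects u u′ p) (erase-reflects v v′ q)
erase-reflects u          (fork u′ v′) (dropˡ p)  = dropˡ u′ (erase-reflects u v′ p)
erase-reflects u          (fork u′ v′) (dropʳ p)  = dropʳ v′ (erase-reflects u u′ p)

Embedded : Shape → Set
Embedded a = ∃[ b ] (a ⊑ b)

_≼ₛ_ : ∀ {a} → Rel (Embedded a) 0ℓ
(b , f) ≼ₛ (c , g) = Σ[ h ∈ b ⊑ c ] g ≡ h ⊙ₛ f

-- The embeddings of a decompose as the word of trees that they drop above the
-- root of a, followed by embeddings of the two branches of a.
dropped : ∀ {a b} → a ⊑ b → List (Σ Side (λ _ → BinaryTree))
dropped tip         = []
dropped (fork _ _)  = []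
dropped (dropˡ u f) = (left , erase u) ∷ dropped f
dropped (dropʳ u f) = (right , erase u) ∷ dropped f

branches : ∀ {a b c} → fork a b ⊑ c → Embedded a × Embedded b
branches (fork f g)  = (_ , f) , (_ , g)
branches (dropˡ _ f) = branches f
branches (dropʳ _ f) = branches f

private
  DroppedRel : Rel (List (Σ Side (λ _ → BinaryTree))) 0ℓ
  DroppedRel = Subword (SideSum (λ _ → _≤ᵗ_))

  skipˡ : ∀ {a b c d} {f : a ⊑ b} {g : a ⊑ c} (u : Unmarked d) → (b , f) ≼ₛ (c , g) → (b , f) ≼ₛ (fork d c , dropˡ u g)
  skipˡ u (h , eq) = dropˡ u h , cong (dropˡ u) eq

  skipʳ : ∀ {a b c d} {f : a ⊑ b} {g : a ⊑ c} (u : Unmarked d) → (b , f) ≼ₛ (c , g) → (b , f) ≼ₛ (fork c d , dropʳ u g)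
  skipʳ u (h , eq) = dropʳ u h , cong (dropʳ u) eq

  keepˡ : ∀ {a b c d e} {f : a ⊑ b} {g : a ⊑ c} (u : Unmarked d) (v : Unmarked e) → erase u ≤ᵗ erase v →
          (b , f) ≼ₛ (c , g) → (fork d b , dropˡ u f) ≼ₛ (fork e c , dropˡ v g)
  keepˡ u v p (h , eq) = fork (erase-reflects u v p) h , cong₂ dropˡ (unmarked-unique _ _) eq

  keepʳ : ∀ {a b c d e} {f : a ⊑ b} {g : a ⊑ c} (u : Unmarked d) (v : Unmarked e) → erase u ≤ᵗ erase v →
          (b , f) ≼ₛ (c , g) → (fork b d , dropʳ u f) ≼ₛ (fork c e , dropʳ v g)
  keepʳ u v p (h , eq) = fork h (erase-reflects u v p) , cong₂ dropʳ (unmarked-unique _ _) eq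

  tip-reflects : ∀ {m b c} (f : tip m ⊑ b) (g : tip m ⊑ c) → DroppedRel (dropped f) (dropped g) → (b , f) ≼ₛ (c , g)
  tip-reflects tip         tip         _                 = tip , refl
  tip-reflects f           (dropˡ u g) (skip s)          = skipˡ u (tip-reflects f g s)
  tip-reflects f           (dropʳ u g) (skip s)          = skipʳ u (tip-reflects f g s)
  tip-reflects (dropˡ u f) (dropˡ v g) (keep (same p) s) = keepˡ u v p (tip-reflects f g s)
  tip-reflects (dropʳ u f) (dropʳ v g) (keep (same p) s) = keepʳ u v p (tip-reflects f g s)

  fork-reflects : ∀ {a b c d} (f : fork a b ⊑ c) (g : fork a b ⊑ d) → DroppedRel (dropped f) (dropped g) →
                  proj₁ (branches f) ≼ₛ proj₁ (branches g) → proj₂ (branches f) ≼ₛ proj₂ (branches g) →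
                  (c , f) ≼ₛ (d , g)
  fork-reflects (fork _ _)  (fork _ _)  _                 (h , e) (k , e′) = fork h k , cong₂ fork e e′
  fork-reflects f           (dropˡ u g) (skip s)          r r′ = skipˡ u (fork-reflects f g s r r′)
  fork-reflects f           (dropʳ u g) (skip s)          r r′ = skipʳ u (fork-reflects f g s r r′)
  fork-reflects (dropˡ u f) (dropˡ v g) (keep (same p) s) r r′ = keepˡ u v p (fork-reflects f g s r r′)
  fork-reflects (dropʳ u f) (dropʳ v g) (keep (same p) s) r r′ = keepʳ u v p (fork-reflects f g s r r′)

  AF-DroppedRel : AF DroppedRel
  AF-DroppedRel = higman (SideSum-dec (λ _ → _≤ᵗ_) (λ _ → _≤ᵗ?_)) (AF-SideSum (λ _ → _≤ᵗ_) (λ _ → AF-≤ᵗ))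

AF-≼ₛ : ∀ a → AF (_≼ₛ_ {a})
AF-≼ₛ (tip m)    = AF-mono (λ {(_ , f)} {(_ , g)} → tip-reflects f g)
  (AF-comap (λ (_ , f) → dropped f) AF-DroppedRel)
AF-≼ₛ (fork a b) = AF-mono (λ {(_ , f)} {(_ , g)} (s , r , r′) → fork-reflects f g s r r′)
  (AF-comap (λ (_ , f) → dropped f , branches f) (AF-× AF-DroppedRel (AF-× (AF-≼ₛ a) (AF-≼ₛ b))))

-- Vertices, edges and marks of a shape

data Tip : Shape → Set where
  here : ∀ {m} → Tip (tip m)
  inˡ  : ∀ {a b} → Tip a → Tip (fork a b)
  inʳ  : ∀ {a b} → Tip b → Tip (fork a b)

data Fork : Shape → Set where
  here : ∀ {a b} → Fork (fork a b)
  inˡ  : ∀ {a b} → Fork a → Fork (fork a b)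
  inʳ  : ∀ {a b} → Fork b → Fork (fork a b)

data Mark : Shape → Set where
  here : Mark (tip true)
  inˡ  : ∀ {a b} → Mark a → Mark (fork a b)
  inʳ  : ∀ {a b} → Mark b → Mark (fork a b)

module _ {a b : Shape} where

  inˡ-injectiveᵗ : {x y : Tip a} → inˡ {b = b} x ≡ inˡ y → x ≡ y
  inˡ-injectiveᵗ refl = refl

  inʳ-injectiveᵗ : {x y : Tip b} → inʳ {a} x ≡ inʳ y → x ≡ y
  inʳ-injectiveᵗ refl = refl

  inˡ-injectiveᶠ : {x y : Fork a} → inˡ {b = b} x ≡ inˡ y → x ≡ y
  inˡ-injectiveᶠ refl = refl

  inʳ-injectiveᶠ : {x y : Fork b} → inʳ {a} x ≡ inʳ y → x ≡ y
  inʳ-injectiveᶠ refl = refl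

  inˡ-injectiveᵐ : {x y : Mark a} → inˡ {b = b} x ≡ inˡ y → x ≡ y
  inˡ-injectiveᵐ refl = refl

  inʳ-injectiveᵐ : {x y : Mark b} → inʳ {a} x ≡ inʳ y → x ≡ y
  inʳ-injectiveᵐ refl = refl

root : ∀ a → Tip a
root (tip _)    = here
root (fork _ b) = inʳ (root b)

-- end e true is the child.
end : ∀ {a} → Fork a → Bool → Tip a
end {fork a b} here    true  = inˡ (root a)
end {fork a b} here    false = inʳ (root b)
end            (inˡ e) s     = inˡ (end e s)
end            (inʳ e) s     = inʳ (end e s)

markTip : ∀ {a} → Mark a → Tip a
markTip here    = here
markTip (inˡ m) = inˡ (markTip m)
markTip (inʳ m) = inʳ (markTip m)

unmarked⇒¬mark : ∀ {a} → Unmarked a → ¬ Mark a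
unmarked⇒¬mark (fork u _) (inˡ m) = unmarked⇒¬mark u m
unmarked⇒¬mark (fork _ v) (inʳ m) = unmarked⇒¬mark v m

-- The contraction given by an embedding

contract : ∀ {a b} → a ⊑ b → Tip b → Tip a
contract tip                 x       = x
contract (fork f g)          (inˡ x) = inˡ (contract f x)
contract (fork f g)          (inʳ x) = inʳ (contract g x)
contract {a} (dropˡ _ f)     (inˡ x) = root a
contract (dropˡ _ f)         (inʳ x) = contract f x
contract (dropʳ _ f)         (inˡ x) = contract f x
contract {a} (dropʳ _ f)     (inʳ x) = root a

section : ∀ {a b} → a ⊑ b → Tip a → Tip b
section tip         x       = x
section (fork f g)  (inˡ x) = inˡ (section f x)
section (fork f g)  (inʳ x) = inʳ (section g x)
section (dropˡ _ f) x       = inʳ (section f x)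
section (dropʳ _ f) x       = inˡ (section f x)

onFork : ∀ {a b} → a ⊑ b → Fork a → Fork b
onFork tip         e       = e
onFork (fork f g)  here    = here
onFork (fork f g)  (inˡ e) = inˡ (onFork f e)
onFork (fork f g)  (inʳ e) = inʳ (onFork g e)
onFork (dropˡ _ f) e       = inʳ (onFork f e)
onFork (dropʳ _ f) e       = inˡ (onFork f e)

onMark : ∀ {a b} → a ⊑ b → Mark a → Mark b
onMark tip         m       = m
onMark (fork f g)  (inˡ m) = inˡ (onMark f m)
onMark (fork f g)  (inʳ m) = inʳ (onMark g m)
onMark (dropˡ _ f) m       = inʳ (onMark f m)
onMark (dropʳ _ f) m       = inˡ (onMark f m)

onMark-surjective : ∀ {a b} (f : a ⊑ b) m → ∃[ m′ ] onMark f m′ ≡ m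
onMark-surjective tip         m       = m , refl
onMark-surjective (fork f g)  (inˡ m) = let (m′ , eq) = onMark-surjective f m in inˡ m′ , cong inˡ eq
onMark-surjective (fork f g)  (inʳ m) = let (m′ , eq) = onMark-surjective g m in inʳ m′ , cong inʳ eq
onMark-surjective (dropˡ u f) (inˡ m) = contradiction m (unmarked⇒¬mark u)
onMark-surjective (dropˡ u f) (inʳ m) = let (m′ , eq) = onMark-surjective f m in m′ , cong inʳ eq
onMark-surjective (dropʳ u f) (inˡ m) = let (m′ , eq) = onMark-surjective f m in m′ , cong inˡ eq
onMark-surjective (dropʳ u f) (inʳ m) = contradiction m (unmarked⇒¬mark u)

onMark-injective : ∀ {a b} (f : a ⊑ b) {m m′} → onMark f m ≡ onMark f m′ → m ≡ m′
onMark-injective tip         {here}  {here}  _  = refl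
onMark-injective (fork f g)  {inˡ _} {inˡ _} eq = cong inˡ (onMark-injective f (inˡ-injectiveᵐ eq))
onMark-injective (fork f g)  {inʳ _} {inʳ _} eq = cong inʳ (onMark-injective g (inʳ-injectiveᵐ eq))
onMark-injective (dropˡ _ f)                 eq = onMark-injective f (inʳ-injectiveᵐ eq)
onMark-injective (dropʳ _ f)                 eq = onMark-injective f (inˡ-injectiveᵐ eq)

contract-root : ∀ {a b} (f : a ⊑ b) → contract f (root b) ≡ root a
contract-root tip         = refl
contract-root (fork f g)  = cong inʳ (contract-root g)
contract-root (dropˡ _ f) = contract-root f
contract-root (dropʳ _ f) = refl

contract-section : ∀ {a b} (f : a ⊑ b) x → contract f (section f x) ≡ x
contract-section tip         x       = refl
contract-section (fork f g)  (inˡ x) = cong inˡ (contract-section f x)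
contract-section (fork f g)  (inʳ x) = cong inʳ (contract-section g x)
contract-section (dropˡ _ f) x       = contract-section f x
contract-section (dropʳ _ f) x       = contract-section f x

contract-end : ∀ {a b} (f : a ⊑ b) e s → contract f (end (onFork f e) s) ≡ end e s
contract-end (fork f g)  here    true  = cong inˡ (contract-root f)
contract-end (fork f g)  here    false = cong inʳ (contract-root g)
contract-end (fork f g)  (inˡ e) s     = cong inˡ (contract-end f e s)
contract-end (fork f g)  (inʳ e) s     = cong inʳ (contract-end g e s)
contract-end (dropˡ _ f) e       s     = contract-end f e s
contract-end (dropʳ _ f) e       s     = contract-end f e s

contract-mark : ∀ {a b} (f : a ⊑ b) m → contract f (markTip (onMark f m)) ≡ markTip m
contract-mark tip         m       = refl
contract-mark (fork f g)  (inˡ m) = cong inˡ (contract-mark f m)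
contract-mark (fork f g)  (inʳ m) = cong inʳ (contract-mark g m)
contract-mark (dropˡ _ f) m       = contract-mark f m
contract-mark (dropʳ _ f) m       = contract-mark f m

onFork-injective : ∀ {a b} (f : a ⊑ b) {e e′} → onFork f e ≡ onFork f e′ → e ≡ e′
onFork-injective (fork f g)  {here}  {here}  _  = refl
onFork-injective (fork f g)  {inˡ _} {inˡ _} eq = cong inˡ (onFork-injective f (inˡ-injectiveᶠ eq))
onFork-injective (fork f g)  {inʳ _} {inʳ _} eq = cong inʳ (onFork-injective g (inʳ-injectiveᶠ eq))
onFork-injective (dropˡ _ f)                 eq = onFork-injective f (inʳ-injectiveᶠ eq)
onFork-injective (dropʳ _ f)                 eq = onFork-injective f (inˡ-injectiveᶠ eq)

Contracted : ∀ {a b} → a ⊑ b → Fork b → Set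
Contracted f e = ∀ e′ → onFork f e′ ≢ e

fork-cases : ∀ {a b} (f : a ⊑ b) e → (∃[ e′ ] onFork f e′ ≡ e) ⊎ contract f (end e true) ≡ contract f (end e false)
fork-cases (fork f g)  here    = inj₁ (here , refl)
fork-cases (fork f g)  (inˡ e) with fork-cases f e
... | inj₁ (e′ , eq) = inj₁ (inˡ e′ , cong inˡ eq)
... | inj₂ eq        = inj₂ (cong inˡ eq)
fork-cases (fork f g)  (inʳ e) with fork-cases g e
... | inj₁ (e′ , eq) = inj₁ (inʳ e′ , cong inʳ eq)
... | inj₂ eq        = inj₂ (cong inʳ eq)
fork-cases (dropˡ _ f) here    = inj₂ (sym (contract-root f))
fork-cases (dropˡ _ f) (inˡ e) = inj₂ refl
fork-cases (dropˡ _ f) (inʳ e) with fork-cases f e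
... | inj₁ (e′ , eq) = inj₁ (e′ , cong inʳ eq)
... | inj₂ eq        = inj₂ eq
fork-cases (dropʳ _ f) here    = inj₂ (contract-root f)
fork-cases (dropʳ _ f) (inʳ e) = inj₂ refl
fork-cases (dropʳ _ f) (inˡ e) with fork-cases f e
... | inj₁ (e′ , eq) = inj₁ (e′ , cong inˡ eq)
... | inj₂ eq        = inj₂ eq

-- Paths along a set of tree edges

data Step {a} (P : Fork a → Set) : Rel (Tip a) 0ℓ where
  step : ∀ e s → P e → Step P (end e s) (end e (not s))

Path : ∀ {a} → (Fork a → Set) → Rel (Tip a) 0ℓ
Path P = Star (Step P)

module _ {a b : Shape} {P : Fork a → Set} {Q : Fork (fork a b) → Set} (P⇒Q : ∀ e → P e → Q (inˡ e)) where

  path-inˡ : ∀ {x y} → Path P x y → Path Q (inˡ x) (inˡ y)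
  path-inˡ = gmap inˡ λ { (step e s p) → step (inˡ e) s (P⇒Q e p) }

module _ {a b : Shape} {P : Fork b → Set} {Q : Fork (fork a b) → Set} (P⇒Q : ∀ e → P e → Q (inʳ e)) where

  path-inʳ : ∀ {x y} → Path P x y → Path Q (inʳ x) (inʳ y)
  path-inʳ = gmap inʳ λ { (step e s p) → step (inʳ e) s (P⇒Q e p) }

path-reverse : ∀ {a} {P : Fork a → Set} {x y} → Path P x y → Path P y x
path-reverse = reverse λ { (step e true p) → step e false p ; (step e false p) → step e true p }

tips-connected : ∀ {a} {P : Fork a → Set} → (∀ e → P e) → ∀ x y → Path P x y
tips-connected p here    here    = ε
tips-connected p (inˡ x) (inˡ y) = path-inˡ (λ _ q → q) (tips-connected (p ∘ inˡ) x y)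
tips-connected p (inʳ x) (inʳ y) = path-inʳ (λ _ q → q) (tips-connected (p ∘ inʳ) x y)
tips-connected p (inˡ x) (inʳ y) =
  path-inˡ (λ _ q → q) (tips-connected (p ∘ inˡ) x (root _)) ◅◅
  step here true (p here) ◅ path-inʳ (λ _ q → q) (tips-connected (p ∘ inʳ) (root _) y)
tips-connected p (inʳ x) (inˡ y) =
  path-inʳ (λ _ q → q) (tips-connected (p ∘ inʳ) x (root _)) ◅◅
  step here false (p here) ◅ path-inˡ (λ _ q → q) (tips-connected (p ∘ inˡ) (root _) y)

-- Shows that the fibres of `contract f` are connected by edges that f contracts: each tip is joined
-- to the representative of its fibre chosen by `section`.
path-section : ∀ {a b} (f : a ⊑ b) x → Path (Contracted f) x (section f (contract f x))
path-section tip         x       = ε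
path-section (fork f g)  (inˡ x) = path-inˡ (λ { e c (inˡ e′) refl → c e′ refl }) (path-section f x)
path-section (fork f g)  (inʳ x) = path-inʳ (λ { e c (inʳ e′) refl → c e′ refl }) (path-section g x)
path-section (dropˡ _ f) (inʳ x) = path-inʳ (λ { e c e′ refl → c e′ refl }) (path-section f x)
path-section (dropʳ _ f) (inˡ x) = path-inˡ (λ { e c e′ refl → c e′ refl }) (path-section f x)
-- A tip of the dropped branch goes to the root of that branch, crosses the fork, and continues from
-- `root b′`, which lies over the root of the embedded shape.
path-section (dropˡ {b′ = b′} u f) (inˡ x) =
  path-inˡ {P = λ e → Contracted (dropˡ u f) (inˡ e)} (λ _ c → c) (tips-connected (λ { _ _ () }) x (root _)) ◅◅
  step here true (λ _ ()) ◅
  path-inʳ (λ { e c e′ refl → c e′ refl })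
    (subst (λ y → Path (Contracted f) (root b′) (section f y)) (contract-root f) (path-section f (root b′)))
path-section (dropʳ {a′ = a′} u f) (inʳ x) =
  path-inʳ {P = λ e → Contracted (dropʳ u f) (inʳ e)} (λ _ c → c) (tips-connected (λ { _ _ () }) x (root _)) ◅◅
  step here false (λ _ ()) ◅
  path-inˡ (λ { e c e′ refl → c e′ refl })
    (subst (λ y → Path (Contracted f) (root a′) (section f y)) (contract-root f) (path-section f (root a′)))

contract-id : ∀ a x → contract (⊑-id a) x ≡ x
contract-id (tip _)    x       = refl
contract-id (fork a b) (inˡ x) = cong inˡ (contract-id a x)
contract-id (fork a b) (inʳ x) = cong inʳ (contract-id b x)

onFork-id : ∀ a e → onFork (⊑-id a) e ≡ e
onFork-id (fork a b) here    = refl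
onFork-id (fork a b) (inˡ e) = cong inˡ (onFork-id a e)
onFork-id (fork a b) (inʳ e) = cong inʳ (onFork-id b e)

onMark-id : ∀ a m → onMark (⊑-id a) m ≡ m
onMark-id (tip _)    m       = refl
onMark-id (fork a b) (inˡ m) = cong inˡ (onMark-id a m)
onMark-id (fork a b) (inʳ m) = cong inʳ (onMark-id b m)

contract-⊙ : ∀ {a b c} (g : b ⊑ c) (f : a ⊑ b) x → contract (g ⊙ₛ f) x ≡ contract f (contract g x)
contract-⊙ tip         f           x       = refl
contract-⊙ (dropˡ _ g) f           (inˡ x) = sym (contract-root f)
contract-⊙ (dropˡ _ g) f           (inʳ x) = contract-⊙ g f x
contract-⊙ (dropʳ _ g) f           (inˡ x) = contract-⊙ g f x
contract-⊙ (dropʳ _ g) f           (inʳ x) = sym (contract-root f)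
contract-⊙ (fork g h)  (fork f k)  (inˡ x) = cong inˡ (contract-⊙ g f x)
contract-⊙ (fork g h)  (fork f k)  (inʳ x) = cong inʳ (contract-⊙ h k x)
contract-⊙ (fork g h)  (dropˡ _ f) (inˡ x) = refl
contract-⊙ (fork g h)  (dropˡ _ f) (inʳ x) = contract-⊙ h f x
contract-⊙ (fork g h)  (dropʳ _ f) (inˡ x) = contract-⊙ g f x
contract-⊙ (fork g h)  (dropʳ _ f) (inʳ x) = refl

onFork-⊙ : ∀ {a b c} (g : b ⊑ c) (f : a ⊑ b) e → onFork (g ⊙ₛ f) e ≡ onFork g (onFork f e)
onFork-⊙ tip         f           e       = refl
onFork-⊙ (dropˡ _ g) f           e       = cong inʳ (onFork-⊙ g f e)
onFork-⊙ (dropʳ _ g) f           e       = cong inˡ (onFork-⊙ g f e)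
onFork-⊙ (fork g h)  (fork f k)  here    = refl
onFork-⊙ (fork g h)  (fork f k)  (inˡ e) = cong inˡ (onFork-⊙ g f e)
onFork-⊙ (fork g h)  (fork f k)  (inʳ e) = cong inʳ (onFork-⊙ h k e)
onFork-⊙ (fork g h)  (dropˡ _ f) e       = cong inʳ (onFork-⊙ h f e)
onFork-⊙ (fork g h)  (dropʳ _ f) e       = cong inˡ (onFork-⊙ g f e)

onMark-⊙ : ∀ {a b c} (g : b ⊑ c) (f : a ⊑ b) m → onMark (g ⊙ₛ f) m ≡ onMark g (onMark f m)
onMark-⊙ tip         f           m       = refl
onMark-⊙ (dropˡ _ g) f           m       = cong inʳ (onMark-⊙ g f m)
onMark-⊙ (dropʳ _ g) f           m       = cong inˡ (onMark-⊙ g f m)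
onMark-⊙ (fork g h)  (fork f k)  (inˡ m) = cong inˡ (onMark-⊙ g f m)
onMark-⊙ (fork g h)  (fork f k)  (inʳ m) = cong inʳ (onMark-⊙ h k m)
onMark-⊙ (fork g h)  (dropˡ _ f) m       = cong inʳ (onMark-⊙ h f m)
onMark-⊙ (fork g h)  (dropʳ _ f) m       = cong inˡ (onMark-⊙ g f m)

-- Finite sums of integers

open Sum ℤ.+-*-semiring using (sum; sum-cong-≗; ∑-distrib-+; ∑-comm; *-distribˡ-sum; *-distribʳ-sum; sum-remove; sum-replicate-zero)

⟦_⟧ : ∀ {P : Set} → Dec P → ℤ
⟦ yes _ ⟧ = + 1
⟦ no _ ⟧  = + 0

⟦_⟧-yes : ∀ {P : Set} (d : Dec P) → P → ⟦ d ⟧ ≡ + 1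
⟦ yes _ ⟧-yes _ = refl
⟦ no ¬p ⟧-yes p = contradiction p ¬p

⟦_⟧-no : ∀ {P : Set} (d : Dec P) → ¬ P → ⟦ d ⟧ ≡ + 0
⟦ yes p ⟧-no ¬p = contradiction p ¬p
⟦ no _ ⟧-no  _  = refl

∑-zero : ∀ {n} {f : Fin n → ℤ} → (∀ i → f i ≡ + 0) → sum f ≡ + 0
∑-zero {n} eq = trans (sum-cong-≗ eq) (sum-replicate-zero n)

∑-single : ∀ {n} {f : Fin n → ℤ} i → (∀ j → j ≢ i → f j ≡ + 0) → sum f ≡ f i
∑-single {suc n} {f} i eq = trans (sum-remove {i = i} f)
  (trans (cong (λ s → f i ℤ.+ s) (∑-zero (λ j → eq (punchIn i j) (Fin.punchInᵢ≢i i j)))) (ℤ.+-identityʳ (f i)))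

∑-δ : ∀ {n} (F : Fin n → ℤ) x → sum (λ y → ⟦ x Fin.≟ y ⟧ ℤ.* F y) ≡ F x
∑-δ F x = trans
  (∑-single x (λ y y≢x → trans (cong (ℤ._* F y) (⟦ x Fin.≟ y ⟧-no (y≢x ∘ sym))) (ℤ.*-zeroˡ (F y))))
  (trans (cong (ℤ._* F x) (⟦ x Fin.≟ x ⟧-yes refl)) (ℤ.*-identityˡ (F x)))

-- Every x is `e l u` for exactly one pair (l , u). Inserting the indicator of `e l u ≡ x` and
-- exchanging the sums uses this without building a bijection.
∑-fibres : ∀ {m n} (θ : Fin n → Fin m) {k : Fin m → ℕ} (e : ∀ l → Fin (k l) → Fin n) →
           (∀ l u → θ (e l u) ≡ l) → (∀ x → ∃[ u ] e (θ x) u ≡ x) →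
           (∀ l {u v} → e l u ≡ e l v → u ≡ v) →
           (F : Fin n → ℤ) → sum F ≡ sum (λ l → sum (λ u → F (e l u)))
∑-fibres θ {k} e sound complete injective F = sym (begin
  sum (λ l → sum (λ u → F (e l u)))
    ≡⟨ sum-cong-≗ (λ l → sum-cong-≗ (λ u → sym (∑-δ F (e l u)))) ⟩
  sum (λ l → sum (λ u → sum (λ x → I l u x)))
    ≡⟨ sum-cong-≗ (λ l → ∑-comm (I l)) ⟩
  sum (λ l → sum (λ x → sum (λ u → I l u x)))
    ≡⟨ ∑-comm (λ l x → sum (λ u → I l u x)) ⟩
  sum (λ x → sum (λ l → sum (λ u → I l u x)))
    ≡⟨ sum-cong-≗ count ⟩
  sum F ∎)
  where
  open ≡-Reasoning

  I : ∀ l → Fin (k l) → Fin _ → ℤ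
  I l u x = ⟦ e l u Fin.≟ x ⟧ ℤ.* F x

  I-zero : ∀ l u x → e l u ≢ x → I l u x ≡ + 0
  I-zero l u x ≢ = trans (cong (ℤ._* F x) (⟦ e l u Fin.≟ x ⟧-no ≢)) (ℤ.*-zeroˡ (F x))

  count : ∀ x → sum (λ l → sum (λ u → I l u x)) ≡ F x
  count x = let (u₀ , eq) = complete x in begin
    sum (λ l → sum (λ u → I l u x))
      ≡⟨ ∑-single (θ x) (λ l l≢ → ∑-zero (λ u → I-zero l u x (λ eq → l≢ (trans (sym (sound l u)) (cong θ eq))))) ⟩
    sum (λ u → I (θ x) u x)
      ≡⟨ ∑-single u₀ (λ u u≢ → I-zero (θ x) u x (λ eq′ → u≢ (injective (θ x) (trans eq′ (sym eq))))) ⟩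
    I (θ x) u₀ x
      ≡⟨ cong (ℤ._* F x) (⟦ e (θ x) u₀ Fin.≟ x ⟧-yes eq) ⟩
    + 1 ℤ.* F x
      ≡⟨ ℤ.*-identityˡ (F x) ⟩
    F x ∎

∑-list : ∀ {A : Set} (f : A → ℕ) {n} (g : Fin n → A) → + sumᴸ (map f (tabulate g)) ≡ sum (λ i → + f (g i))
∑-list f {zero}  g = refl
∑-list f {suc n} g = cong (λ s → + f (g zero) ℤ.+ s) (∑-list f (g ∘ suc))

∑-const : ∀ n c → sum {n} (λ _ → c) ≡ + n ℤ.* c
∑-const zero    c = sym (ℤ.*-zeroˡ c)
∑-const (suc n) c = trans (cong (ℤ._+_ c) (∑-const n c)) (sym (ℤ.suc-* (+ n) c))

-- Morphisms as contractions

open OperadicGraph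
open GenusGraph

-- Minus the Euler characteristic of a vertex punctured at its half-edges; this
-- is additive under contraction, which makes the genus condition linear.
weight : (p : GenusGraph) → Vertex (graph p) → ℤ
weight p v = + (genus p v ℕ.+ genus p v ℕ.+ arity (graph p) v) ℤ.- + 2

-- Integral against the measure `weight`. The genus condition says that φ pushes the measure of q
-- forward to that of p, a form that composes and cancels.
∫ : (p : GenusGraph) → (Vertex (graph p) → ℤ) → ℤ
∫ p k = sum (λ v → k v ℤ.* weight p v)

-- Each edge has two half-edges and each leaf one, so the sum is 2Σg + 2E + L - 2V. This is the
-- weight of a single vertex whose genus is the total genus and whose half-edges are the leaves.
∑-weight : ∀ p → sum (weight p) ≡ totalGenus p ℤ.+ totalGenus p ℤ.- + 2 ℤ.+ + #L (graph p)
∑-weight p = begin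
  sum (weight p)
    ≡⟨ ∑-distrib-+ (λ v → + (g v ℕ.+ g v ℕ.+ arity Γ v)) (λ _ → ℤ.- + 2) ⟩
  sum (λ v → + (g v ℕ.+ g v ℕ.+ arity Γ v)) ℤ.+ sum {#V Γ} (λ _ → ℤ.- + 2)
    ≡⟨ cong₂ ℤ._+_ (sym (∑-list (λ v → g v ℕ.+ g v ℕ.+ arity Γ v) id)) (∑-const (#V Γ) (ℤ.- + 2)) ⟩
  + sumᴸ (map (λ v → g v ℕ.+ g v ℕ.+ arity Γ v) (vertices Γ)) ℤ.+ + #V Γ ℤ.* ℤ.- + 2
    ≡⟨ cong (λ s → + s ℤ.+ + #V Γ ℤ.* ℤ.- + 2) (trans (sum-map-+ (λ v → g v ℕ.+ g v) (arity Γ) (vertices Γ))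
         (cong₂ ℕ._+_ (sum-map-+ g g (vertices Γ)) (sym (GraphProperties.2#E+#L Γ)))) ⟩
  + (G ℕ.+ G ℕ.+ (#E Γ ℕ.+ #E Γ ℕ.+ #L Γ)) ℤ.+ + #V Γ ℤ.* ℤ.- + 2
    ≡⟨ rearrange (+ G) (+ #E Γ) (+ #V Γ) (+ #L Γ) ⟩
  totalGenus p ℤ.+ totalGenus p ℤ.- + 2 ℤ.+ + #L Γ ∎
  where
  open ≡-Reasoning
  Γ = graph p
  g = genus p
  G = sumᴸ (map g (vertices Γ))

  rearrange : ∀ s e v n → s ℤ.+ s ℤ.+ (e ℤ.+ e ℤ.+ n) ℤ.+ v ℤ.* ℤ.- + 2 ≡
    (s ℤ.+ (e ℤ.- v ℤ.+ + 1)) ℤ.+ (s ℤ.+ (e ℤ.- v ℤ.+ + 1)) ℤ.- + 2 ℤ.+ n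
  rearrange = ℤSolver.solve-∀

module _ (g n : ℕ) (p : GenusGraph) (n≡ : #L (graph p) ≡ n) where
  private
    rearrange : ∀ t n → t ℤ.+ t ℤ.- + 2 ℤ.+ n ≡ (t ℤ.+ t ℤ.+ n) ℤ.- + 2
    rearrange = ℤSolver.solve-∀

    ∑-weight′ : sum (weight p) ≡ totalGenus p ℤ.+ totalGenus p ℤ.+ + n ℤ.- + 2
    ∑-weight′ = trans (∑-weight p)
      (trans (cong (λ k → totalGenus p ℤ.+ totalGenus p ℤ.- + 2 ℤ.+ + k) n≡) (rearrange (totalGenus p) (+ n)))

  genus⇒weight : + g ≡ totalGenus p → sum (weight p) ≡ + (g ℕ.+ g ℕ.+ n) ℤ.- + 2
  genus⇒weight eq = trans ∑-weight′ (cong (λ t → t ℤ.+ t ℤ.+ + n ℤ.- + 2) (sym eq))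

  weight⇒genus : sum (weight p) ≡ + (g ℕ.+ g ℕ.+ n) ℤ.- + 2 → + g ≡ totalGenus p
  weight⇒genus eq = ℤ.*-cancelˡ-≡ (+ 2) (+ g) (totalGenus p)
    (trans (halve (+ g) (+ n))
      (trans (cong (λ s → s ℤ.+ + 2 ℤ.- + n) (trans (sym eq) ∑-weight′)) (sym (halve (totalGenus p) (+ n)))))
    where
    halve : ∀ t n → + 2 ℤ.* t ≡ (t ℤ.+ t ℤ.+ n ℤ.- + 2) ℤ.+ + 2 ℤ.- n
    halve = ℤSolver.solve-∀

module _ (p q : GenusGraph) (φ : Vertex (graph q) → Vertex (graph p))
         (ψ : HalfEdge (graph p) → HalfEdge (graph q)) where

  Linked : Rel (Vertex (graph q)) 0ℓ
  Linked x y = ∃[ h ] ((∀ h′ → ψ h′ ≢ h) × t (graph q) h ≡ x × t (graph q) (inv (graph q) h) ≡ y)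

  -- All that a morphism amounts to in terms of φ and ψ. No field mentions another one and each is
  -- decidable over finite sets (leaves are matched by `toℕ` instead of a cast), so contractions can
  -- be enumerated. `surjective`, `fibres` and `balanced` make the parts nonempty, connected and of
  -- the right genus.
  record IsContraction : Set where
    field
      φ-ψ         : ∀ h → φ (t (graph q) (ψ h)) ≡ t (graph p) h
      ψ-injective : ∀ h h′ → ψ h ≡ ψ h′ → h ≡ h′
      ψ-inv       : ∀ h → inv (graph q) (ψ h) ≡ ψ (inv (graph p) h)
      #L-≡        : #L (graph p) ≡ #L (graph q)
      ψ-leaf      : ∀ k k′ → toℕ k ≡ toℕ k′ → leaf (graph q) k′ ≡ ψ (leaf (graph p) k)
      internal    : ∀ h → (∃[ h′ ] ψ h′ ≡ h) ⊎ φ (t (graph q) (inv (graph q) h)) ≡ φ (t (graph q) h)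
      surjective  : ∀ l → ∃[ x ] φ x ≡ l
      fibres      : ∀ x y → φ x ≡ φ y → Star Linked x y
      balanced    : ∀ l → ∫ q (λ x → ⟦ φ x Fin.≟ l ⟧) ≡ weight p l

    internal′ : ∀ h → (∀ h′ → ψ h′ ≢ h) → φ (t (graph q) (inv (graph q) h)) ≡ φ (t (graph q) h)
    internal′ h ∉ψ with internal h
    ... | inj₁ (h′ , eq) = contradiction eq (∉ψ h′)
    ... | inj₂ eq        = eq

    ∫-φ : ∀ k → ∫ q (k ∘ φ) ≡ ∫ p k
    ∫-φ k = begin
      sum (λ x → k (φ x) ℤ.* weight q x)
        ≡⟨ sum-cong-≗ (λ x → trans (cong (ℤ._* weight q x) (sym (∑-δ k (φ x))))
             (*-distribʳ-sum (weight q x) (λ l → ⟦ φ x Fin.≟ l ⟧ ℤ.* k l))) ⟩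
      sum (λ x → sum (λ l → ⟦ φ x Fin.≟ l ⟧ ℤ.* k l ℤ.* weight q x))
        ≡⟨ ∑-comm (λ x l → ⟦ φ x Fin.≟ l ⟧ ℤ.* k l ℤ.* weight q x) ⟩
      sum (λ l → sum (λ x → ⟦ φ x Fin.≟ l ⟧ ℤ.* k l ℤ.* weight q x))
        ≡⟨ sum-cong-≗ (λ l → trans (sum-cong-≗ (λ x → swap ⟦ φ x Fin.≟ l ⟧ (k l) (weight q x)))
             (sym (*-distribˡ-sum (k l) (λ x → ⟦ φ x Fin.≟ l ⟧ ℤ.* weight q x)))) ⟩
      sum (λ l → k l ℤ.* ∫ q (λ x → ⟦ φ x Fin.≟ l ⟧))
        ≡⟨ sum-cong-≗ (λ l → cong (k l ℤ.*_) (balanced l)) ⟩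
      sum (λ l → k l ℤ.* weight p l) ∎
      where
      open ≡-Reasoning

      swap : ∀ a b c → a ℤ.* b ℤ.* c ≡ b ℤ.* (a ℤ.* c)
      swap = ℤSolver.solve-∀

    collapsed : Collapse (graph p) (graph q)
    collapsed = record
      { φ = φ
      ; ψ = ψ
      ; φ-ψ = φ-ψ
      ; ψ-injective = ψ-injective _ _
      ; ψ-inv = ψ-inv
      ; #L-≡ = #L-≡
      ; ψ-leaf = λ k → ψ-leaf k (cast #L-≡ k) (sym (Fin.toℕ-cast #L-≡ k))
      ; internal = λ h ∉ψ → internal′ h (λ h′ eq → ∉ψ (h′ , eq))
      }

  ∫-δ : ∀ l → ∫ p (λ m → ⟦ m Fin.≟ l ⟧) ≡ weight p l
  ∫-δ l = trans (∑-single l (λ m m≢ → trans (cong (ℤ._* weight p m) (⟦ m Fin.≟ l ⟧-no m≢)) (ℤ.*-zeroˡ (weight p m))))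
    (trans (cong (ℤ._* weight p l) (⟦ l Fin.≟ l ⟧-yes refl)) (ℤ.*-identityˡ _))

  module _ {k : Vertex (graph p) → ℕ} (e : ∀ l → Fin (k l) → Vertex (graph q))
           (φ-e : ∀ l u → φ (e l u) ≡ l) (e-complete : ∀ x → ∃[ u ] e (φ x) u ≡ x)
           (e-injective : ∀ l {u v} → e l u ≡ e l v → u ≡ v) where

    ∫-fibre : ∀ l → ∫ q (λ x → ⟦ φ x Fin.≟ l ⟧) ≡ sum (λ u → weight q (e l u))
    ∫-fibre l = begin
      sum (λ x → ⟦ φ x Fin.≟ l ⟧ ℤ.* weight q x)
        ≡⟨ ∑-fibres φ e φ-e e-complete e-injective (λ x → ⟦ φ x Fin.≟ l ⟧ ℤ.* weight q x) ⟩
      sum (λ m → sum (λ u → ⟦ φ (e m u) Fin.≟ l ⟧ ℤ.* weight q (e m u)))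
        ≡⟨ ∑-single l (λ m m≢ → ∑-zero (λ u → trans (cong (ℤ._* weight q (e m u))
             (⟦ φ (e m u) Fin.≟ l ⟧-no (m≢ ∘ trans (sym (φ-e m u))))) (ℤ.*-zeroˡ (weight q (e m u))))) ⟩
      sum (λ u → ⟦ φ (e l u) Fin.≟ l ⟧ ℤ.* weight q (e l u))
        ≡⟨ sum-cong-≗ (λ u → trans (cong (ℤ._* weight q (e l u)) (⟦ φ (e l u) Fin.≟ l ⟧-yes (φ-e l u))) (ℤ.*-identityˡ _)) ⟩
      sum (λ u → weight q (e l u)) ∎
      where open ≡-Reasoning

-- Opaque only to keep conversion checking fast.
opaque
  contraction⇒hom : ∀ {p q φ ψ} → IsContraction p q φ ψ → Hom p q
  contraction⇒hom {p} {q} {φ} {ψ} c = record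
    { part = part
    ; part-genus = λ l → weight⇒genus (genus p l) (arity (graph p) l) (part l) refl
        (trans (sym (∫-fibre p q φ ψ κ φ-κ (λ x → κ-fibre (φ x) x refl) (λ l → mono⇒injective (κ-mono-< l)) l))
               (balanced l))
    ; substitution = reconstruct
    ; ι-genus = λ _ _ → refl
    }
    where
    open IsContraction c
    open Parts collapsed

    -- A path of contracted edges that starts in the fibre over l never leaves it, because the
    -- involution of the part cut out of q follows such edges.
    cut-path : ∀ l u v {x y} → κ l u ≡ x → κ l v ≡ y → Star (Linked p q φ ψ) x y → Star (Adjacent (cut l)) u v
    cut-path l u v equ eqv ε with mono⇒injective (κ-mono-< l) (trans equ (sym eqv))
    ... | refl = ε
    cut-path l u v refl eqv (((_ , i) , ∉ψ , refl , refl) ◅ path) =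
      ((u , i) , refl , refl) ◅
      cut-path l _ v (cong proj₁ (invₗ-inner l (u , i) (λ (h′ , eq) → ∉ψ h′ eq))) eqv path

    part : Vertex (graph p) → GenusGraph
    part l = record
      { graph = cut l
      ; genus = genus q ∘ κ l
      ; nonempty = let (x , eq) = surjective l in ℕ.≤-<-trans z≤n (Fin.toℕ<n (proj₁ (κ-fibre l x eq)))
      ; connected = λ u v → cut-path l u v refl refl (fibres _ _ (trans (φ-κ l u) (sym (φ-κ l v))))
      }

  φ-contraction⇒hom : ∀ {p q φ ψ} (c : IsContraction p q φ ψ) → φₕ (contraction⇒hom c) ≗ φ
  φ-contraction⇒hom c _ = refl

  ψ-contraction⇒hom : ∀ {p q φ ψ} (c : IsContraction p q φ ψ) → Hom.ψ (contraction⇒hom c) ≗ ψ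
  ψ-contraction⇒hom c = Parts.reconstruct-ψ (IsContraction.collapsed c)

hom⇒contraction : ∀ {p q} (f : Hom p q) → IsContraction p q (φₕ f) (Hom.ψ f)
hom⇒contraction {p} {q} f = record
  { φ-ψ = SP.φ-ψ
  ; ψ-injective = λ _ _ → SP.ψ-injective
  ; ψ-inv = F.inv-outer
  ; #L-≡ = F.#L-≡
  ; ψ-leaf = λ k k′ eq → trans (cong (leaf (graph q))
      (Fin.toℕ-injective (trans (sym eq) (sym (Fin.toℕ-cast F.#L-≡ k))))) (F.leaf-outer k)
  ; internal = internal
  ; surjective = λ l → _ , SP.φ-ι l (Fin.fromℕ< (nonempty (F.part l)))
  ; fibres = λ x y eq → let (u , equ) = SP.ι-fibre x _ refl ; (v , eqv) = SP.ι-fibre y _ (sym eq) in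
      subst (λ z → Star Lk z y) equ (subst (Star Lk _) eqv (ι-path (φₕ f x) (connected (F.part (φₕ f x)) u v)))
  ; balanced = λ l → trans
      (∫-fibre p q (φₕ f) F.ψ F.ι SP.φ-ι (λ x → SP.ι-fibre x _ refl) (λ l → SP.ι-injective) l)
      (trans (sum-cong-≗ (λ u → cong₂ (λ g a → + (g ℕ.+ g ℕ.+ a) ℤ.- + 2) (F.ι-genus l u) (sym (F.ι-arity l u))))
             (genus⇒weight (genus p l) (arity (graph p) l) (F.part l) (F.part-leaves l) (F.part-genus l)))
  }
  where
  module F = Hom f
  module SP = SubstitutionProperties F.substitution
  module C = Collapse (collapse F.substitution)

  Lk : Rel (Vertex (graph q)) 0ℓ
  Lk = Linked p q (φₕ f) F.ψ

  internal : ∀ h → (∃[ h′ ] F.ψ h′ ≡ h) ⊎ φₕ f (t (graph q) (inv (graph q) h)) ≡ φₕ f (t (graph q) h)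
  internal h with C.ψ? h
  ... | yes ∈ψ = inj₁ ∈ψ
  ... | no ∉ψ  = inj₂ (C.internal h ∉ψ)

  ι-path : ∀ l {u v} → Star (Adjacent (graph (F.part l))) u v → Star Lk (F.ι l u) (F.ι l v)
  ι-path l ε = ε
  ι-path l ((h , refl , refl) ◅ path) with GraphProperties._≟ₕ_ (graph (F.part l)) (inv (graph (F.part l)) h) h
  ... | yes fix = subst (λ k → Star Lk (F.ι l (proj₁ h)) (F.ι l (proj₁ k))) (sym fix) ε ◅◅ ι-path l path
  ... | no ¬fix = (F.γ l h , ∉ψ , refl , cong proj₁ (F.inv-inner l h ¬fix)) ◅ ι-path l path
    where
    ∉ψ : ∀ h′ → F.ψ h′ ≢ F.γ l h
    ∉ψ h′ eq = let (i , eq′) = C.ψ-fibre l eq (SP.φ-γ l h) in ¬fix (SP.ψ⇒fixed l h i eq′)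

-- Composition and cancellation of contractions

record IsComposite {p q r : GenusGraph} (k : Hom p r) (g : Hom q r) (f : Hom p q) : Set where
  field
    φ-composite : ∀ x → φₕ k x ≡ φₕ f (φₕ g x)
    ψ-composite : ∀ h → Hom.ψ k h ≡ Hom.ψ g (Hom.ψ f h)

composite⇒≈ : ∀ {p q r} {k : Hom p r} {g : Hom q r} {f : Hom p q} → IsComposite k g f →
              Category._≈_ numOpᵒᵖ k (Category._⊚_ numOpᵒᵖ g f)
composite⇒≈ {k = k} {g} {f} c =
  ∼⇒≈ {f = k} {g ∘ₕ f} (φ-composite , λ h → trans (ψ-composite h) (sym (ψ-∘ₕ g f h)))
  where open IsComposite c

≈-idₕ : ∀ {p} {k : Hom p p} → (∀ x → φₕ k x ≡ x) → (∀ h → Hom.ψ k h ≡ h) → k ≈ₕ idₕ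
≈-idₕ {p} {k} φ-eq ψ-eq = ∼⇒≈ {f = k} {idₕ} (φ-eq , λ h → trans (ψ-eq h) (sym (ψ-idₕ p h)))

-- Left cancellation of g. Since `φₕ g` is surjective and `Hom.ψ g` is injective, each condition on
-- φ and ψ may be checked after composing with g, where it is a condition on f; for `balanced` this
-- uses that `φₕ g` preserves integrals.
factor : ∀ {p q r} {φ : Vertex (graph q) → Vertex (graph p)} {ψ : HalfEdge (graph p) → HalfEdge (graph q)} →
         (f : Hom p r) (g : Hom q r) → (∀ x → φ (φₕ g x) ≡ φₕ f x) → (∀ h → Hom.ψ g (ψ h) ≡ Hom.ψ f h) →
         IsContraction p q φ ψ
factor {p} {q} {r} {φ} {ψ} f g φ-eq ψ-eq = record
  { φ-ψ = λ h → begin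
      φ (t Q (ψ h))              ≡⟨ cong φ (G.φ-ψ (ψ h)) ⟨
      φ (φₕ g (t R (gψ (ψ h))))  ≡⟨ φ-eq _ ⟩
      φₕ f (t R (gψ (ψ h)))      ≡⟨ cong (φₕ f ∘ t R) (ψ-eq h) ⟩
      φₕ f (t R (fψ h))          ≡⟨ F.φ-ψ h ⟩
      t (graph p) h              ∎
  ; ψ-injective = λ h h′ eq → F.ψ-injective h h′ (trans (sym (ψ-eq h)) (trans (cong gψ eq) (ψ-eq h′)))
  ; ψ-inv = λ h → G.ψ-injective _ _ (begin
      gψ (inv Q (ψ h))       ≡⟨ G.ψ-inv (ψ h) ⟨
      inv R (gψ (ψ h))       ≡⟨ cong (inv R) (ψ-eq h) ⟩
      inv R (fψ h)           ≡⟨ F.ψ-inv h ⟩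
      fψ (inv (graph p) h)   ≡⟨ ψ-eq _ ⟨
      gψ (ψ (inv (graph p) h)) ∎)
  ; #L-≡ = trans F.#L-≡ (sym G.#L-≡)
  ; ψ-leaf = λ k k′ eq → G.ψ-injective _ _ (begin
      gψ (leaf Q k′)             ≡⟨ G.ψ-leaf k′ (cast G.#L-≡ k′) (sym (Fin.toℕ-cast G.#L-≡ k′)) ⟨
      leaf R (cast G.#L-≡ k′)    ≡⟨ F.ψ-leaf k _ (trans eq (sym (Fin.toℕ-cast G.#L-≡ k′))) ⟩
      fψ (leaf (graph p) k)      ≡⟨ ψ-eq _ ⟨
      gψ (ψ (leaf (graph p) k))  ∎)
  ; internal = internal
  ; surjective = λ l → let (x , eq) = F.surjective l in φₕ g x , trans (φ-eq x) eq
  ; fibres = fibres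
  ; balanced = λ l → begin
      ∫ q (λ y → ⟦ φ y Fin.≟ l ⟧)          ≡⟨ G.∫-φ (λ y → ⟦ φ y Fin.≟ l ⟧) ⟨
      ∫ r (λ x → ⟦ φ (φₕ g x) Fin.≟ l ⟧)   ≡⟨ sum-cong-≗ (λ x → cong (λ z → ⟦ z Fin.≟ l ⟧ ℤ.* weight r x) (φ-eq x)) ⟩
      ∫ r (λ x → ⟦ φₕ f x Fin.≟ l ⟧)       ≡⟨ F.balanced l ⟩
      weight p l                           ∎
  }
  where
  open ≡-Reasoning
  module F = IsContraction (hom⇒contraction f)
  module G = IsContraction (hom⇒contraction g)
  Q = graph q
  R = graph r
  fψ = Hom.ψ f
  gψ = Hom.ψ g

  t-inv : ∀ h → φₕ g (t R (inv R (gψ h))) ≡ t Q (inv Q h)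
  t-inv h = trans (cong (φₕ g ∘ t R) (G.ψ-inv h)) (G.φ-ψ (inv Q h))

  internal : ∀ h → (∃[ h′ ] ψ h′ ≡ h) ⊎ φ (t Q (inv Q h)) ≡ φ (t Q h)
  internal h with F.internal (gψ h)
  ... | inj₁ (h′ , eq) = inj₁ (h′ , G.ψ-injective _ _ (trans (ψ-eq h′) eq))
  ... | inj₂ eq = inj₂ (begin
    φ (t Q (inv Q h))                  ≡⟨ cong φ (t-inv h) ⟨
    φ (φₕ g (t R (inv R (gψ h))))      ≡⟨ φ-eq _ ⟩
    φₕ f (t R (inv R (gψ h)))          ≡⟨ eq ⟩
    φₕ f (t R (gψ h))                  ≡⟨ φ-eq _ ⟨
    φ (φₕ g (t R (gψ h)))              ≡⟨ cong φ (G.φ-ψ h) ⟩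
    φ (t Q h)                          ∎)

  image : ∀ {x y} → Star (Linked p r (φₕ f) fψ) x y → Star (Linked p q φ ψ) (φₕ g x) (φₕ g y)
  image ε = ε
  -- An edge of r whose ends g identifies becomes a constant step; any other one comes from an edge
  -- of q, which ψ misses because f misses its image.
  image {y = y} ((h , ∉ψ , refl , refl) ◅ path) with G.internal h
  ... | inj₂ eq = subst (λ z → Star (Linked p q φ ψ) z (φₕ g y)) eq (image path)
  ... | inj₁ (k , refl) =
    (k , (λ h′ eq → ∉ψ h′ (trans (sym (ψ-eq h′)) (cong gψ eq))) , sym (G.φ-ψ k) , sym (t-inv k)) ◅ image path

  fibres : ∀ x y → φ x ≡ φ y → Star (Linked p q φ ψ) x y
  fibres x y eq with G.surjective x | G.surjective y
  ... | x′ , refl | y′ , refl = image (F.fibres x′ y′ (trans (sym (φ-eq x′)) (trans eq (φ-eq y′))))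

-- Finite types

record Finite (A : Set) : Set where
  field
    size    : ℕ
    to      : A → Fin size
    from    : Fin size → A
    from-to : ∀ x → from (to x) ≡ x
    to-from : ∀ i → to (from i) ≡ i

  to-injective : ∀ {x y} → to x ≡ to y → x ≡ y
  to-injective {x} {y} eq = trans (sym (from-to x)) (trans (cong from eq) (from-to y))

  from-injective : ∀ {i j} → from i ≡ from j → i ≡ j
  from-injective {i} {j} eq = trans (sym (to-from i)) (trans (cong to eq) (to-from j))

  _≟ᶠ_ : (x y : A) → Dec (x ≡ y)
  x ≟ᶠ y = map′ to-injective (cong to) (to x Fin.≟ to y)

  any?ᶠ : ∀ {P : A → Set} → (∀ x → Dec (P x)) → Dec (∃[ x ] P x)
  any?ᶠ {P} P? = map′ (λ (i , p) → from i , p) (λ (x , p) → to x , subst P (sym (from-to x)) p)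
                      (Fin.any? (λ i → P? (from i)))

  all?ᶠ : ∀ {P : A → Set} → (∀ x → Dec (P x)) → Dec (∀ x → P x)
  all?ᶠ {P} P? = map′ (λ f x → subst P (from-to x) (f (to x))) (λ f i → f (from i))
                      (Fin.all? (λ i → P? (from i)))

  ∑ᶠ : (A → ℤ) → ℤ
  ∑ᶠ f = sum (f ∘ from)

open Finite

finite-Fin : ∀ n → Finite (Fin n)
finite-Fin n = record { size = n ; to = id ; from = id ; from-to = λ _ → refl ; to-from = λ _ → refl }

finite-⊥ : Finite ⊥
finite-⊥ = record { size = 0 ; to = λ () ; from = λ () ; from-to = λ () ; to-from = λ () }

finite-⊤ : Finite ⊤
finite-⊤ = record { size = 1 ; to = λ _ → zero ; from = λ _ → tt ; from-to = λ _ → refl ; to-from = λ { zero → refl } }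

finite-↔ : ∀ {A B : Set} (f : A → B) (g : B → A) → (∀ x → g (f x) ≡ x) → (∀ y → f (g y) ≡ y) → Finite A → Finite B
finite-↔ f g gf fg F = record
  { size = size F
  ; to = to F ∘ g
  ; from = f ∘ from F
  ; from-to = λ y → trans (cong f (from-to F (g y))) (fg y)
  ; to-from = λ i → trans (cong (to F) (gf (from F i))) (to-from F i)
  }

finite-⊎ : ∀ {A B : Set} → Finite A → Finite B → Finite (A ⊎ B)
finite-⊎ F G = record
  { size = size F ℕ.+ size G
  ; to = join (size F) (size G) ∘ ⊎-map (to F) (to G)
  ; from = ⊎-map (from F) (from G) ∘ splitAt (size F)
  ; from-to = λ z → trans (cong (⊎-map (from F) (from G)) (Fin.splitAt-join (size F) (size G) (⊎-map (to F) (to G) z))) (there-back z)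
  ; to-from = λ i → trans (cong (join (size F) (size G)) (back-there (splitAt (size F) i))) (Fin.join-splitAt (size F) (size G) i)
  }
  where
  there-back : ∀ z → ⊎-map (from F) (from G) (⊎-map (to F) (to G) z) ≡ z
  there-back (inj₁ x) = cong inj₁ (from-to F x)
  there-back (inj₂ y) = cong inj₂ (from-to G y)

  back-there : ∀ z → ⊎-map (to F) (to G) (⊎-map (from F) (from G) z) ≡ z
  back-there (inj₁ i) = cong inj₁ (to-from F i)
  back-there (inj₂ j) = cong inj₂ (to-from G j)

∑ᶠ-⊎ : ∀ {A B : Set} (F : Finite A) (G : Finite B) f → ∑ᶠ (finite-⊎ F G) f ≡ ∑ᶠ F (f ∘ inj₁) ℤ.+ ∑ᶠ G (f ∘ inj₂)
∑ᶠ-⊎ F G f = go (size F) (from F)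
  where
  go : ∀ m (h : Fin m → _) → sum (λ i → f (⊎-map h (from G) (splitAt m i))) ≡ sum (f ∘ inj₁ ∘ h) ℤ.+ ∑ᶠ G (f ∘ inj₂)
  go zero    h = sym (ℤ.+-identityˡ _)
  go (suc m) h = trans
    (cong (λ s → f (inj₁ (h zero)) ℤ.+ s) (trans (sum-cong-≗ (λ i → cong f (shift (splitAt m i)))) (go m (h ∘ suc))))
    (sym (ℤ.+-assoc (f (inj₁ (h zero))) _ _))
    where
    shift : ∀ z → ⊎-map h (from G) (⊎-map suc id z) ≡ ⊎-map (h ∘ suc) (from G) z
    shift (inj₁ _) = refl
    shift (inj₂ _) = refl

finite-×Bool : ∀ {A : Set} → Finite A → Finite (A × Bool)
finite-×Bool F = finite-↔ to′ from′ from-to′ to-from′ (finite-⊎ F F)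
  where
  to′ : _ ⊎ _ → _ × Bool
  to′ = [ _, true , _, false ]′

  from′ : _ × Bool → _ ⊎ _
  from′ (x , true)  = inj₁ x
  from′ (x , false) = inj₂ x

  from-to′ : ∀ z → from′ (to′ z) ≡ z
  from-to′ (inj₁ _) = refl
  from-to′ (inj₂ _) = refl

  to-from′ : ∀ z → to′ (from′ z) ≡ z
  to-from′ (_ , true)  = refl
  to-from′ (_ , false) = refl

finite-Σ : ∀ {n} (a : Fin n → ℕ) → Finite (Σ[ i ∈ Fin n ] Fin (a i))
finite-Σ {zero}  a = finite-↔ (λ ()) (λ ()) (λ ()) (λ ()) finite-⊥
finite-Σ {suc n} a = finite-↔ to′ from′ from-to′ to-from′ (finite-⊎ (finite-Fin (a zero)) (finite-Σ (a ∘ suc)))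
  where
  to′ : Fin (a zero) ⊎ (Σ[ i ∈ Fin n ] Fin (a (suc i))) → Σ[ i ∈ Fin (suc n) ] Fin (a i)
  to′ (inj₁ j)       = zero , j
  to′ (inj₂ (i , j)) = suc i , j

  from′ : Σ[ i ∈ Fin (suc n) ] Fin (a i) → Fin (a zero) ⊎ (Σ[ i ∈ Fin n ] Fin (a (suc i)))
  from′ (zero , j)  = inj₁ j
  from′ (suc i , j) = inj₂ (i , j)

  from-to′ : ∀ z → from′ (to′ z) ≡ z
  from-to′ (inj₁ _) = refl
  from-to′ (inj₂ _) = refl

  to-from′ : ∀ z → to′ (from′ z) ≡ z
  to-from′ (zero , _)  = refl
  to-from′ (suc _ , _) = refl

finite-HalfEdge : ∀ p → Finite (HalfEdge p)
finite-HalfEdge p = finite-Σ (arity p)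

finite-Tip : ∀ a → Finite (Tip a)
finite-Tip (tip _)    = finite-↔ (λ _ → here) (λ _ → tt) (λ _ → refl) (λ { here → refl }) finite-⊤
finite-Tip (fork a b) = finite-↔ to′ from′ from-to′ to-from′ (finite-⊎ (finite-Tip a) (finite-Tip b))
  where
  to′ : Tip a ⊎ Tip b → Tip (fork a b)
  to′ = [ inˡ , inʳ ]′

  from′ : Tip (fork a b) → Tip a ⊎ Tip b
  from′ (inˡ x) = inj₁ x
  from′ (inʳ x) = inj₂ x

  from-to′ : ∀ z → from′ (to′ z) ≡ z
  from-to′ (inj₁ _) = refl
  from-to′ (inj₂ _) = refl

  to-from′ : ∀ z → to′ (from′ z) ≡ z
  to-from′ (inˡ _) = refl
  to-from′ (inʳ _) = refl

finite-Mark : ∀ a → Finite (Mark a)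
finite-Mark (tip true)  = finite-↔ (λ _ → here) (λ _ → tt) (λ _ → refl) (λ { here → refl }) finite-⊤
finite-Mark (tip false) = finite-↔ (λ ()) (λ ()) (λ ()) (λ ()) finite-⊥
finite-Mark (fork a b)  = finite-↔ to′ from′ from-to′ to-from′ (finite-⊎ (finite-Mark a) (finite-Mark b))
  where
  to′ : Mark a ⊎ Mark b → Mark (fork a b)
  to′ = [ inˡ , inʳ ]′

  from′ : Mark (fork a b) → Mark a ⊎ Mark b
  from′ (inˡ x) = inj₁ x
  from′ (inʳ x) = inj₂ x

  from-to′ : ∀ z → from′ (to′ z) ≡ z
  from-to′ (inj₁ _) = refl
  from-to′ (inj₂ _) = refl

  to-from′ : ∀ z → to′ (from′ z) ≡ z
  to-from′ (inˡ _) = refl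
  to-from′ (inʳ _) = refl

finite-Fork : ∀ a → Finite (Fork a)
finite-Fork (tip _)    = finite-↔ (λ ()) (λ ()) (λ ()) (λ ()) finite-⊥
finite-Fork (fork a b) = finite-↔ to′ from′ from-to′ to-from′ (finite-⊎ finite-⊤ (finite-⊎ (finite-Fork a) (finite-Fork b)))
  where
  to′ : ⊤ ⊎ (Fork a ⊎ Fork b) → Fork (fork a b)
  to′ = [ (λ _ → here) , [ inˡ , inʳ ]′ ]′

  from′ : Fork (fork a b) → ⊤ ⊎ (Fork a ⊎ Fork b)
  from′ here    = inj₁ tt
  from′ (inˡ x) = inj₂ (inj₁ x)
  from′ (inʳ x) = inj₂ (inj₂ x)

  from-to′ : ∀ z → from′ (to′ z) ≡ z
  from-to′ (inj₁ _)        = refl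
  from-to′ (inj₂ (inj₁ _)) = refl
  from-to′ (inj₂ (inj₂ _)) = refl

  to-from′ : ∀ z → to′ (from′ z) ≡ z
  to-from′ here    = refl
  to-from′ (inˡ _) = refl
  to-from′ (inʳ _) = refl

-- Regroups N items by their value under θ. This turns the half-edges and the genus units of a
-- marked tree into the arities and the genera of an operadic graph.
module Fibres {N n : ℕ} (θ : Fin N → Fin n) where
  private
    module E (v : Fin n) = Enumeration (enumerate (λ i → θ i Fin.≟ v))

  opaque
    fibreSize : Fin n → ℕ
    fibreSize = E.size

    inFibre : Fin N → Σ[ v ∈ Fin n ] Fin (fibreSize v)
    inFibre i = θ i , proj₁ (E.complete (θ i) i refl)

    outFibre : Σ[ v ∈ Fin n ] Fin (fibreSize v) → Fin N
    outFibre (v , u) = E.enum v u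

    proj-in : ∀ i → proj₁ (inFibre i) ≡ θ i
    proj-in i = refl

    out-in : ∀ i → outFibre (inFibre i) ≡ i
    out-in i = proj₂ (E.complete (θ i) i refl)

    out-complete : ∀ i → ∃[ u ] outFibre (θ i , u) ≡ i
    out-complete i = E.complete (θ i) i refl

    θ-out : ∀ z → θ (outFibre z) ≡ proj₁ z
    θ-out (v , u) = E.sound v u

    out-injective : ∀ v {u u′} → outFibre (v , u) ≡ outFibre (v , u′) → u ≡ u′
    out-injective v = mono⇒injective (E.mono v)

    in-out : ∀ z → inFibre (outFibre z) ≡ z
    in-out (v , u) with outFibre (v , u) in eq | θ-out (v , u)
    ... | i | refl = cong (θ i ,_) (out-injective (θ i) (trans (out-in i) (sym eq)))

  ∑-fibreSize : ∀ k → sum (λ v → k v ℤ.* + fibreSize v) ≡ sum (k ∘ θ)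
  ∑-fibreSize k = sym (begin
    sum (k ∘ θ)
      ≡⟨ ∑-fibres θ (λ v u → outFibre (v , u)) (λ v u → θ-out (v , u))
           out-complete out-injective (k ∘ θ) ⟩
    sum (λ v → sum (λ u → k (θ (outFibre (v , u)))))
      ≡⟨ sum-cong-≗ (λ v → trans (sum-cong-≗ (λ u → cong k (θ-out (v , u)))) (∑-const (fibreSize v) (k v))) ⟩
    sum (λ v → + fibreSize v ℤ.* k v)
      ≡⟨ sum-cong-≗ (λ v → ℤ.*-comm (+ fibreSize v) (k v)) ⟩
    sum (λ v → k v ℤ.* + fibreSize v) ∎)
    where open ≡-Reasoning

-- The Gröbner category

-- (n , b , g): the numbers of leaves, of edges outside the tree, and the sum
-- of the genera of the vertices.
Type : Set
Type = ℕ × ℕ × ℕ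

#leaves #loops #genera : Type → ℕ
#leaves = proj₁
#loops  = proj₁ ∘ proj₂
#genera = proj₂ ∘ proj₂

HalfMark : Type → Set
HalfMark τ = Fin (#leaves τ) ⊎ (Fin (#loops τ) × Bool)

Marking : Type → Set
Marking τ = HalfMark τ ⊎ Fin (#genera τ)

finite-HalfMark : ∀ τ → Finite (HalfMark τ)
finite-HalfMark τ = finite-⊎ (finite-Fin (#leaves τ)) (finite-×Bool (finite-Fin (#loops τ)))

finite-Marking : ∀ τ → Finite (Marking τ)
finite-Marking τ = finite-⊎ (finite-HalfMark τ) (finite-Fin (#genera τ))

-- Several markings may share a tip, of which `Mark` records only that there are some. Surjectivity
-- bounds the number of marked tips by the type, which property (F) relies on.
record MarkedTree : Set where
  field
    type             : Type
    shape            : Shape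
    place            : Marking type → Mark shape
    place-surjective : ∀ m → ∃[ x ] place x ≡ m

open MarkedTree

record Embedding (c d : MarkedTree) : Set where
  field
    type-≡  : type c ≡ type d
    embed   : shape c ⊑ shape d
    place-≡ : ∀ x → place d (subst Marking type-≡ x) ≡ onMark embed (place c x)

open Embedding

embedding-id : ∀ {c} → Embedding c c
embedding-id {c} = record
  { type-≡ = refl ; embed = ⊑-id (shape c) ; place-≡ = λ x → sym (onMark-id (shape c) (place c x)) }

_⊙ₑ_ : ∀ {c d e} → Embedding d e → Embedding c d → Embedding c e
_⊙ₑ_ {c} {d} {e} record { type-≡ = refl ; embed = g ; place-≡ = q } record { type-≡ = refl ; embed = f ; place-≡ = p } = record
  { type-≡ = refl
  ; embed = g ⊙ₛ f
  ; place-≡ = λ x → trans (q x) (trans (cong (onMark g) (p x)) (sym (onMark-⊙ g f (place c x))))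
  }

embed-⊙ₑ : ∀ {c d e} (g : Embedding d e) (f : Embedding c d) → embed (g ⊙ₑ f) ≡ embed g ⊙ₛ embed f
embed-⊙ₑ record { type-≡ = refl } record { type-≡ = refl } = refl

markedTrees : Category
markedTrees = record
  { Obj = MarkedTree
  ; Hom = Embedding
  ; _≈_ = λ f g → embed f ≡ embed g
  ; idₘ = embedding-id
  ; _⊚_ = _⊙ₑ_
  ; isEquivalence = record { refl = refl ; sym = sym ; trans = trans }
  ; identityˡ = λ f → trans (embed-⊙ₑ embedding-id f) (⊙ₛ-identityˡ (embed f))
  ; identityʳ = λ f → trans (embed-⊙ₑ f embedding-id) (⊙ₛ-identityʳ (embed f))
  ; assoc = λ h g f → trans (embed-⊙ₑ (h ⊙ₑ g) f) (trans (cong (_⊙ₛ embed f) (embed-⊙ₑ h g))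
      (trans (⊙ₛ-assoc (embed h) (embed g) (embed f))
        (sym (trans (embed-⊙ₑ h (g ⊙ₑ f)) (cong (embed h ⊙ₛ_) (embed-⊙ₑ g f))))))
  ; ⊚-resp-≈ = λ {_} {_} {_} {g} {g′} {f} {f′} eq eq′ →
      trans (embed-⊙ₑ g f) (trans (cong₂ _⊙ₛ_ eq eq′) (sym (embed-⊙ₑ g′ f′)))
  }

markedTrees-isGröbner : IsGröbner markedTrees
markedTrees-isGröbner = record
  { G1 = λ c → record
    { _≺_ = λ f g → embed f ≺ embed g
    ; isStrictTotalOrder = On.isStrictTotalOrder embed ≺-isStrictTotalOrder
    ; wellFounded = On.wellFounded embed ≺-wellFounded
    ; ⊚-mono-≺ = λ g {f} {f′} p → subst (_≺ embed (g ⊙ₑ f′)) (sym (embed-⊙ₑ g f))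
        (subst (embed g ⊙ₛ embed f ≺_) (sym (embed-⊙ₑ g f′)) (⊙ₛ-mono-≺ (embed g) p))
    }
  ; G2 = λ c → AF⇒good (AF-mono (λ {(_ , f)} {(_ , g)} → lift f g)
      (AF-comap (λ (d , f) → shape d , embed f) (AF-≼ₛ (shape c))))
  }
  where
  -- A factorization of shapes respects the markings by itself, because the places in d and in e are
  -- both images of those in c.
  lift : ∀ {c d e} (f : Embedding c d) (g : Embedding c e) → (shape d , embed f) ≼ₛ (shape e , embed g) →
         Σ[ h ∈ Embedding d e ] embed g ≡ embed (h ⊙ₑ f)
  lift {c} record { type-≡ = refl ; embed = f ; place-≡ = p } record { type-≡ = refl ; embed = g ; place-≡ = q } (h , refl) =
    record { type-≡ = refl ; embed = h
           ; place-≡ = λ x → trans (q x) (trans (onMark-⊙ h f (place c x)) (cong (onMark h) (sym (p x)))) } ,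
    refl

-- Realizing a marked tree as a graph

flip : ∀ {τ} → HalfMark τ → HalfMark τ
flip (inj₁ k)       = inj₁ k
flip (inj₂ (e , s)) = inj₂ (e , not s)

flip-involutive : ∀ {τ} (m : HalfMark τ) → flip {τ} (flip {τ} m) ≡ m
flip-involutive (inj₁ _)       = refl
flip-involutive (inj₂ (e , s)) = cong (λ s → inj₂ (e , s)) (not-involutive s)

not-fixpoint : ∀ s → not s ≢ s
not-fixpoint true  ()
not-fixpoint false ()

-- The sum of k over both ends of all forks minus twice its sum over all tips (`treeSum-∑`): the
-- share of the tree in an integral. The recursive form fits the recursion on embeddings.
treeSum : ∀ a → (Tip a → ℤ) → ℤ
treeSum (tip _)    k = ℤ.- + 2 ℤ.* k here
treeSum (fork a b) k = k (inˡ (root a)) ℤ.+ k (inʳ (root b)) ℤ.+ (treeSum a (k ∘ inˡ) ℤ.+ treeSum b (k ∘ inʳ))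

treeSum-cong : ∀ a {k k′ : Tip a → ℤ} → k ≗ k′ → treeSum a k ≡ treeSum a k′
treeSum-cong (tip _)    eq = cong (λ z → ℤ.- + 2 ℤ.* z) (eq here)
treeSum-cong (fork a b) eq = cong₂ ℤ._+_ (cong₂ ℤ._+_ (eq _) (eq _))
  (cong₂ ℤ._+_ (treeSum-cong a (eq ∘ inˡ)) (treeSum-cong b (eq ∘ inʳ)))

-- This uses that a tree has one edge less than it has vertices.
treeSum-const : ∀ a z → treeSum a (λ _ → z) ≡ ℤ.- + 2 ℤ.* z
treeSum-const (tip _)    z = refl
treeSum-const (fork a b) z = trans (cong₂ (λ x y → z ℤ.+ z ℤ.+ (x ℤ.+ y)) (treeSum-const a z) (treeSum-const b z)) (arith z)
  where
  arith : ∀ z → z ℤ.+ z ℤ.+ (ℤ.- + 2 ℤ.* z ℤ.+ ℤ.- + 2 ℤ.* z) ≡ ℤ.- + 2 ℤ.* z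
  arith = ℤSolver.solve-∀

-- On a dropped branch k is a constant z and contributes -2z; the two ends of the fork that joins
-- the branch to the rest contribute 2z, which cancels it.
treeSum-contract : ∀ {a b} (f : a ⊑ b) k → treeSum b (k ∘ contract f) ≡ treeSum a k
treeSum-contract tip         k = refl
treeSum-contract (fork {a} {b} {a′} {b′} f g) k = cong₂ ℤ._+_
  (cong₂ (λ x y → k (inˡ x) ℤ.+ k (inʳ y)) (contract-root f) (contract-root g))
  (cong₂ ℤ._+_ (treeSum-contract f (k ∘ inˡ)) (treeSum-contract g (k ∘ inʳ)))
treeSum-contract {a} (dropˡ {a′ = a′} {b′} _ f) k = trans
  (cong₂ (λ x y → k (root a) ℤ.+ k x ℤ.+ y) (contract-root f)
    (cong₂ ℤ._+_ (treeSum-const a′ (k (root a))) (treeSum-contract f k)))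
  (arith (k (root a)) (treeSum a k))
  where
  arith : ∀ z s → z ℤ.+ z ℤ.+ (ℤ.- + 2 ℤ.* z ℤ.+ s) ≡ s
  arith = ℤSolver.solve-∀
treeSum-contract {a} (dropʳ {a′ = a′} {b′} _ f) k = trans
  (cong₂ (λ x y → k x ℤ.+ k (root a) ℤ.+ y) (contract-root f)
    (cong₂ ℤ._+_ (treeSum-contract f k) (treeSum-const b′ (k (root a)))))
  (arith (k (root a)) (treeSum a k))
  where
  arith : ∀ z s → z ℤ.+ z ℤ.+ (s ℤ.+ ℤ.- + 2 ℤ.* z) ≡ s
  arith = ℤSolver.solve-∀

treeSum-∑ : ∀ a k → ∑ᶠ (finite-×Bool (finite-Fork a)) (λ (e , s) → k (end e s)) ≡
                    treeSum a k ℤ.+ + 2 ℤ.* ∑ᶠ (finite-Tip a) k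
treeSum-∑ a k = trans (∑ᶠ-⊎ (finite-Fork a) (finite-Fork a) (ends ∘ [ (λ e → e , true) , (λ e → e , false) ]′)) (go a k)
  where
  ends : Fork a × Bool → ℤ
  ends (e , s) = k (end e s)

  go : ∀ a k → ∑ᶠ (finite-Fork a) (λ e → k (end e true)) ℤ.+ ∑ᶠ (finite-Fork a) (λ e → k (end e false)) ≡
               treeSum a k ℤ.+ + 2 ℤ.* ∑ᶠ (finite-Tip a) k
  go (tip _)    k = arith (k here)
    where
    arith : ∀ z → + 0 ≡ ℤ.- + 2 ℤ.* z ℤ.+ + 2 ℤ.* (z ℤ.+ + 0)
    arith = ℤSolver.solve-∀
  go (fork a b) k = begin
    ∑ᶠ (finite-Fork (fork a b)) (λ e → k (end e true)) ℤ.+ ∑ᶠ (finite-Fork (fork a b)) (λ e → k (end e false))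
      ≡⟨ cong₂ ℤ._+_ (split (λ e → k (end e true))) (split (λ e → k (end e false))) ⟩
    (ka ℤ.+ + 0 ℤ.+ (A₁ ℤ.+ B₁)) ℤ.+ (kb ℤ.+ + 0 ℤ.+ (A₂ ℤ.+ B₂))
      ≡⟨ arith₁ ka kb A₁ B₁ A₂ B₂ ⟩
    ka ℤ.+ kb ℤ.+ ((A₁ ℤ.+ A₂) ℤ.+ (B₁ ℤ.+ B₂))
      ≡⟨ cong₂ (λ x y → ka ℤ.+ kb ℤ.+ (x ℤ.+ y)) (go a (k ∘ inˡ)) (go b (k ∘ inʳ)) ⟩
    ka ℤ.+ kb ℤ.+ ((treeSum a (k ∘ inˡ) ℤ.+ + 2 ℤ.* SA) ℤ.+ (treeSum b (k ∘ inʳ) ℤ.+ + 2 ℤ.* SB))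
      ≡⟨ arith₂ (ka ℤ.+ kb) (treeSum a (k ∘ inˡ)) SA (treeSum b (k ∘ inʳ)) SB ⟩
    treeSum (fork a b) k ℤ.+ + 2 ℤ.* (SA ℤ.+ SB)
      ≡⟨ cong (λ s → treeSum (fork a b) k ℤ.+ + 2 ℤ.* s) (∑ᶠ-⊎ (finite-Tip a) (finite-Tip b) (k ∘ [ inˡ , inʳ ]′)) ⟨
    treeSum (fork a b) k ℤ.+ + 2 ℤ.* ∑ᶠ (finite-Tip (fork a b)) k ∎
    where
    open ≡-Reasoning
    ka = k (inˡ (root a))
    kb = k (inʳ (root b))
    A₁ = ∑ᶠ (finite-Fork a) (λ e → k (inˡ (end e true)))
    A₂ = ∑ᶠ (finite-Fork a) (λ e → k (inˡ (end e false)))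
    B₁ = ∑ᶠ (finite-Fork b) (λ e → k (inʳ (end e true)))
    B₂ = ∑ᶠ (finite-Fork b) (λ e → k (inʳ (end e false)))
    SA = ∑ᶠ (finite-Tip a) (k ∘ inˡ)
    SB = ∑ᶠ (finite-Tip b) (k ∘ inʳ)

    split : (f : Fork (fork a b) → ℤ) → ∑ᶠ (finite-Fork (fork a b)) f ≡
            f here ℤ.+ + 0 ℤ.+ (∑ᶠ (finite-Fork a) (f ∘ inˡ) ℤ.+ ∑ᶠ (finite-Fork b) (f ∘ inʳ))
    split f = trans (∑ᶠ-⊎ finite-⊤ (finite-⊎ (finite-Fork a) (finite-Fork b)) (f ∘ [ (λ _ → here) , [ inˡ , inʳ ]′ ]′))
      (cong (λ s → f here ℤ.+ + 0 ℤ.+ s) (∑ᶠ-⊎ (finite-Fork a) (finite-Fork b) (f ∘ [ inˡ , inʳ ]′)))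

    arith₁ : ∀ ka kb A₁ B₁ A₂ B₂ → (ka ℤ.+ + 0 ℤ.+ (A₁ ℤ.+ B₁)) ℤ.+ (kb ℤ.+ + 0 ℤ.+ (A₂ ℤ.+ B₂)) ≡
             ka ℤ.+ kb ℤ.+ ((A₁ ℤ.+ A₂) ℤ.+ (B₁ ℤ.+ B₂))
    arith₁ = ℤSolver.solve-∀

    arith₂ : ∀ z x s y s′ → z ℤ.+ ((x ℤ.+ + 2 ℤ.* s) ℤ.+ (y ℤ.+ + 2 ℤ.* s′)) ≡ z ℤ.+ (x ℤ.+ y) ℤ.+ + 2 ℤ.* (s ℤ.+ s′)
    arith₂ = ℤSolver.solve-∀

module Construction (c : MarkedTree) where

  private
    τ = type c
    a = shape c
    module T = Finite (finite-Tip a)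

  Half : Set
  Half = (Fork a × Bool) ⊎ HalfMark τ

  finite-Half : Finite Half
  finite-Half = finite-⊎ (finite-×Bool (finite-Fork a)) (finite-HalfMark τ)

  private
    module H = Finite finite-Half

  base : Half → Tip a
  base (inj₁ (e , s)) = end e s
  base (inj₂ m)       = markTip (place c (inj₁ m))

  opposite : Half → Half
  opposite (inj₁ (e , s)) = inj₁ (e , not s)
  opposite (inj₂ m)       = inj₂ (flip {τ} m)

  opposite-involutive : ∀ h → opposite (opposite h) ≡ h
  opposite-involutive (inj₁ (e , s)) = cong (λ s → inj₁ (e , s)) (not-involutive s)
  opposite-involutive (inj₂ m)       = cong inj₂ (flip-involutive {τ} m)

  opposite-fixed : ∀ h → opposite h ≡ h → ∃[ k ] inj₂ (inj₁ k) ≡ h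
  opposite-fixed (inj₁ (e , s))        eq = contradiction (cong proj₂ (inj₁-injective eq)) (not-fixpoint s)
  opposite-fixed (inj₂ (inj₁ k))       eq = k , refl
  opposite-fixed (inj₂ (inj₂ (e , s))) eq =
    contradiction (cong proj₂ (inj₂-injective (inj₂-injective eq))) (not-fixpoint s)

  opaque
    vert : Tip a → Fin T.size
    vert = T.to

    unvert : Fin T.size → Tip a
    unvert = T.from

    unvert-vert : ∀ x → unvert (vert x) ≡ x
    unvert-vert = T.from-to

    vert-unvert : ∀ v → vert (unvert v) ≡ v
    vert-unvert = T.to-from

    sum-unvert : ∀ k → sum (k ∘ unvert) ≡ ∑ᶠ (finite-Tip a) k
    sum-unvert k = refl

  private
    module FH = Fibres {H.size} {T.size} (vert ∘ base ∘ H.from)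
    module FG = Fibres {#genera τ} {T.size} (λ j → vert (markTip (place c (inj₂ j))))

  opaque
    half : Half → Σ[ v ∈ Fin T.size ] Fin (FH.fibreSize v)
    half h = FH.inFibre (H.to h)

    unhalf : (Σ[ v ∈ Fin T.size ] Fin (FH.fibreSize v)) → Half
    unhalf = H.from ∘ FH.outFibre

    unhalf-half : ∀ h → unhalf (half h) ≡ h
    unhalf-half h = trans (cong H.from (FH.out-in (H.to h))) (H.from-to h)

    half-unhalf : ∀ z → half (unhalf z) ≡ z
    half-unhalf z = trans (cong FH.inFibre (H.to-from (FH.outFibre z))) (FH.in-out z)

    t-half : ∀ h → proj₁ (half h) ≡ vert (base h)
    t-half h = trans (FH.proj-in (H.to h)) (cong (vert ∘ base) (H.from-to h))

  gen : Fin (#genera τ) → Σ[ v ∈ Fin T.size ] Fin (FG.fibreSize v)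
  gen = FG.inFibre

  ungen : (Σ[ v ∈ Fin T.size ] Fin (FG.fibreSize v)) → Fin (#genera τ)
  ungen = FG.outFibre

  ungen-gen : ∀ j → ungen (gen j) ≡ j
  ungen-gen = FG.out-in

  gen-ungen : ∀ z → gen (ungen z) ≡ z
  gen-ungen = FG.in-out

  t-gen : ∀ j → proj₁ (gen j) ≡ vert (markTip (place c (inj₂ j)))
  t-gen = FG.proj-in

  realGraph : OperadicGraph
  realGraph = record
    { #V = T.size
    ; arity = FH.fibreSize
    ; #L = #leaves τ
    ; inv = half ∘ opposite ∘ unhalf
    ; inv-involutive = λ z → trans (cong (half ∘ opposite) (unhalf-half (opposite (unhalf z))))
        (trans (cong half (opposite-involutive (unhalf z))) (half-unhalf z))
    ; leaf = λ k → half (inj₂ (inj₁ k))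
    ; leaf-injective = λ {k} {k′} eq → inj₁-injective (inj₂-injective
        (trans (sym (unhalf-half (inj₂ (inj₁ k)))) (trans (cong unhalf eq) (unhalf-half (inj₂ (inj₁ k′))))))
    ; leaf-fixed = λ k → cong (half ∘ opposite) (unhalf-half (inj₂ (inj₁ k)))
    ; fixed⇒leaf = λ z eq → let (k , eq′) = opposite-fixed (unhalf z) (trans (sym (unhalf-half _)) (cong unhalf eq)) in
        k , trans (cong half eq′) (half-unhalf z)
    }

  inv-half : ∀ h → inv realGraph (half h) ≡ half (opposite h)
  inv-half h = cong (half ∘ opposite) (unhalf-half h)

  real : GenusGraph
  real = record
    { graph = realGraph
    ; genus = FG.fibreSize
    ; nonempty = ℕ.≤-<-trans z≤n (Fin.toℕ<n (vert (root a)))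
    ; connected = λ v w → subst (Star _ v) (vert-unvert w) (subst (λ z → Star _ z _) (vert-unvert v)
        (gmap vert adjacent (tips-connected (λ _ → tt) (unvert v) (unvert w))))
    }
    where
    adjacent : ∀ {x y} → Step (λ _ → ⊤) x y → Adjacent realGraph (vert x) (vert y)
    adjacent (step e s _) = half (inj₁ (e , s)) , t-half (inj₁ (e , s)) ,
      trans (cong proj₁ (inv-half (inj₁ (e , s)))) (t-half (inj₁ (e , not s)))

  -- The term -2 of each vertex joins the tree edges in `treeSum`, and the other summands range over
  -- the markings alone. Embeddings preserve both, hence integrals.
  ∫-real : ∀ k → ∫ real k ≡ treeSum a (k ∘ vert) ℤ.+ ∑ᶠ (finite-HalfMark τ) (λ m → k (vert (markTip (place c (inj₁ m)))))
                              ℤ.+ + 2 ℤ.* sum (λ j → k (vert (markTip (place c (inj₂ j)))))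
  ∫-real k = begin
    sum (λ v → k v ℤ.* (+ (FG.fibreSize v ℕ.+ FG.fibreSize v ℕ.+ FH.fibreSize v) ℤ.- + 2))
      ≡⟨ sum-cong-≗ (λ v → arith₁ (k v) (+ FG.fibreSize v) (+ FH.fibreSize v)) ⟩
    sum (λ v → kH v ℤ.+ (+ 2 ℤ.* kG v ℤ.+ ℤ.- + 2 ℤ.* k v))
      ≡⟨ trans (∑-distrib-+ kH _) (cong (λ s → sum kH ℤ.+ s) (∑-distrib-+ (λ v → + 2 ℤ.* kG v) (λ v → ℤ.- + 2 ℤ.* k v))) ⟩
    sum kH ℤ.+ (sum (λ v → + 2 ℤ.* kG v) ℤ.+ sum (λ v → ℤ.- + 2 ℤ.* k v))
      ≡⟨ cong₂ (λ x y → sum kH ℤ.+ (x ℤ.+ y)) (*-distribˡ-sum (+ 2) kG) (*-distribˡ-sum (ℤ.- + 2) k) ⟨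
    sum kH ℤ.+ (+ 2 ℤ.* sum kG ℤ.+ ℤ.- + 2 ℤ.* sum k)
      ≡⟨ cong₂ (λ x y → x ℤ.+ (+ 2 ℤ.* y ℤ.+ ℤ.- + 2 ℤ.* sum k)) (FH.∑-fibreSize k) (FG.∑-fibreSize k) ⟩
    ∑ᶠ finite-Half (k ∘ vert ∘ base) ℤ.+ (+ 2 ℤ.* G ℤ.+ ℤ.- + 2 ℤ.* sum k)
      ≡⟨ cong₂ (λ x y → x ℤ.+ (+ 2 ℤ.* G ℤ.+ ℤ.- + 2 ℤ.* y))
           (trans (∑ᶠ-⊎ (finite-×Bool (finite-Fork a)) (finite-HalfMark τ) (k ∘ vert ∘ base))
                  (cong (λ s → s ℤ.+ M) (treeSum-∑ a (k ∘ vert))))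
           (trans (sum-cong-≗ (λ v → cong k (sym (vert-unvert v)))) (sum-unvert (k ∘ vert))) ⟩
    (treeSum a (k ∘ vert) ℤ.+ + 2 ℤ.* ∑ᶠ (finite-Tip a) (k ∘ vert)) ℤ.+ M ℤ.+ (+ 2 ℤ.* G ℤ.+ ℤ.- + 2 ℤ.* ∑ᶠ (finite-Tip a) (k ∘ vert))
      ≡⟨ arith₂ (treeSum a (k ∘ vert)) (∑ᶠ (finite-Tip a) (k ∘ vert)) M G ⟩
    treeSum a (k ∘ vert) ℤ.+ M ℤ.+ + 2 ℤ.* G ∎
    where
    open ≡-Reasoning
    kH kG : Fin T.size → ℤ
    kH v = k v ℤ.* + FH.fibreSize v
    kG v = k v ℤ.* + FG.fibreSize v
    G = sum (λ j → k (vert (markTip (place c (inj₂ j)))))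
    M = ∑ᶠ (finite-HalfMark τ) (λ m → k (vert (markTip (place c (inj₁ m)))))

    arith₁ : ∀ k g h → k ℤ.* (g ℤ.+ g ℤ.+ h ℤ.- + 2) ≡ k ℤ.* h ℤ.+ (+ 2 ℤ.* (k ℤ.* g) ℤ.+ ℤ.- + 2 ℤ.* k)
    arith₁ = ℤSolver.solve-∀

    arith₂ : ∀ t s m g → (t ℤ.+ + 2 ℤ.* s) ℤ.+ m ℤ.+ (+ 2 ℤ.* g ℤ.+ ℤ.- + 2 ℤ.* s) ≡ t ℤ.+ m ℤ.+ + 2 ℤ.* g
    arith₂ = ℤSolver.solve-∀

-- An opaque interface: later arguments rest on the inverse pairs and their compatibilities, and the
-- enumerations behind vertices and half-edges never unfold.
module Realization (c : MarkedTree) where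
  private
    module R = Construction c
    τ = type c
    a = shape c

  open Construction c public using (Half; base; opposite)

  opaque
    real : GenusGraph
    real = R.real

    vert : Tip a → Vertex (graph real)
    vert = R.vert

    unvert : Vertex (graph real) → Tip a
    unvert = R.unvert

    half : Half → HalfEdge (graph real)
    half = R.half

    unhalf : HalfEdge (graph real) → Half
    unhalf = R.unhalf

    gen : Fin (#genera τ) → Σ[ v ∈ Vertex (graph real) ] Fin (genus real v)
    gen = R.gen

    ungen : (Σ[ v ∈ Vertex (graph real) ] Fin (genus real v)) → Fin (#genera τ)
    ungen = R.ungen

    unvert-vert : ∀ x → unvert (vert x) ≡ x
    unvert-vert = R.unvert-vert

    vert-unvert : ∀ v → vert (unvert v) ≡ v
    vert-unvert = R.vert-unvert

    unhalf-half : ∀ h → unhalf (half h) ≡ h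
    unhalf-half = R.unhalf-half

    half-unhalf : ∀ z → half (unhalf z) ≡ z
    half-unhalf = R.half-unhalf

    ungen-gen : ∀ j → ungen (gen j) ≡ j
    ungen-gen = R.ungen-gen

    gen-ungen : ∀ z → gen (ungen z) ≡ z
    gen-ungen = R.gen-ungen

    t-half : ∀ h → t (graph real) (half h) ≡ vert (base h)
    t-half = R.t-half

    t-gen : ∀ j → proj₁ (gen j) ≡ vert (markTip (place c (inj₂ j)))
    t-gen = R.t-gen

    inv-half : ∀ h → inv (graph real) (half h) ≡ half (opposite h)
    inv-half = R.inv-half

    #L-real : #L (graph real) ≡ #leaves τ
    #L-real = refl

    leaf-half : ∀ k k′ → toℕ k ≡ toℕ k′ → leaf (graph real) k ≡ half (inj₂ (inj₁ k′))
    leaf-half k k′ eq = cong (R.half ∘ inj₂ ∘ inj₁) (Fin.toℕ-injective eq)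

    ∫-real : ∀ k → ∫ real k ≡ treeSum a (k ∘ vert) ℤ.+ ∑ᶠ (finite-HalfMark τ) (λ m → k (vert (markTip (place c (inj₁ m)))))
                                ℤ.+ + 2 ℤ.* sum (λ j → k (vert (markTip (place c (inj₂ j)))))
    ∫-real = R.∫-real

-- The functor to graphs

open Realization

onHalf : ∀ {c d} → Embedding c d → Half c → Half d
onHalf f (inj₁ (e , s)) = inj₁ (onFork (embed f) e , s)
onHalf f (inj₂ m)       = inj₂ (subst HalfMark (type-≡ f) m)

onHalf-mark : ∀ {c d} (f : Embedding c d) m → ∃[ h ] onHalf f h ≡ inj₂ m
onHalf-mark record { type-≡ = refl } m = inj₂ m , refl

base-onHalf : ∀ {c d} (f : Embedding c d) h → contract (embed f) (base d (onHalf f h)) ≡ base c h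
base-onHalf         f                                                        (inj₁ (e , s)) = contract-end (embed f) e s
base-onHalf {c} {d} record { type-≡ = refl ; embed = f ; place-≡ = p } (inj₂ m)       =
  trans (cong (contract f ∘ markTip) (p (inj₁ m))) (contract-mark f (place c (inj₁ m)))

opposite-onHalf : ∀ {c d} (f : Embedding c d) h → opposite d (onHalf f h) ≡ onHalf f (opposite c h)
opposite-onHalf f                        (inj₁ _) = refl
opposite-onHalf record { type-≡ = refl } (inj₂ _) = refl

onHalf-injective : ∀ {c d} (f : Embedding c d) h h′ → onHalf f h ≡ onHalf f h′ → h ≡ h′
onHalf-injective f (inj₁ (e , s)) (inj₁ (e′ , s′)) eq =
  cong₂ (λ e s → inj₁ (e , s)) (onFork-injective (embed f) (cong proj₁ (inj₁-injective eq))) (cong proj₂ (inj₁-injective eq))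
onHalf-injective record { type-≡ = refl } (inj₂ m) (inj₂ m′) eq = cong inj₂ (inj₂-injective eq)
onHalf-injective f (inj₁ _) (inj₂ _) ()
onHalf-injective f (inj₂ _) (inj₁ _) ()

onHalf-cases : ∀ {c d} (f : Embedding c d) h → (∃[ h′ ] onHalf f h′ ≡ h) ⊎
               contract (embed f) (base d (opposite d h)) ≡ contract (embed f) (base d h)
onHalf-cases f (inj₂ m)       = inj₁ (onHalf-mark f m)
onHalf-cases f (inj₁ (e , s)) with fork-cases (embed f) e
... | inj₁ (e′ , eq) = inj₁ (inj₁ (e′ , s) , cong (λ e → inj₁ (e , s)) eq)
... | inj₂ eq        = inj₂ (either s)
  where
  either : ∀ s → contract (embed f) (end e (not s)) ≡ contract (embed f) (end e s)
  either true  = sym eq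
  either false = eq

vert-injective : ∀ c {x y} → vert c x ≡ vert c y → x ≡ y
vert-injective c {x} {y} eq = trans (sym (unvert-vert c x)) (trans (cong (unvert c) eq) (unvert-vert c y))

half-injective : ∀ c {h h′} → half c h ≡ half c h′ → h ≡ h′
half-injective c {h} {h′} eq = trans (sym (unhalf-half c h)) (trans (cong (unhalf c) eq) (unhalf-half c h′))

unhalf-injective : ∀ c {z z′} → unhalf c z ≡ unhalf c z′ → z ≡ z′
unhalf-injective c {z} {z′} eq = trans (sym (half-unhalf c z)) (trans (cong (half c) eq) (half-unhalf c z′))

inv-unhalf : ∀ c z → inv (graph (real c)) z ≡ half c (opposite c (unhalf c z))
inv-unhalf c z = trans (cong (inv (graph (real c))) (sym (half-unhalf c z))) (inv-half c (unhalf c z))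

unvert-t : ∀ c z → unvert c (t (graph (real c)) z) ≡ base c (unhalf c z)
unvert-t c z = trans (cong (unvert c ∘ t (graph (real c))) (sym (half-unhalf c z)))
  (trans (cong (unvert c) (t-half c (unhalf c z))) (unvert-vert c (base c (unhalf c z))))

module _ {c d : MarkedTree} (f : Embedding c d) where

  realφ : Vertex (graph (real d)) → Vertex (graph (real c))
  realφ x = vert c (contract (embed f) (unvert d x))

  realψ : HalfEdge (graph (real c)) → HalfEdge (graph (real d))
  realψ z = half d (onHalf f (unhalf c z))

  private
    φ-half : ∀ h → realφ (t (graph (real d)) (half d h)) ≡ vert c (contract (embed f) (base d h))
    φ-half h = cong (vert c ∘ contract (embed f)) (trans (unvert-t d (half d h)) (cong (base d) (unhalf-half d h)))

    φ-t : ∀ z → realφ (t (graph (real d)) z) ≡ vert c (contract (embed f) (base d (unhalf d z)))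
    φ-t z = cong (vert c ∘ contract (embed f)) (unvert-t d z)

    internal : ∀ z → (∃[ z′ ] realψ z′ ≡ z) ⊎ realφ (t (graph (real d)) (inv (graph (real d)) z)) ≡ realφ (t (graph (real d)) z)
    internal z with onHalf-cases f (unhalf d z)
    ... | inj₁ (h , eq) = inj₁ (half c h ,
      trans (cong (half d ∘ onHalf f) (unhalf-half c h)) (trans (cong (half d) eq) (half-unhalf d z)))
    ... | inj₂ eq = inj₂ (trans (cong (realφ ∘ t (graph (real d))) (inv-unhalf d z)) (trans (φ-half (opposite d (unhalf d z))) (trans (cong (vert c) eq) (sym (φ-t z)))))

    linked : ∀ {x y} → Step (Contracted (embed f)) x y → Linked (real c) (real d) realφ realψ (vert d x) (vert d y)
    linked (step e s c∌e) = half d (inj₁ (e , s)) ,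
      (λ z eq → ∉image (unhalf c z) (half-injective d eq)) ,
      t-half d (inj₁ (e , s)) ,
      trans (cong proj₁ (inv-half d (inj₁ (e , s)))) (t-half d (inj₁ (e , not s)))
      where
      ∉image : ∀ h → onHalf f h ≢ inj₁ (e , s)
      ∉image (inj₁ (e′ , s′)) eq = c∌e e′ (cong proj₁ (inj₁-injective eq))
      ∉image (inj₂ _)         ()

    fibres : ∀ x y → realφ x ≡ realφ y → Star (Linked (real c) (real d) realφ realψ) x y
    fibres x y eq = subst (Star _ x) (vert-unvert d y) (subst (λ z → Star _ z _) (vert-unvert d x)
      (gmap (vert d) linked
        (path-section (embed f) (unvert d x) ◅◅
         subst (λ z → Path (Contracted (embed f)) (section (embed f) z) (unvert d y)) (sym (vert-injective c eq))
           (path-reverse (path-section (embed f) (unvert d y))))))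

  ∫-realφ : ∀ k → ∫ (real d) (k ∘ realφ) ≡ ∫ (real c) k
  ∫-realφ k = trans (∫-real d (k ∘ realφ)) (trans (compare f {k}) (sym (∫-real c k)))
    where
    φ-vert : ∀ {c d} (f : Embedding c d) x → vert c (contract (embed f) (unvert d (vert d x))) ≡ vert c (contract (embed f) x)
    φ-vert {c} {d} f x = cong (vert c ∘ contract (embed f)) (unvert-vert d x)

    -- Quantified anew over both trees, so that they are variables when `type-≡` is matched with
    -- `refl`.
    compare : ∀ {c d} (f : Embedding c d) {k : Vertex (graph (real c)) → ℤ} →
      let k′ = λ x → k (vert c (contract (embed f) (unvert d (vert d x)))) in
      treeSum (shape d) k′ ℤ.+ ∑ᶠ (finite-HalfMark (type d)) (λ m → k′ (markTip (place d (inj₁ m))))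
        ℤ.+ + 2 ℤ.* sum (λ j → k′ (markTip (place d (inj₂ j)))) ≡
      treeSum (shape c) (k ∘ vert c) ℤ.+ ∑ᶠ (finite-HalfMark (type c)) (λ m → k (vert c (markTip (place c (inj₁ m)))))
        ℤ.+ + 2 ℤ.* sum (λ j → k (vert c (markTip (place c (inj₂ j)))))
    compare {c} {d} f@record { type-≡ = refl ; embed = ε′ ; place-≡ = p } {k} =
      cong₂ (λ x y → x ℤ.+ + 2 ℤ.* y)
        (cong₂ ℤ._+_
          (trans (treeSum-cong (shape d) (λ x → cong k (φ-vert f x))) (treeSum-contract ε′ (k ∘ vert c)))
          (sum-cong-≗ (λ i → marks (inj₁ (from (finite-HalfMark (type c)) i)))))
        (sum-cong-≗ (λ j → marks (inj₂ j)))
      where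
      marks : ∀ m → k (vert c (contract ε′ (unvert d (vert d (markTip (place d m)))))) ≡ k (vert c (markTip (place c m)))
      marks m = cong k (trans (φ-vert f (markTip (place d m)))
        (cong (vert c) (trans (cong (contract ε′ ∘ markTip) (p m)) (contract-mark ε′ (place c m)))))

  realContraction : IsContraction (real c) (real d) realφ realψ
  realContraction = record
    { φ-ψ = λ z → trans (φ-half (onHalf f (unhalf c z))) (trans (cong (vert c) (base-onHalf f (unhalf c z)))
        (trans (cong (vert c) (sym (unvert-t c z))) (vert-unvert c _)))
    ; ψ-injective = λ z z′ eq → unhalf-injective c (onHalf-injective f _ _ (half-injective d eq))
    ; ψ-inv = λ z → trans (inv-half d (onHalf f (unhalf c z))) (cong (half d)
        (trans (opposite-onHalf f (unhalf c z)) (cong (onHalf f) (sym (trans (cong (unhalf c) (inv-unhalf c z)) (unhalf-half c (opposite c (unhalf c z))))))))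
    ; #L-≡ = trans (#L-real c) (trans (cong #leaves (type-≡ f)) (sym (#L-real d)))
    ; ψ-leaf = λ k k′ eq →
        let k₀ = cast (#L-real c) k ; k₀′ = cast (#L-real d) k′ in
        trans (leaf-half d k′ k₀′ (sym (Fin.toℕ-cast (#L-real d) k′)))
          (cong (half d) (trans
            (leaf-eq f k₀ k₀′ (trans (Fin.toℕ-cast (#L-real c) k) (trans eq (sym (Fin.toℕ-cast (#L-real d) k′)))))
            (cong (onHalf f) (trans (sym (unhalf-half c _))
              (cong (unhalf c) (sym (leaf-half c k k₀ (sym (Fin.toℕ-cast (#L-real c) k)))))))))
    ; internal = internal
    ; surjective = λ l → vert d (section (embed f) (unvert c l)) ,
        trans (cong (vert c ∘ contract (embed f)) (unvert-vert d _))
          (trans (cong (vert c) (contract-section (embed f) (unvert c l))) (vert-unvert c l))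
    ; fibres = fibres
    ; balanced = λ l → trans (∫-realφ (λ m → ⟦ m Fin.≟ l ⟧)) (∫-δ (real c) (real d) realφ realψ l)
    }
    where
    leaf-eq : ∀ {c d} (f : Embedding c d) k k′ → toℕ k ≡ toℕ k′ → inj₂ (inj₁ k′) ≡ onHalf f (inj₂ (inj₁ k))
    leaf-eq record { type-≡ = refl } k k′ eq = cong (inj₂ ∘ inj₁) (Fin.toℕ-injective (sym eq))

opaque
  realHom : ∀ {c d} → Embedding c d → Hom (real c) (real d)
  realHom f = contraction⇒hom (realContraction f)

  ψ-realHom : ∀ {c d} (f : Embedding c d) h → Hom.ψ (realHom f) h ≡ realψ f h
  ψ-realHom f = ψ-contraction⇒hom (realContraction f)

  φ-realHom : ∀ {c d} (f : Embedding c d) x → φₕ (realHom f) x ≡ realφ f x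
  φ-realHom f = φ-contraction⇒hom (realContraction f)

onHalf-id : ∀ c h → onHalf (embedding-id {c}) h ≡ h
onHalf-id c (inj₁ (e , s)) = cong (λ e → inj₁ (e , s)) (onFork-id (shape c) e)
onHalf-id c (inj₂ _)       = refl

onHalf-⊙ : ∀ {c d e} (g : Embedding d e) (f : Embedding c d) h → onHalf (g ⊙ₑ f) h ≡ onHalf g (onHalf f h)
onHalf-⊙ record { type-≡ = refl ; embed = g } record { type-≡ = refl ; embed = f } (inj₁ (e , s)) =
  cong (λ e → inj₁ (e , s)) (onFork-⊙ g f e)
onHalf-⊙ record { type-≡ = refl } record { type-≡ = refl } (inj₂ m) = refl

onHalf-cong : ∀ {c d} (f g : Embedding c d) → embed f ≡ embed g → ∀ h → onHalf f h ≡ onHalf g h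
onHalf-cong f g eq (inj₁ (e , s)) = cong (λ ε′ → inj₁ (onFork ε′ e , s)) eq
onHalf-cong record { type-≡ = refl } record { type-≡ = refl } eq (inj₂ m) = refl

realize : Functor markedTrees numOpᵒᵖ
realize = record
  { F₀ = real
  ; F₁ = realHom
  ; F-resp-≈ = λ {c} {d} {f} {g} eq → ∼⇒≈ {f = realHom f} {realHom g}
      ((λ x → trans (φ-realHom f x) (trans (cong (λ ε′ → vert c (contract ε′ (unvert d x))) eq) (sym (φ-realHom g x)))) ,
       λ z → trans (ψ-realHom f z) (trans (cong (half d) (onHalf-cong f g eq (unhalf c z))) (sym (ψ-realHom g z))))
  ; identity = λ {c} → ≈-idₕ {k = realHom (embedding-id {c})}
      (λ x → trans (φ-realHom (embedding-id {c}) x)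
        (trans (cong (vert c) (contract-id (shape c) (unvert c x))) (vert-unvert c x)))
      (λ z → trans (ψ-realHom (embedding-id {c}) z)
        (trans (cong (half c) (onHalf-id c (unhalf c z))) (half-unhalf c z)))
  ; homomorphism = λ g f → composite⇒≈ {k = realHom (g ⊙ₑ f)} {realHom g} {realHom f}
      (record { φ-composite = φ-⊙ g f ; ψ-composite = ψ-⊙ g f })
  }
  where
  φ-⊙ : ∀ {c d e} (g : Embedding d e) (f : Embedding c d) x →
        φₕ (realHom (g ⊙ₑ f)) x ≡ φₕ (realHom f) (φₕ (realHom g) x)
  φ-⊙ {c} {d} {e} g f x = begin
    φₕ (realHom (g ⊙ₑ f)) x
      ≡⟨ φ-realHom (g ⊙ₑ f) x ⟩
    vert c (contract (embed (g ⊙ₑ f)) (unvert e x))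
      ≡⟨ cong (λ ε′ → vert c (contract ε′ (unvert e x))) (embed-⊙ₑ g f) ⟩
    vert c (contract (embed g ⊙ₛ embed f) (unvert e x))
      ≡⟨ cong (vert c) (contract-⊙ (embed g) (embed f) (unvert e x)) ⟩
    vert c (contract (embed f) (contract (embed g) (unvert e x)))
      ≡⟨ cong (vert c ∘ contract (embed f)) (unvert-vert d (contract (embed g) (unvert e x))) ⟨
    realφ f (realφ g x)
      ≡⟨ cong (realφ f) (φ-realHom g x) ⟨
    realφ f (φₕ (realHom g) x)
      ≡⟨ φ-realHom f (φₕ (realHom g) x) ⟨
    φₕ (realHom f) (φₕ (realHom g) x) ∎
    where open ≡-Reasoning

  ψ-⊙ : ∀ {c d e} (g : Embedding d e) (f : Embedding c d) z →
        Hom.ψ (realHom (g ⊙ₑ f)) z ≡ Hom.ψ (realHom g) (Hom.ψ (realHom f) z)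
  ψ-⊙ {c} {d} {e} g f z = begin
    Hom.ψ (realHom (g ⊙ₑ f)) z
      ≡⟨ ψ-realHom (g ⊙ₑ f) z ⟩
    half e (onHalf (g ⊙ₑ f) (unhalf c z))
      ≡⟨ cong (half e) (onHalf-⊙ g f (unhalf c z)) ⟩
    half e (onHalf g (onHalf f (unhalf c z)))
      ≡⟨ cong (half e ∘ onHalf g) (unhalf-half d (onHalf f (unhalf c z))) ⟨
    realψ g (realψ f z)
      ≡⟨ cong (realψ g) (ψ-realHom f z) ⟨
    realψ g (Hom.ψ (realHom f) z)
      ≡⟨ ψ-realHom g (Hom.ψ (realHom f) z) ⟨
    Hom.ψ (realHom g) (Hom.ψ (realHom f) z) ∎
    where open ≡-Reasoning

-- Enumerating morphisms

-- The Floyd–Warshall algorithm.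
module _ {n : ℕ} {E : Rel (Fin n) 0ℓ} (E? : ∀ x y → Dec (E x y)) where
  private
    Via : List (Fin n) → Rel (Fin n) 0ℓ
    Via []       x y = x ≡ y ⊎ E x y
    Via (v ∷ vs) x y = Via vs x y ⊎ (Via vs x v × Via vs v y)

    via? : ∀ vs x y → Dec (Via vs x y)
    via? []       x y = (x Fin.≟ y) ⊎-dec E? x y
    via? (v ∷ vs) x y = via? vs x y ⊎-dec (via? vs x v ×-dec via? vs v y)

    via⇒star : ∀ vs {x y} → Via vs x y → Star E x y
    via⇒star []       (inj₁ refl)     = ε
    via⇒star []       (inj₂ e)        = e ◅ ε
    via⇒star (v ∷ vs) (inj₁ p)        = via⇒star vs p
    via⇒star (v ∷ vs) (inj₂ (p , q))  = via⇒star vs p ◅◅ via⇒star vs q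

    via-trans : ∀ vs {x v y} → v ∈ vs → Via vs x v → Via vs v y → Via vs x y
    via-trans (v ∷ vs) (here refl) p q = inj₂ (merge p , merge′ q)
      where
      merge : ∀ {x} → Via (v ∷ vs) x v → Via vs x v
      merge (inj₁ p)       = p
      merge (inj₂ (p , _)) = p

      merge′ : ∀ {y} → Via (v ∷ vs) v y → Via vs v y
      merge′ (inj₁ p)       = p
      merge′ (inj₂ (_ , p)) = p
    via-trans (w ∷ vs) (there i) (inj₁ p)       (inj₁ q)       = inj₁ (via-trans vs i p q)
    via-trans (w ∷ vs) (there i) (inj₁ p)       (inj₂ (q , r)) = inj₂ (via-trans vs i p q , r)
    via-trans (w ∷ vs) (there i) (inj₂ (p , q)) (inj₁ r)       = inj₂ (p , via-trans vs i q r)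
    -- Both halves pass through w; the detour between the two visits, which contains the
    -- intermediate vertex, is cut out.
    via-trans (w ∷ vs) (there i) (inj₂ (p , _)) (inj₂ (_ , q)) = inj₂ (p , q)

    via-base : ∀ vs {x y} → Via [] x y → Via vs x y
    via-base []       p = p
    via-base (v ∷ vs) p = inj₁ (via-base vs p)

    star⇒via : ∀ {x y} → Star E x y → Via (allFin n) x y
    star⇒via ε        = via-base (allFin n) (inj₁ refl)
    star⇒via (e ◅ es) = via-trans (allFin n) (∈-allFin _) (via-base (allFin n) (inj₂ e)) (star⇒via es)

  star? : ∀ x y → Dec (Star E x y)
  star? x y = map′ (via⇒star (allFin n)) star⇒via (via? (allFin n) x y)

module _ (p q : GenusGraph) (φ : Vertex (graph q) → Vertex (graph p))
         (ψ : HalfEdge (graph p) → HalfEdge (graph q)) where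
  private
    P = graph p
    Q = graph q

    allH? : ∀ r {A : HalfEdge r → Set} → (∀ h → Dec (A h)) → Dec (∀ h → A h)
    allH? r = all?ᶠ (finite-HalfEdge r)

    anyH? : ∀ r {A : HalfEdge r → Set} → (∀ h → Dec (A h)) → Dec (∃[ h ] A h)
    anyH? r = any?ᶠ (finite-HalfEdge r)

    linked? : ∀ x y → Dec (Linked p q φ ψ x y)
    linked? x y = anyH? Q λ h →
      allH? P (λ h′ → ¬? (GraphProperties._≟ₕ_ Q (ψ h′) h)) ×-dec (t Q h Fin.≟ x) ×-dec (t Q (inv Q h) Fin.≟ y)

  isContraction? : Dec (IsContraction p q φ ψ)
  isContraction? = map′
    (λ (a , b , c , d , e , f , g , h , i) → record
      { φ-ψ = a ; ψ-injective = b ; ψ-inv = c ; #L-≡ = d ; ψ-leaf = e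
      ; internal = f ; surjective = g ; fibres = h ; balanced = i })
    (λ c → let open IsContraction c in
      φ-ψ , ψ-injective , ψ-inv , #L-≡ , ψ-leaf , internal , surjective , fibres , balanced)
    (allH? P (λ h → φ (t Q (ψ h)) Fin.≟ t P h)
     ×-dec allH? P (λ h → allH? P (λ h′ → GraphProperties._≟ₕ_ Q (ψ h) (ψ h′) →-dec GraphProperties._≟ₕ_ P h h′))
     ×-dec allH? P (λ h → GraphProperties._≟ₕ_ Q (inv Q (ψ h)) (ψ (inv P h)))
     ×-dec (#L P ℕ.≟ #L Q)
     ×-dec Fin.all? (λ k → Fin.all? (λ k′ → (toℕ k ℕ.≟ toℕ k′) →-dec GraphProperties._≟ₕ_ Q (leaf Q k′) (ψ (leaf P k))))
     ×-dec allH? Q (λ h → anyH? P (λ h′ → GraphProperties._≟ₕ_ Q (ψ h′) h) ⊎-dec (φ (t Q (inv Q h)) Fin.≟ φ (t Q h)))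
     ×-dec Fin.all? (λ l → Fin.any? (λ x → φ x Fin.≟ l))
     ×-dec Fin.all? (λ x → Fin.all? (λ y → (φ x Fin.≟ φ y) →-dec star? linked? x y))
     ×-dec Fin.all? (λ l → ∫ q (λ x → ⟦ φ x Fin.≟ l ⟧) ℤ.≟ weight p l))

allFunctions : ∀ {A B : Set} → Finite A → Finite B → List (A → B)
allFunctions F G = map (λ i → from G ∘ finToFun i ∘ to F) (allFin (size G ℕ.^ size F))

∈-allFunctions : ∀ {A B : Set} (F : Finite A) (G : Finite B) (f : A → B) → ∃[ g ] (g ∈ allFunctions F G × g ≗ f)
∈-allFunctions F G f = _ , ∈-map⁺ _ (∈-allFin (funToFin f′)) ,
  λ x → trans (cong (from G) (Fin.finToFun-funToFin f′ (to F x)))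
              (trans (from-to G _) (cong f (from-to F x)))
  where f′ = to G ∘ f ∘ from F

whenYes : ∀ {P A : Set} → Dec P → (P → A) → List A
whenYes (yes p) f = [ f p ]
whenYes (no _)  f = []

∈-whenYes : ∀ {P A : Set} (d : Dec P) (f : P → A) → P → ∃[ p ] f p ∈ whenYes d f
∈-whenYes (yes p) f _ = p , here refl
∈-whenYes (no ¬p) f p = contradiction p ¬p

module _ (p q : GenusGraph) where
  private
    φs = allFunctions (finite-Fin (#V (graph q))) (finite-Fin (#V (graph p)))
    ψs = allFunctions (finite-HalfEdge (graph p)) (finite-HalfEdge (graph q))

  opaque
    homs : List (Hom p q)
    homs = concatMap (λ φ → concatMap (λ ψ → whenYes (isContraction? p q φ ψ) contraction⇒hom) ψs) φs

    -- The listed functions agree with φ and ψ only pointwise, and `IsContraction` does not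
    -- transport along pointwise equality by itself; hence the hypothesis covers all pointwise equal
    -- pairs.
    ∈-homs : ∀ φ ψ → (∀ {φ′ ψ′} → φ′ ≗ φ → ψ′ ≗ ψ → IsContraction p q φ′ ψ′) →
             ∃[ f ] (f ∈ homs × φₕ f ≗ φ × Hom.ψ f ≗ ψ)
    ∈-homs φ ψ contraction =
      let (φ′ , φ′∈ , φ-eq) = ∈-allFunctions (finite-Fin (#V (graph q))) (finite-Fin (#V (graph p))) φ
          (ψ′ , ψ′∈ , ψ-eq) = ∈-allFunctions (finite-HalfEdge (graph p)) (finite-HalfEdge (graph q)) ψ
          (c , c∈) = ∈-whenYes (isContraction? p q φ′ ψ′) contraction⇒hom (contraction φ-eq ψ-eq)
      in contraction⇒hom c ,
         ∈-concatMap⁺ _ (lose φ′∈ (∈-concatMap⁺ _ (lose ψ′∈ c∈))) ,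
         (λ x → trans (φ-contraction⇒hom c x) (φ-eq x)) ,
         (λ h → trans (ψ-contraction⇒hom c h) (ψ-eq h))

-- Enumerating marked trees of bounded size

shapes : ℕ → List Shape
shapes zero    = []
shapes (suc k) = tip true ∷ tip false ∷ cartesianProductWith fork (shapes k) (shapes k)

#tips #marks : Shape → ℕ
#tips  = size ∘ finite-Tip
#marks = size ∘ finite-Mark

#tips-positive : ∀ a → 1 ℕ.≤ #tips a
#tips-positive (tip _)    = ℕ.≤-refl
#tips-positive (fork a b) = ℕ.≤-trans (#tips-positive a) (ℕ.m≤m+n (#tips a) (#tips b))

-- `shapes k` bounds the height. Each branch of a fork has fewer tips than the fork because the
-- other branch has at least one, so the number of tips bounds the height.
∈-shapes : ∀ {k} a → #tips a ℕ.≤ k → a ∈ shapes k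
∈-shapes {zero}  a           le = contradiction (ℕ.≤-trans (#tips-positive a) le) λ ()
∈-shapes {suc k} (tip true)  le = here refl
∈-shapes {suc k} (tip false) le = there (here refl)
∈-shapes {suc k} (fork a b)  le = there (there (∈-cartesianProductWith⁺ fork
  (∈-shapes a (ℕ.s≤s⁻¹ (ℕ.<-≤-trans (ℕ.m<m+n (#tips a) (#tips-positive b)) le)))
  (∈-shapes b (ℕ.s≤s⁻¹ (ℕ.<-≤-trans (ℕ.m<n+m (#tips b) (#tips-positive a)) le)))))

placements : ∀ τ a → List MarkedTree
placements τ a = concatMap (λ f → whenYes (surjective? f)
    (λ s → record { type = τ ; shape = a ; place = f ; place-surjective = s }))
  (allFunctions (finite-Marking τ) (finite-Mark a))
  where
  surjective? : (f : Marking τ → Mark a) → Dec (∀ m → ∃[ x ] f x ≡ m)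
  surjective? f = all?ᶠ (finite-Mark a) λ m → any?ᶠ (finite-Marking τ) λ x → _≟ᶠ_ (finite-Mark a) (f x) m

-- Matching on `placement` makes the type and the shape of the tree definitionally τ and a, whereas
-- its `place` agrees with f only pointwise.
data Placement (τ : Type) (a : Shape) (f : Marking τ → Mark a) : MarkedTree → Set where
  placement : ∀ {f′ s} → f′ ≗ f → Placement τ a f (record { type = τ ; shape = a ; place = f′ ; place-surjective = s })

∈-placements : ∀ τ a (f : Marking τ → Mark a) → (∀ m → ∃[ x ] f x ≡ m) → ∃[ c ] (c ∈ placements τ a × Placement τ a f c)
∈-placements τ a f s =
  let (f′ , f′∈ , eq) = ∈-allFunctions (finite-Marking τ) (finite-Mark a) f
      (_ , c∈) = ∈-whenYes _ _ (λ m → let (x , eq′) = s m in x , trans (eq x) eq′)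
  in _ , ∈-concatMap⁺ _ (lose f′∈ c∈) , placement eq

-- Dropping all that a morphism contracts

-- An edge that must be kept counts twice: each of the branches that it joins may need the spare tip
-- granted by `⊔ 1` in `bounded`.
Kind : ∀ {P : Set} → Dec P → Set
Kind (yes _) = Bool
Kind (no _)  = ⊥

finite-Kind : ∀ {P : Set} (d : Dec P) → Finite (Kind d)
finite-Kind (yes _) = finite-↔ proj₂ (tt ,_) (λ _ → refl) (λ _ → refl) (finite-×Bool finite-⊤)
finite-Kind (no _)  = finite-⊥

kind : ∀ {P : Set} (d : Dec P) → Kind d → P × Bool
kind (yes p) s = p , s

kind-injective : ∀ {P : Set} (d : Dec P) {x y} → proj₂ (kind d x) ≡ proj₂ (kind d y) → x ≡ y
kind-injective (yes _) eq = eq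

-- The marks and two copies of every edge in K, arranged by recursion on the shape so that
-- `#special` of a fork is a sum by computation.
Special : ∀ a {K : Fork a → Set} → (∀ e → Dec (K e)) → Set
Special (tip m)    K? = Mark (tip m)
Special (fork a b) K? = Kind (K? here) ⊎ (Special a (K? ∘ inˡ) ⊎ Special b (K? ∘ inʳ))

finite-Special : ∀ a {K : Fork a → Set} (K? : ∀ e → Dec (K e)) → Finite (Special a K?)
finite-Special (tip m)    K? = finite-Mark (tip m)
finite-Special (fork a b) K? =
  finite-⊎ (finite-Kind (K? here)) (finite-⊎ (finite-Special a (K? ∘ inˡ)) (finite-Special b (K? ∘ inʳ)))

#special : ∀ a {K : Fork a → Set} → (∀ e → Dec (K e)) → ℕ
#special a K? = size (finite-Special a K?)

module _ where
  private
    Origin : ∀ {a} → (Fork a → Set) → Set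
    Origin {a} K = Mark a ⊎ ((Σ[ e ∈ Fork a ] K e) × Bool)

    goˡ : ∀ {a b} {K : Fork (fork a b) → Set} → Origin (K ∘ inˡ) → Origin K
    goˡ (inj₁ m)             = inj₁ (inˡ m)
    goˡ (inj₂ ((e , k) , s)) = inj₂ ((inˡ e , k) , s)

    goʳ : ∀ {a b} {K : Fork (fork a b) → Set} → Origin (K ∘ inʳ) → Origin K
    goʳ (inj₁ m)             = inj₁ (inʳ m)
    goʳ (inj₂ ((e , k) , s)) = inj₂ ((inʳ e , k) , s)

  origin : ∀ a {K : Fork a → Set} (K? : ∀ e → Dec (K e)) → Special a K? → Mark a ⊎ ((Σ[ e ∈ Fork a ] K e) × Bool)
  origin (tip _)    K? m               = inj₁ m
  origin (fork a b) K? (inj₁ x)        = let (k , s) = kind (K? here) x in inj₂ ((here , k) , s)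
  origin (fork a b) K? (inj₂ (inj₁ x)) = goˡ (origin a (K? ∘ inˡ) x)
  origin (fork a b) K? (inj₂ (inj₂ x)) = goʳ (origin b (K? ∘ inʳ) x)

  -- Equality up to the proof of `K e`, since K is not assumed to have unique proofs.
  data Same {a} {K : Fork a → Set} : Rel (Mark a ⊎ ((Σ[ e ∈ Fork a ] K e) × Bool)) 0ℓ where
    mark : ∀ {m} → Same (inj₁ m) (inj₁ m)
    edge : ∀ {e s k k′} → Same (inj₂ ((e , k) , s)) (inj₂ ((e , k′) , s))

  private
    sameˡ : ∀ {a b} {K : Fork (fork a b) → Set} x y → Same {K = K} (goˡ x) (goˡ y) → Same {K = K ∘ inˡ} x y
    sameˡ (inj₁ _) (inj₁ _) mark = mark
    sameˡ (inj₂ _) (inj₂ _) edge = edge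

    sameʳ : ∀ {a b} {K : Fork (fork a b) → Set} x y → Same {K = K} (goʳ x) (goʳ y) → Same {K = K ∘ inʳ} x y
    sameʳ (inj₁ _) (inj₁ _) mark = mark
    sameʳ (inj₂ _) (inj₂ _) edge = edge

    ¬here-ˡ : ∀ {a b} {K : Fork (fork a b) → Set} {k s} x → ¬ Same {K = K} (inj₂ ((here , k) , s)) (goˡ x)
    ¬here-ˡ (inj₁ _) ()
    ¬here-ˡ (inj₂ _) ()

    ¬here-ʳ : ∀ {a b} {K : Fork (fork a b) → Set} {k s} x → ¬ Same {K = K} (inj₂ ((here , k) , s)) (goʳ x)
    ¬here-ʳ (inj₁ _) ()
    ¬here-ʳ (inj₂ _) ()

    ¬ˡ-ʳ : ∀ {a b} {K : Fork (fork a b) → Set} x y → ¬ Same {K = K} (goˡ x) (goʳ y)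
    ¬ˡ-ʳ (inj₁ _) (inj₁ _) ()
    ¬ˡ-ʳ (inj₂ _) (inj₂ _) ()
    ¬ˡ-ʳ (inj₁ _) (inj₂ _) ()
    ¬ˡ-ʳ (inj₂ _) (inj₁ _) ()

    flipSame : ∀ {a} {K : Fork a → Set} {x y} → Same {K = K} x y → Same y x
    flipSame mark = mark
    flipSame edge = edge

    sameKind : ∀ {a b} {K : Fork (fork a b) → Set} {k k′ s s′} →
               Same {K = K} (inj₂ ((here , k) , s)) (inj₂ ((here , k′) , s′)) → s ≡ s′
    sameKind edge = refl

  origin-injective : ∀ a {K : Fork a → Set} (K? : ∀ e → Dec (K e)) x y → Same (origin a K? x) (origin a K? y) → x ≡ y
  origin-injective (tip _)    K? x y mark = refl
  origin-injective (fork a b) K? (inj₁ x) (inj₁ y) s = cong inj₁ (kind-injective (K? here) (sameKind s))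
  origin-injective (fork a b) K? (inj₁ x) (inj₂ (inj₁ y)) s = contradiction s (¬here-ˡ (origin a (K? ∘ inˡ) y))
  origin-injective (fork a b) K? (inj₁ x) (inj₂ (inj₂ y)) s = contradiction s (¬here-ʳ (origin b (K? ∘ inʳ) y))
  origin-injective (fork a b) K? (inj₂ (inj₁ x)) (inj₁ y) s = contradiction (flipSame s) (¬here-ˡ (origin a (K? ∘ inˡ) x))
  origin-injective (fork a b) K? (inj₂ (inj₂ x)) (inj₁ y) s = contradiction (flipSame s) (¬here-ʳ (origin b (K? ∘ inʳ) x))
  origin-injective (fork a b) K? (inj₂ (inj₁ x)) (inj₂ (inj₁ y)) s =
    cong (inj₂ ∘ inj₁) (origin-injective a (K? ∘ inˡ) x y (sameˡ _ _ s))
  origin-injective (fork a b) K? (inj₂ (inj₂ x)) (inj₂ (inj₂ y)) s =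
    cong (inj₂ ∘ inj₂) (origin-injective b (K? ∘ inʳ) x y (sameʳ _ _ s))
  origin-injective (fork a b) K? (inj₂ (inj₁ x)) (inj₂ (inj₂ y)) s =
    contradiction s (¬ˡ-ʳ (origin a (K? ∘ inˡ) x) (origin b (K? ∘ inʳ) y))
  origin-injective (fork a b) K? (inj₂ (inj₂ x)) (inj₂ (inj₁ y)) s =
    contradiction (flipSame s) (¬ˡ-ʳ (origin a (K? ∘ inˡ) y) (origin b (K? ∘ inʳ) x))

finite-≤ : ∀ {A B : Set} (F : Finite A) (G : Finite B) (f : A → B) → (∀ {x y} → f x ≡ f y → x ≡ y) → size F ℕ.≤ size G
finite-≤ F G f inj = Fin.injective⇒≤ {f = to G ∘ f ∘ from F} (from-injective F ∘ inj ∘ to-injective G)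

ordinary⇒unmarked : ∀ a {K : Fork a → Set} (K? : ∀ e → Dec (K e)) → #special a K? ≡ 0 → Unmarked a
ordinary⇒unmarked (tip false) K? _  = tip
ordinary⇒unmarked (tip true)  K? ()
ordinary⇒unmarked (fork a b)  K? eq = fork
  (ordinary⇒unmarked a (K? ∘ inˡ) (ℕ.m+n≡0⇒m≡0 _ rest))
  (ordinary⇒unmarked b (K? ∘ inʳ) (ℕ.m+n≡0⇒n≡0 (#special a (K? ∘ inˡ)) rest))
  where
  rest : #special a (K? ∘ inˡ) ℕ.+ #special b (K? ∘ inʳ) ≡ 0
  rest = ℕ.m+n≡0⇒n≡0 (size (finite-Kind (K? here))) eq

ordinary⇒¬K : ∀ a {K : Fork a → Set} (K? : ∀ e → Dec (K e)) → #special a K? ≡ 0 → ∀ e → ¬ K e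
ordinary⇒¬K (fork a b) K? eq here with K? here
... | no ¬k = ¬k
ordinary⇒¬K (fork a b) K? eq (inˡ e) = ordinary⇒¬K a (K? ∘ inˡ)
  (ℕ.m+n≡0⇒m≡0 _ (ℕ.m+n≡0⇒n≡0 (size (finite-Kind (K? here))) eq)) e
ordinary⇒¬K (fork a b) K? eq (inʳ e) = ordinary⇒¬K b (K? ∘ inʳ)
  (ℕ.m+n≡0⇒n≡0 (#special a (K? ∘ inˡ)) (ℕ.m+n≡0⇒n≡0 (size (finite-Kind (K? here))) eq)) e

record Reduction (a : Shape) {K : Fork a → Set} (K? : ∀ e → Dec (K e)) : Set where
  field
    reduced : Shape
    inject  : reduced ⊑ a
    keeps   : ∀ e → K e → ∃[ e′ ] onFork inject e′ ≡ e
    -- A shape has a tip even if it has nothing special, whence `⊔ 1`.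
    bounded : #tips reduced ℕ.≤ #special a K? ℕ.⊔ 1

open Reduction

-- A fork outside K survives only if both branches contain something special; then their bounds need
-- no spare tip and add up. Otherwise a branch without anything special is dropped, and the bound of
-- the other one is inherited.
reduce : ∀ a {K : Fork a → Set} (K? : ∀ e → Dec (K e)) → Reduction a K?
reduce (tip m) K? = record { reduced = tip m ; inject = tip ; keeps = λ () ; bounded = ℕ.m≤n⊔m (#marks (tip m)) 1 }
reduce (fork a b) {K} K? = by-cases (K? here) refl (#special a (K? ∘ inˡ) ℕ.≟ 0) (#special b (K? ∘ inʳ) ℕ.≟ 0)
  where
  ra = reduce a (K? ∘ inˡ)
  rb = reduce b (K? ∘ inʳ)
  sa = #special a (K? ∘ inˡ)
  sb = #special b (K? ∘ inʳ)

  both : #tips (reduced ra) ℕ.+ #tips (reduced rb) ℕ.≤ #special (fork a b) K? ℕ.⊔ 1 → Reduction (fork a b) K?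
  both le = record
    { reduced = fork (reduced ra) (reduced rb)
    ; inject = fork (inject ra) (inject rb)
    ; keeps = λ { here k → here , refl
                ; (inˡ e) k → let (e′ , eq) = keeps ra e k in inˡ e′ , cong inˡ eq
                ; (inʳ e) k → let (e′ , eq) = keeps rb e k in inʳ e′ , cong inʳ eq }
    ; bounded = le
    }

  ≤-special : ∀ k {m n} → m ℕ.≤ n ℕ.⊔ 1 → m ℕ.≤ (k ℕ.+ n) ℕ.⊔ 1
  ≤-special k {n = n} le = ℕ.≤-trans le (ℕ.⊔-monoˡ-≤ 1 (ℕ.m≤n+m n k))

  -- The equation lets `K? here`, on which `#special` computes, be replaced by the case at hand.
  by-cases : (d : Dec (K here)) → K? here ≡ d → Dec (sa ≡ 0) → Dec (sb ≡ 0) → Reduction (fork a b) K?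
  by-cases (yes _) eq _ _ = both (ℕ.≤-trans (ℕ.+-mono-≤ (bounded ra) (bounded rb))
    (ℕ.≤-trans (ℕ.+-mono-≤ (ℕ.m⊔n≤m+n sa 1) (ℕ.m⊔n≤m+n sb 1))
      (ℕ.≤-trans (ℕ.≤-reflexive (trans (arith sa sb) (cong (λ d → size (finite-Kind d) ℕ.+ (sa ℕ.+ sb)) (sym eq))))
        (ℕ.m≤m⊔n _ 1))))
    where
    arith : ∀ x y → x ℕ.+ 1 ℕ.+ (y ℕ.+ 1) ≡ 2 ℕ.+ (x ℕ.+ y)
    arith = ℕSolver.solve-∀
  by-cases (no _) _ (no sa≢0) (no sb≢0) = both (ℕ.≤-trans
    (ℕ.+-mono-≤ (ℕ.≤-trans (bounded ra) (ℕ.≤-reflexive (ℕ.m≥n⇒m⊔n≡m (ℕ.n≢0⇒n>0 sa≢0))))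
                (ℕ.≤-trans (bounded rb) (ℕ.≤-reflexive (ℕ.m≥n⇒m⊔n≡m (ℕ.n≢0⇒n>0 sb≢0)))))
    (ℕ.≤-trans (ℕ.m≤n+m (sa ℕ.+ sb) (size (finite-Kind (K? here)))) (ℕ.m≤m⊔n _ 1)))
  by-cases (no ¬k) _ (yes sa≡0) _ = record
    { reduced = reduced rb
    ; inject = dropˡ (ordinary⇒unmarked a (K? ∘ inˡ) sa≡0) (inject rb)
    ; keeps = λ { here k → contradiction k ¬k
                ; (inˡ e) k → contradiction k (ordinary⇒¬K a (K? ∘ inˡ) sa≡0 e)
                ; (inʳ e) k → let (e′ , eq) = keeps rb e k in e′ , cong inʳ eq }
    ; bounded = ≤-special (size (finite-Kind (K? here))) (≤-special sa (bounded rb))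
    }
  by-cases (no ¬k) _ (no _) (yes sb≡0) = record
    { reduced = reduced ra
    ; inject = dropʳ (ordinary⇒unmarked b (K? ∘ inʳ) sb≡0) (inject ra)
    ; keeps = λ { here k → contradiction k ¬k
                ; (inʳ e) k → contradiction k (ordinary⇒¬K b (K? ∘ inʳ) sb≡0 e)
                ; (inˡ e) k → let (e′ , eq) = keeps ra e k in e′ , cong inˡ eq }
    ; bounded = ≤-special (size (finite-Kind (K? here)))
        (ℕ.≤-trans (≤-special sb (bounded ra)) (ℕ.≤-reflexive (cong (ℕ._⊔ 1) (ℕ.+-comm sb sa))))
    }

-- Property (F)

module _ {d : GenusGraph} {c : MarkedTree} (f : Hom d (real c)) where
  private
    module F = IsContraction (hom⇒contraction f)
    D = graph d
    R = graph (real c)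

  Kept : Fork (shape c) → Set
  Kept e = ∃[ h ] Hom.ψ f h ≡ half c (inj₁ (e , true))

  kept? : ∀ e → Dec (Kept e)
  kept? e = any?ᶠ (finite-HalfEdge D) (λ h → GraphProperties._≟ₕ_ R (Hom.ψ f h) (half c (inj₁ (e , true))))

  -- `ψ` commutes with `inv`, so testing the child half of an edge in `Kept` covers both halves.
  kept : ∀ e s h → Hom.ψ f h ≡ half c (inj₁ (e , s)) → Kept e
  kept e true  h eq = h , eq
  kept e false h eq = inv D h , trans (sym (F.ψ-inv h)) (trans (cong (inv R) eq) (inv-half c (inj₁ (e , false))))

  -- A mark is charged to a marking placed on it, a kept edge to the half-edge of d that is sent to
  -- it, so the bound depends on d and the type only.
  #special-≤ : #special (shape c) kept? ℕ.≤ size (finite-Marking (type c)) ℕ.+ size (finite-×Bool (finite-HalfEdge D))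
  #special-≤ = finite-≤ (finite-Special (shape c) kept?) (finite-⊎ (finite-Marking (type c)) (finite-×Bool (finite-HalfEdge D)))
    (code ∘ origin (shape c) kept?) (origin-injective (shape c) kept? _ _ ∘ code-injective _ _)
    where
    code : Mark (shape c) ⊎ ((Σ[ e ∈ Fork (shape c) ] Kept e) × Bool) → Marking (type c) ⊎ (HalfEdge D × Bool)
    code (inj₁ m)                   = inj₁ (proj₁ (place-surjective c m))
    code (inj₂ ((_ , h , _) , s))   = inj₂ (h , s)

    code-injective : ∀ x y → code x ≡ code y → Same x y
    code-injective (inj₁ m) (inj₁ m′) eq
      with trans (sym (proj₂ (place-surjective c m))) (trans (cong (place c) (inj₁-injective eq)) (proj₂ (place-surjective c m′)))
    ... | refl = mark
    code-injective (inj₂ ((e , h , p) , s)) (inj₂ ((e′ , .h , p′) , .s)) refl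
      with inj₁-injective (half-injective c (trans (sym p) p′))
    ... | refl = edge
    code-injective (inj₁ _) (inj₂ _) ()
    code-injective (inj₂ _) (inj₁ _) ()

  module _ {c′ : MarkedTree} (g : Embedding c′ c) (covers : ∀ e → Kept e → ∃[ e′ ] onFork (embed g) e′ ≡ e) where
    private
      φ-path : ∀ {x y} → Path (Contracted (embed g)) x y → φₕ f (vert c x) ≡ φₕ f (vert c y)
      φ-path ε = refl
      φ-path (step e s ∉image ◅ path) = trans (φ-step e s ∉image) (φ-path path)
        where
        φ-step : ∀ e s → Contracted (embed g) e → φₕ f (vert c (end e s)) ≡ φₕ f (vert c (end e (not s)))
        φ-step e s ∉image = begin
          φₕ f (vert c (end e s))                     ≡⟨ cong (φₕ f) (t-half c (inj₁ (e , s))) ⟨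
          φₕ f (t R (half c (inj₁ (e , s))))          ≡⟨ F.internal′ _ (λ h eq →
              let (e′ , eq′) = covers e (kept e s h eq) in ∉image e′ eq′) ⟨
          φₕ f (t R (inv R (half c (inj₁ (e , s)))))  ≡⟨ cong (φₕ f ∘ t R) (inv-half c (inj₁ (e , s))) ⟩
          φₕ f (t R (half c (inj₁ (e , not s))))      ≡⟨ cong (φₕ f) (t-half c (inj₁ (e , not s))) ⟩
          φₕ f (vert c (end e (not s)))               ∎
          where open ≡-Reasoning

      lift : ∀ h → ∃[ z ] onHalf g z ≡ unhalf c (Hom.ψ f h)
      lift h = go (unhalf c (Hom.ψ f h)) (sym (half-unhalf c (Hom.ψ f h)))
        where
        go : ∀ x → Hom.ψ f h ≡ half c x → ∃[ z ] onHalf g z ≡ x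
        go (inj₂ m)       _  = onHalf-mark g m
        go (inj₁ (e , s)) eq = let (e′ , eq′) = covers e (kept e s h eq) in inj₁ (e′ , s) , cong (λ e → inj₁ (e , s)) eq′

    -- An edge contracted by g is not kept, hence f identifies its ends. So f is constant on the
    -- fibres of g and may be evaluated at `section`, while the half-edges of d lift through g;
    -- `factor` makes this a contraction.
    descend : ∃[ k ] (k ∈ homs d (real c′) × IsComposite f (realHom g) k)
    descend = finish (∈-homs d (real c′) φ′ ψ′ λ φ-eq ψ-eq → factor f (realHom g)
        (λ x → trans (φ-eq (φₕ (realHom g) x)) (φ-factor x))
        (λ h → trans (cong (Hom.ψ (realHom g)) (ψ-eq h)) (ψ-factor h)))
      where
      φ′ : Vertex (graph (real c′)) → Vertex D
      φ′ y = φₕ f (vert c (section (embed g) (unvert c′ y)))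

      ψ′ : HalfEdge D → HalfEdge (graph (real c′))
      ψ′ h = half c′ (proj₁ (lift h))

      φ-factor : ∀ x → φ′ (φₕ (realHom g) x) ≡ φₕ f x
      φ-factor x = begin
        φ′ (φₕ (realHom g) x)
          ≡⟨ cong φ′ (φ-realHom g x) ⟩
        φₕ f (vert c (section (embed g) (unvert c′ (vert c′ (contract (embed g) (unvert c x))))))
          ≡⟨ cong (φₕ f ∘ vert c ∘ section (embed g)) (unvert-vert c′ _) ⟩
        φₕ f (vert c (section (embed g) (contract (embed g) (unvert c x))))
          ≡⟨ φ-path (path-section (embed g) (unvert c x)) ⟨
        φₕ f (vert c (unvert c x))
          ≡⟨ cong (φₕ f) (vert-unvert c x) ⟩
        φₕ f x ∎
        where open ≡-Reasoning

      ψ-factor : ∀ h → Hom.ψ (realHom g) (ψ′ h) ≡ Hom.ψ f h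
      ψ-factor h = begin
        Hom.ψ (realHom g) (ψ′ h)
          ≡⟨ ψ-realHom g (ψ′ h) ⟩
        half c (onHalf g (unhalf c′ (half c′ (proj₁ (lift h)))))
          ≡⟨ cong (half c ∘ onHalf g) (unhalf-half c′ (proj₁ (lift h))) ⟩
        half c (onHalf g (proj₁ (lift h)))
          ≡⟨ cong (half c) (proj₂ (lift h)) ⟩
        half c (unhalf c (Hom.ψ f h))
          ≡⟨ half-unhalf c (Hom.ψ f h) ⟩
        Hom.ψ f h ∎
        where open ≡-Reasoning

      finish : ∃[ k ] (k ∈ homs d (real c′) × φₕ k ≗ φ′ × Hom.ψ k ≗ ψ′) →
               ∃[ k ] (k ∈ homs d (real c′) × IsComposite f (realHom g) k)
      finish (k , k∈ , φk , ψk) = k , k∈ , record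
        { φ-composite = λ x → sym (trans (φk (φₕ (realHom g) x)) (φ-factor x))
        ; ψ-composite = λ h → sym (trans (cong (Hom.ψ (realHom g)) (ψk h)) (ψ-factor h)) }

  private
    total : ∫ d (λ _ → + 1) ≡ ℤ.- + 2 ℤ.+ + (#leaves (type c) ℕ.+ (#loops (type c) ℕ.+ #loops (type c))) ℤ.+ + 2 ℤ.* + #genera (type c)
    total = begin
      ∫ d (λ _ → + 1)
        ≡⟨ F.∫-φ (λ _ → + 1) ⟨
      ∫ (real c) (λ _ → + 1)
        ≡⟨ ∫-real c (λ _ → + 1) ⟩
      treeSum (shape c) (λ _ → + 1) ℤ.+ sum {size (finite-HalfMark (type c))} (λ _ → + 1) ℤ.+ + 2 ℤ.* sum {#genera (type c)} (λ _ → + 1)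
        ≡⟨ cong₂ (λ x y → x ℤ.+ + 2 ℤ.* y)
             (cong₂ ℤ._+_ (treeSum-const (shape c) (+ 1)) (trans (∑-const (size (finite-HalfMark (type c))) (+ 1)) (ℤ.*-identityʳ (+ size (finite-HalfMark (type c))))))
             (trans (∑-const (#genera (type c)) (+ 1)) (ℤ.*-identityʳ (+ #genera (type c)))) ⟩
      ℤ.- + 2 ℤ.+ + (#leaves (type c) ℕ.+ (#loops (type c) ℕ.+ #loops (type c))) ℤ.+ + 2 ℤ.* + #genera (type c) ∎
      where open ≡-Reasoning

  #leaves-≡ : #leaves (type c) ≡ #L D
  #leaves-≡ = trans (sym (#L-real c)) (sym F.#L-≡)

  -- The total genus is preserved, which bounds the type of c.
  #loops+#genera : ℤ.∣ ∫ d (λ _ → + 1) ℤ.+ + 2 ℤ.- + #L D ∣ ≡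
                   (#loops (type c) ℕ.+ #genera (type c)) ℕ.+ (#loops (type c) ℕ.+ #genera (type c))
  #loops+#genera = cong ℤ.∣_∣ (trans (cong₂ (λ x y → x ℤ.+ + 2 ℤ.- + y) total (sym #leaves-≡))
    (arith (+ #leaves (type c)) (+ #loops (type c)) (+ #genera (type c))))
    where
    arith : ∀ n b g → ℤ.- + 2 ℤ.+ (n ℤ.+ (b ℤ.+ b)) ℤ.+ + 2 ℤ.* g ℤ.+ + 2 ℤ.- n ≡ (b ℤ.+ g) ℤ.+ (b ℤ.+ g)
    arith = ℤSolver.solve-∀

module _ (d : GenusGraph) where
  private
    -- By `∑-weight` this is the absolute value of twice the total genus of d. By `#loops+#genera`
    -- it is twice the number of loops and genus units of any c whose realization receives a
    -- morphism from d.
    bound : ℕ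
    bound = ℤ.∣ ∫ d (λ _ → + 1) ℤ.+ + 2 ℤ.- + #L (graph d) ∣

  types : List Type
  types = cartesianProductWith (λ b g → #L (graph d) , b , g) (upTo (suc bound)) (upTo (suc bound))

  ∈-types : ∀ {c} → Hom d (real c) → type c ∈ types
  ∈-types {c} f = subst (λ n → (n , #loops (type c) , #genera (type c)) ∈ types) (sym (#leaves-≡ f))
    (∈-cartesianProductWith⁺ (λ b g → #L (graph d) , b , g)
      (∈-upTo⁺ (s≤s (ℕ.≤-trans (ℕ.m≤m+n _ _) le))) (∈-upTo⁺ (s≤s (ℕ.≤-trans (ℕ.m≤n+m _ (#loops (type c))) le))))
    where
    le : #loops (type c) ℕ.+ #genera (type c) ℕ.≤ bound
    le = ℕ.≤-trans (ℕ.m≤m+n _ _) (ℕ.≤-reflexive (sym (#loops+#genera f)))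

  maxTips : Type → ℕ
  maxTips τ = (size (finite-Marking τ) ℕ.+ size (finite-×Bool (finite-HalfEdge (graph d)))) ℕ.⊔ 1

  opaque
    candidates : List (Σ[ c ∈ MarkedTree ] Hom d (real c))
    candidates = concatMap (λ τ → concatMap (λ a → concatMap (λ c → map (c ,_) (homs d (real c)))
      (placements τ a)) (shapes (maxTips τ))) types

    candidates-complete : ∀ {c} (f : Hom d (real c)) →
      ∃[ x ] (x ∈ candidates × Σ[ g ∈ Embedding (proj₁ x) c ] IsComposite f (realHom g) (proj₂ x))
    candidates-complete {c} f = finish (∈-placements (type c) (reduced r) place′ place′-surjective)
      where
      r : Reduction (shape c) (kept? f)
      r = reduce (shape c) (kept? f)

      -- The reduced shape retains every mark, so all places of c lift to it.
      place′ : Marking (type c) → Mark (reduced r)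
      place′ x = proj₁ (onMark-surjective (inject r) (place c x))

      onMark-place′ : ∀ x → onMark (inject r) (place′ x) ≡ place c x
      onMark-place′ x = proj₂ (onMark-surjective (inject r) (place c x))

      place′-surjective : ∀ m → ∃[ x ] place′ x ≡ m
      place′-surjective m = let (x , eq) = place-surjective c (onMark (inject r) m) in
        x , onMark-injective (inject r) (trans (onMark-place′ x) eq)

      finish : ∃[ c′ ] (c′ ∈ placements (type c) (reduced r) × Placement (type c) (reduced r) place′ c′) →
               ∃[ x ] (x ∈ candidates × Σ[ g ∈ Embedding (proj₁ x) c ] IsComposite f (realHom g) (proj₂ x))
      finish (c′ , c′∈ , placement eq) = collect (descend f g (keeps r))
        where
        g : Embedding c′ c
        g = record
          { type-≡ = refl
          ; embed = inject r
          ; place-≡ = λ x → sym (trans (cong (onMark (inject r)) (eq x)) (onMark-place′ x))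
          }

        collect : ∃[ k ] (k ∈ homs d (real c′) × IsComposite f (realHom g) k) →
                  ∃[ x ] (x ∈ candidates × Σ[ g ∈ Embedding (proj₁ x) c ] IsComposite f (realHom g) (proj₂ x))
        collect (k , k∈ , comp) = (c′ , k) ,
          ∈-concatMap⁺ _ (lose (∈-types f) (∈-concatMap⁺ _ (lose
            (∈-shapes (reduced r) (ℕ.≤-trans (bounded r) (ℕ.⊔-monoˡ-≤ 1 (#special-≤ f))))
            (∈-concatMap⁺ _ (lose c′∈ (∈-map⁺ (c′ ,_) k∈)))))) ,
          g , comp

list⇒finiteFactorization : ∀ {C D : Category} (Φ : Functor C D) {d : Category.Obj D}
  (xs : List (Σ[ c ∈ Category.Obj C ] Category.Hom D d (Functor.F₀ Φ c))) →
  (∀ {c} (f : Category.Hom D d (Functor.F₀ Φ c)) → ∃[ x ] (x ∈ xs × Σ[ g ∈ Category.Hom C (proj₁ x) c ]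
    Category._≈_ D f (Category._⊚_ D (Functor.F₁ Φ g) (proj₂ x)))) →
  FiniteFactorization Φ d
list⇒finiteFactorization {C} {D} Φ xs complete = record
  { size = length xs
  ; cᵢ = λ i → proj₁ (lookup xs i)
  ; fᵢ = λ i → proj₂ (lookup xs i)
  ; factors = λ {c} f → let (x , x∈ , g) = complete f in
      ∈-index x∈ , subst (λ y → Σ[ g ∈ Category.Hom C (proj₁ y) c ]
        Category._≈_ D f (Category._⊚_ D (Functor.F₁ Φ g) (proj₂ y))) (lookup-index x∈) g
  }

-- The types below are spelled with the projections of numOpᵒᵖ and realize
-- because comparing them with their unfoldings is slow.
realize-propertyF : PropertyF realize
realize-propertyF d = list⇒finiteFactorization realize (candidates d) (λ {c} f → factors {c} f (candidates-complete d f))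
  where
  compose : ∀ {c c′} (f : Hom d (Functor.F₀ realize c)) (k : Hom d (Functor.F₀ realize c′)) (g : Embedding c′ c) →
            IsComposite f (Functor.F₁ realize g) k →
            Category._≈_ numOpᵒᵖ f (Category._⊚_ numOpᵒᵖ (Functor.F₁ realize g) k)
  compose {c} {c′} f k g = composite⇒≈ {d} {Functor.F₀ realize c′} {Functor.F₀ realize c} {f} {Functor.F₁ realize g} {k}

  factors : ∀ {c} (f : Hom d (Functor.F₀ realize c)) →
    ∃[ x ] (x ∈ candidates d × Σ[ g ∈ Embedding (proj₁ x) c ] IsComposite f (realHom g) (proj₂ x)) →
    ∃[ x ] (x ∈ candidates d × Σ[ g ∈ Embedding (proj₁ x) c ]
      Category._≈_ numOpᵒᵖ f (Category._⊚_ numOpᵒᵖ (Functor.F₁ realize g) (proj₂ x)))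
  factors {c} f ((c′ , k) , x∈ , g , comp) = (c′ , k) , x∈ , g , compose {c} {c′} f k g comp

-- Isomorphic graphs

-- Unlike `_≅_`, this may permute the vertices and the half-edges at each vertex: the parts and the
-- bijection of a morphism absorb such permutations.
record GraphIso (p q : GenusGraph) : Set where
  private
    P = graph p
    Q = graph q
  field
    onV       : Vertex P → Vertex Q
    offV      : Vertex Q → Vertex P
    off-on-V  : ∀ v → offV (onV v) ≡ v
    on-off-V  : ∀ w → onV (offV w) ≡ w
    onH       : HalfEdge P → HalfEdge Q
    offH      : HalfEdge Q → HalfEdge P
    off-on-H  : ∀ h → offH (onH h) ≡ h
    on-off-H  : ∀ h → onH (offH h) ≡ h
    onH-t     : ∀ h → t Q (onH h) ≡ onV (t P h)
    onH-inv   : ∀ h → inv Q (onH h) ≡ onH (inv P h)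
    #L-iso    : #L P ≡ #L Q
    onH-leaf  : ∀ k k′ → toℕ k ≡ toℕ k′ → leaf Q k′ ≡ onH (leaf P k)
    genus-iso : ∀ v → genus q (onV v) ≡ genus p v

  offH-t : ∀ h → t P (offH h) ≡ offV (t Q h)
  offH-t h = trans (sym (off-on-V _)) (cong offV (trans (sym (onH-t (offH h))) (cong (t Q) (on-off-H h))))

graphIso-sym : ∀ {p q} → GraphIso p q → GraphIso q p
graphIso-sym {p} {q} i = record
  { onV = offV ; offV = onV ; off-on-V = on-off-V ; on-off-V = off-on-V
  ; onH = offH ; offH = onH ; off-on-H = on-off-H ; on-off-H = off-on-H
  ; onH-t = offH-t
  ; onH-inv = λ h → trans (sym (off-on-H _)) (cong offH (trans (sym (onH-inv (offH h))) (cong (inv (graph q)) (on-off-H h))))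
  ; #L-iso = sym #L-iso
  ; onH-leaf = λ k k′ eq → trans (sym (off-on-H _)) (cong offH (sym (onH-leaf k′ k (sym eq))))
  ; genus-iso = λ w → trans (sym (genus-iso (offV w))) (cong (genus q) (on-off-V w))
  }
  where open GraphIso i

-- Applied in both directions, this turns a bijection of half-edges or of genus units over the
-- vertices into equality of arities or of genera.
fibre-≤ : ∀ {m n} {a : Fin m → ℕ} {b : Fin n → ℕ} (f : Σ[ v ∈ Fin m ] Fin (a v) → Σ[ w ∈ Fin n ] Fin (b w)) (g : Fin m → Fin n) →
          (∀ {x y} → f x ≡ f y → x ≡ y) → (∀ x → proj₁ (f x) ≡ g (proj₁ x)) → ∀ v → a v ℕ.≤ b (g v)
fibre-≤ {a = a} {b} f g inj over v = Fin.injective⇒≤ {f = f′} λ {i} {j} eq →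
  unpair (inj (pair-≡ (trans (over (v , i)) (sym (over (v , j))))
    (trans (sym (Fin.toℕ-cast _ (proj₂ (f (v , i))))) (trans (cong toℕ eq) (Fin.toℕ-cast _ (proj₂ (f (v , j))))))))
  where
  f′ : Fin (a v) → Fin (b (g v))
  f′ i = cast (cong b (over (v , i))) (proj₂ (f (v , i)))

  unpair : ∀ {i j : Fin (a v)} → (v , i) ≡ (v , j) → i ≡ j
  unpair refl = refl

module _ {p q : GenusGraph} (i : GraphIso p q) where
  open GraphIso i
  private
    cancelH : ∀ {h h′} → onH h ≡ onH h′ → h ≡ h′
    cancelH {h} {h′} eq = trans (sym (off-on-H h)) (trans (cong offH eq) (off-on-H h′))

    cancelH′ : ∀ {h h′} → offH h ≡ offH h′ → h ≡ h′
    cancelH′ {h} {h′} eq = trans (sym (on-off-H h)) (trans (cong onH eq) (on-off-H h′))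

    arity-iso : ∀ v → arity (graph q) (onV v) ≡ arity (graph p) v
    arity-iso v = ℕ.≤-antisym
      (subst (λ w → arity (graph q) (onV v) ℕ.≤ arity (graph p) w) (off-on-V v) (fibre-≤ offH offV cancelH′ offH-t (onV v)))
      (fibre-≤ onH onV cancelH onH-t v)

    weight-iso : ∀ v → weight q (onV v) ≡ weight p v
    weight-iso v = cong₂ (λ g a → + (g ℕ.+ g ℕ.+ a) ℤ.- + 2) (genus-iso v) (arity-iso v)

    single : ∀ l → ∫ q (λ x → ⟦ offV x Fin.≟ l ⟧) ≡ weight p l
    single l = begin
      ∫ q (λ x → ⟦ offV x Fin.≟ l ⟧)
        ≡⟨ ∑-single (onV l) (λ x x≢ → trans (cong (ℤ._* weight q x)
             (⟦ offV x Fin.≟ l ⟧-no (λ eq → x≢ (trans (sym (on-off-V x)) (cong onV eq))))) (ℤ.*-zeroˡ (weight q x))) ⟩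
      ⟦ offV (onV l) Fin.≟ l ⟧ ℤ.* weight q (onV l)
        ≡⟨ cong₂ ℤ._*_ (⟦ offV (onV l) Fin.≟ l ⟧-yes (off-on-V l)) (weight-iso l) ⟩
      + 1 ℤ.* weight p l
        ≡⟨ ℤ.*-identityˡ (weight p l) ⟩
      weight p l ∎
      where open ≡-Reasoning

  isoContraction : IsContraction p q offV onH
  isoContraction = record
    { φ-ψ = λ h → trans (cong offV (onH-t h)) (off-on-V (t (graph p) h))
    ; ψ-injective = λ _ _ → cancelH
    ; ψ-inv = onH-inv
    ; #L-≡ = #L-iso
    ; ψ-leaf = onH-leaf
    ; internal = λ h → inj₁ (offH h , on-off-H h)
    ; surjective = λ l → onV l , off-on-V l
    ; fibres = λ x y eq → subst (Star _ x) (trans (sym (on-off-V x)) (trans (cong onV eq) (on-off-V y))) ε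
    ; balanced = single
    }

  isoHom : Hom p q
  isoHom = contraction⇒hom isoContraction

iso-inverse : ∀ {p q} (i : GraphIso p q) (j : GraphIso q p) →
              (∀ v → GraphIso.offV i (GraphIso.offV j v) ≡ v) → (∀ h → GraphIso.onH j (GraphIso.onH i h) ≡ h) →
              (isoHom j ∘ₕ isoHom i) ≈ₕ idₕ
iso-inverse {p} {q} i j eqV eqH = ≈-idₕ {p} {isoHom j ∘ₕ isoHom i}
  (λ x → trans (φ-contraction⇒hom (isoContraction i) (φₕ (isoHom j) x))
    (trans (cong (GraphIso.offV i) (φ-contraction⇒hom (isoContraction j) x)) (eqV x)))
  (λ h → trans (ψ-∘ₕ (isoHom j) (isoHom i) h)
    (trans (ψ-contraction⇒hom (isoContraction j) (Hom.ψ (isoHom i) h))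
      (trans (cong (GraphIso.onH j) (ψ-contraction⇒hom (isoContraction i) h)) (eqH h))))

graphIso⇒isomorphic : ∀ {p q} → GraphIso p q → Isomorphic numOpᵒᵖ p q
graphIso⇒isomorphic i = record
  { to = isoHom i
  ; from = isoHom (graphIso-sym i)
  ; from-to = iso-inverse i (graphIso-sym i) off-on-V off-on-H
  ; to-from = iso-inverse (graphIso-sym i) i on-off-V on-off-H
  }
  where open GraphIso i

-- Spanning trees

-- A tree has neither loops nor multiple edges, so its oriented edges are told apart by their ends.
ends-injective : ∀ {a} (e e′ : Fork a) s s′ → end e s ≡ end e′ s′ → end e (not s) ≡ end e′ (not s′) → e ≡ e′ × s ≡ s′
ends-injective here    here     true  true  _  _ = refl , refl
ends-injective here    here     false false _  _ = refl , refl
ends-injective here    here     true  false () _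
ends-injective here    here     false true  () _
ends-injective here    (inˡ _)  true  _     _  ()
ends-injective here    (inˡ _)  false _     () _
ends-injective here    (inʳ _)  true  _     () _
ends-injective here    (inʳ _)  false _     _  ()
ends-injective (inˡ _) here     _     true  _  ()
ends-injective (inˡ _) here     _     false () _
ends-injective (inʳ _) here     _     true  () _
ends-injective (inʳ _) here     _     false _  ()
ends-injective (inˡ _) (inʳ _)  _     _     () _
ends-injective (inʳ _) (inˡ _)  _     _     () _
ends-injective (inˡ e) (inˡ e′) s     s′    p  q =
  map₁ (cong inˡ) (ends-injective e e′ s s′ (inˡ-injectiveᵗ p) (inˡ-injectiveᵗ q))
ends-injective (inʳ e) (inʳ e′) s     s′    p  q =
  map₁ (cong inʳ) (ends-injective e e′ s s′ (inʳ-injectiveᵗ p) (inʳ-injectiveᵗ q))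

module _ (Γ : OperadicGraph) where

  -- Shapes labelled by vertices of Γ. Indexing by the root makes the types state that h joins the
  -- roots of the two branches.
  data Tree : Vertex Γ → Set where
    tip  : ∀ v → Tree v
    fork : ∀ h → Tree (t Γ (inv Γ h)) → Tree (t Γ h) → Tree (t Γ h)

module _ {Γ : OperadicGraph} where

  infix 4 _∈ᵗ_

  data _∈ᵗ_ (v : Vertex Γ) : ∀ {r} → Tree Γ r → Set where
    here : v ∈ᵗ tip v
    inˡ  : ∀ {h a b} → v ∈ᵗ a → v ∈ᵗ fork h a b
    inʳ  : ∀ {h a b} → v ∈ᵗ b → v ∈ᵗ fork h a b

  -- Membership records a position, so uniqueness of its proofs says that no vertex occurs twice.
  Distinct : ∀ {r} → Tree Γ r → Set
  Distinct T = ∀ {v} (i j : v ∈ᵗ T) → i ≡ j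

  root-∈ᵗ : ∀ {r} (T : Tree Γ r) → r ∈ᵗ T
  root-∈ᵗ (tip _)      = here
  root-∈ᵗ (fork _ _ b) = inʳ (root-∈ᵗ b)

  shapeOf : (Vertex Γ → Bool) → ∀ {r} → Tree Γ r → Shape
  shapeOf P (tip v)      = tip (P v)
  shapeOf P (fork _ a b) = fork (shapeOf P a) (shapeOf P b)

  module _ (P : Vertex Γ → Bool) where

    vertexAt : ∀ {r} (T : Tree Γ r) → Tip (shapeOf P T) → Vertex Γ
    vertexAt (tip v)      here    = v
    vertexAt (fork _ a b) (inˡ x) = vertexAt a x
    vertexAt (fork _ a b) (inʳ x) = vertexAt b x

    member : ∀ {r} (T : Tree Γ r) x → vertexAt T x ∈ᵗ T
    member (tip v)      here    = here
    member (fork _ a b) (inˡ x) = inˡ (member a x)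
    member (fork _ a b) (inʳ x) = inʳ (member b x)

    position : ∀ {v r} {T : Tree Γ r} → v ∈ᵗ T → Tip (shapeOf P T)
    position here    = here
    position (inˡ i) = inˡ (position i)
    position (inʳ i) = inʳ (position i)

    position-member : ∀ {r} (T : Tree Γ r) x → position (member T x) ≡ x
    position-member (tip _)      here    = refl
    position-member (fork _ a b) (inˡ x) = cong inˡ (position-member a x)
    position-member (fork _ a b) (inʳ x) = cong inʳ (position-member b x)

    vertexAt-position : ∀ {v r} {T : Tree Γ r} (i : v ∈ᵗ T) → vertexAt T (position i) ≡ v
    vertexAt-position here    = refl
    vertexAt-position (inˡ i) = vertexAt-position i
    vertexAt-position (inʳ i) = vertexAt-position i

    vertexAt-injective : ∀ {r} (T : Tree Γ r) → Distinct T → ∀ {x y} → vertexAt T x ≡ vertexAt T y → x ≡ y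
    vertexAt-injective T distinct {x} {y} eq = trans (sym (position-member T x))
      (trans (go eq (member T x) (member T y)) (position-member T y))
      where
      go : ∀ {v w} → v ≡ w → (i : v ∈ᵗ T) (j : w ∈ᵗ T) → position i ≡ position j
      go refl i j = cong position (distinct i j)

    vertexAt-root : ∀ {r} (T : Tree Γ r) → vertexAt T (root (shapeOf P T)) ≡ r
    vertexAt-root (tip _)      = refl
    vertexAt-root (fork _ a b) = vertexAt-root b

    forkEdge : ∀ {r} (T : Tree Γ r) → Fork (shapeOf P T) → HalfEdge Γ
    forkEdge (fork h a b) here    = h
    forkEdge (fork h a b) (inˡ e) = forkEdge a e
    forkEdge (fork h a b) (inʳ e) = forkEdge b e

    edgeHalf : ∀ {r} (T : Tree Γ r) → Fork (shapeOf P T) → Bool → HalfEdge Γ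
    edgeHalf T e true  = inv Γ (forkEdge T e)
    edgeHalf T e false = forkEdge T e

    inv-edgeHalf : ∀ {r} (T : Tree Γ r) e s → inv Γ (edgeHalf T e s) ≡ edgeHalf T e (not s)
    inv-edgeHalf T e true  = inv-involutive Γ (forkEdge T e)
    inv-edgeHalf T e false = refl

    t-edgeHalf : ∀ {r} (T : Tree Γ r) e s → t Γ (edgeHalf T e s) ≡ vertexAt T (end e s)
    t-edgeHalf (fork h a b) here    true  = sym (vertexAt-root a)
    t-edgeHalf (fork h a b) here    false = sym (vertexAt-root b)
    t-edgeHalf (fork h a b) (inˡ e) true  = t-edgeHalf a e true
    t-edgeHalf (fork h a b) (inˡ e) false = t-edgeHalf a e false
    t-edgeHalf (fork h a b) (inʳ e) true  = t-edgeHalf b e true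
    t-edgeHalf (fork h a b) (inʳ e) false = t-edgeHalf b e false

    edgeHalf-injective : ∀ {r} (T : Tree Γ r) → Distinct T → ∀ e e′ s s′ → edgeHalf T e s ≡ edgeHalf T e′ s′ → e ≡ e′ × s ≡ s′
    edgeHalf-injective T distinct e e′ s s′ eq = ends-injective e e′ s s′ (ends s s′ eq) (ends (not s) (not s′)
      (trans (sym (inv-edgeHalf T e s)) (trans (cong (inv Γ) eq) (inv-edgeHalf T e′ s′))))
      where
      ends : ∀ s s′ → edgeHalf T e s ≡ edgeHalf T e′ s′ → end e s ≡ end e′ s′
      ends s s′ eq = vertexAt-injective T distinct
        (trans (sym (t-edgeHalf T e s)) (trans (cong (t Γ) eq) (t-edgeHalf T e′ s′)))

  _∈ᵗ?_ : ∀ v {r} (T : Tree Γ r) → Dec (v ∈ᵗ T)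
  v ∈ᵗ? T = map′ (λ { (x , refl) → member _ T x }) (λ i → position _ i , vertexAt-position _ i)
    (any?ᶠ (finite-Tip (shapeOf (λ _ → false) T)) (λ x → vertexAt _ T x Fin.≟ v))

  -- Splitting the tip of `t Γ h` leaves its root unchanged, so the surrounding forks keep their
  -- types.
  grow : ∀ {r} (T : Tree Γ r) h → t Γ h ∈ᵗ T → Tree Γ r
  grow (tip _)      h here    = fork h (tip (t Γ (inv Γ h))) (tip (t Γ h))
  grow (fork k a b) h (inˡ i) = fork k (grow a h i) b
  grow (fork k a b) h (inʳ i) = fork k a (grow b h i)

  #tips-grow : ∀ P {r} (T : Tree Γ r) h i → #tips (shapeOf P (grow T h i)) ≡ suc (#tips (shapeOf P T))
  #tips-grow P (tip _)      h here    = refl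
  #tips-grow P (fork k a b) h (inˡ i) = cong (ℕ._+ #tips (shapeOf P b)) (#tips-grow P a h i)
  #tips-grow P (fork k a b) h (inʳ i) = trans (cong (#tips (shapeOf P a) ℕ.+_) (#tips-grow P b h i)) (ℕ.+-suc _ _)

  private
    out : ∀ {r} (T : Tree Γ r) h i {v} → v ∈ᵗ grow T h i → v ≡ t Γ (inv Γ h) ⊎ v ∈ᵗ T
    out (tip _)      h here    (inˡ here) = inj₁ refl
    out (tip _)      h here    (inʳ here) = inj₂ here
    out (fork k a b) h (inˡ i) (inˡ j)    = ⊎-map id inˡ (out a h i j)
    out (fork k a b) h (inˡ i) (inʳ j)    = inj₂ (inʳ j)
    out (fork k a b) h (inʳ i) (inˡ j)    = inj₂ (inˡ j)
    out (fork k a b) h (inʳ i) (inʳ j)    = ⊎-map id inʳ (out b h i j)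

    into : ∀ {r} (T : Tree Γ r) h i {v} → v ≡ t Γ (inv Γ h) ⊎ v ∈ᵗ T → v ∈ᵗ grow T h i
    into (tip _)      h here    (inj₁ refl)    = inˡ here
    into (tip _)      h here    (inj₂ here)    = inʳ here
    into (fork k a b) h (inˡ i) (inj₁ eq)      = inˡ (into a h i (inj₁ eq))
    into (fork k a b) h (inˡ i) (inj₂ (inˡ j)) = inˡ (into a h i (inj₂ j))
    into (fork k a b) h (inˡ i) (inj₂ (inʳ j)) = inʳ j
    into (fork k a b) h (inʳ i) (inj₁ eq)      = inʳ (into b h i (inj₁ eq))
    into (fork k a b) h (inʳ i) (inj₂ (inˡ j)) = inˡ j
    into (fork k a b) h (inʳ i) (inj₂ (inʳ j)) = inʳ (into b h i (inj₂ j))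

    into-out : ∀ {r} (T : Tree Γ r) h i {v} (j : v ∈ᵗ grow T h i) → into T h i (out T h i j) ≡ j
    into-out (tip _)      h here    (inˡ here) = refl
    into-out (tip _)      h here    (inʳ here) = refl
    into-out (fork k a b) h (inˡ i) (inˡ j) with out a h i j | into-out a h i j
    ... | inj₁ _ | eq = cong inˡ eq
    ... | inj₂ _ | eq = cong inˡ eq
    into-out (fork k a b) h (inˡ i) (inʳ j)    = refl
    into-out (fork k a b) h (inʳ i) (inˡ j)    = refl
    into-out (fork k a b) h (inʳ i) (inʳ j) with out b h i j | into-out b h i j
    ... | inj₁ _ | eq = cong inʳ eq
    ... | inj₂ _ | eq = cong inʳ eq

  -- Membership in the grown tree is a retract of the sum of being the new vertex and membership in
  -- T. These exclude each other, and each has at most one proof.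
  grow-distinct : ∀ {r} (T : Tree Γ r) h i → ¬ (t Γ (inv Γ h) ∈ᵗ T) → Distinct T → Distinct (grow T h i)
  grow-distinct T h i ∉T distinct j j′ = trans (sym (into-out T h i j))
    (trans (cong (into T h i) (agree (out T h i j) (out T h i j′))) (into-out T h i j′))
    where
    agree : ∀ {v} (x y : v ≡ t Γ (inv Γ h) ⊎ v ∈ᵗ T) → x ≡ y
    agree (inj₁ refl) (inj₁ refl) = refl
    agree (inj₂ k)    (inj₂ k′)   = cong inj₂ (distinct k k′)
    agree (inj₁ refl) (inj₂ k)    = contradiction k ∉T
    agree (inj₂ k)    (inj₁ refl) = contradiction k ∉T

  crossing : ∀ {r} (T : Tree Γ r) {x y} → Star (Adjacent Γ) x y → x ∈ᵗ T → ¬ (y ∈ᵗ T) →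
             ∃[ h ] (t Γ h ∈ᵗ T × ¬ (t Γ (inv Γ h) ∈ᵗ T))
  crossing T ε x∈ y∉ = contradiction x∈ y∉
  crossing T ((h , refl , refl) ◅ path) x∈ y∉ with t Γ (inv Γ h) ∈ᵗ? T
  ... | yes ∈T = crossing T path ∈T y∉
  ... | no ∉T  = h , x∈ , ∉T

  module _ (conn : Connected Γ) where

    spanning-from : ∀ fuel {r} (T : Tree Γ r) → Distinct T → fuel ℕ.+ #tips (shapeOf (λ _ → false) T) ≡ suc (#V Γ) →
                    Σ[ T ∈ Tree Γ r ] (Distinct T × (∀ v → v ∈ᵗ T))
    -- Without fuel the tree would have one tip more than Γ has vertices, although its tips are
    -- distinct.
    spanning-from zero T distinct eq = contradiction
      (ℕ.≤-trans (ℕ.≤-reflexive (sym eq)) (finite-≤ (finite-Tip (shapeOf (λ _ → false) T)) (finite-Fin (#V Γ)) (vertexAt _ T) (vertexAt-injective _ T distinct)))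
      (ℕ.<-irrefl refl)
    spanning-from (suc fuel) {r} T distinct eq with Fin.all? (λ v → v ∈ᵗ? T)
    ... | yes all = T , distinct , all
    ... | no ¬all with Fin.¬∀⟶∃¬ _ (_∈ᵗ T) (_∈ᵗ? T) ¬all
    ...   | v , v∉ with crossing T (conn r v) (root-∈ᵗ T) v∉
    ...     | h , h∈ , h∉ = spanning-from fuel (grow T h h∈) (grow-distinct T h h∈ h∉ distinct)
      (trans (cong (fuel ℕ.+_) (#tips-grow _ T h h∈)) (trans (ℕ.+-suc fuel _) eq))

    spanningTree : ∀ r → Σ[ T ∈ Tree Γ r ] (Distinct T × (∀ v → v ∈ᵗ T))
    spanningTree r = spanning-from (#V Γ) (tip r) (λ { here here → refl }) (ℕ.+-comm (#V Γ) 1)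

-- Essential surjectivity

-- The final marks depend on which half-edges lie off the tree, so `OnTree` has to be stated
-- beforehand, with a shape on which nothing is marked; this carries edges from one choice of marks
-- to another.
refork : ∀ {Γ : OperadicGraph} {P P′ : Vertex Γ → Bool} {r} (T : Tree Γ r) → Fork (shapeOf P T) → Fork (shapeOf P′ T)
refork (fork _ a b) here    = here
refork (fork _ a b) (inˡ e) = inˡ (refork a e)
refork (fork _ a b) (inʳ e) = inʳ (refork b e)

forkEdge-refork : ∀ {Γ : OperadicGraph} {P P′ : Vertex Γ → Bool} {r} (T : Tree Γ r) (e : Fork (shapeOf P T)) →
                  forkEdge P′ T (refork T e) ≡ forkEdge P T e
forkEdge-refork (fork _ a b) here    = refl
forkEdge-refork (fork _ a b) (inˡ e) = forkEdge-refork a e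
forkEdge-refork (fork _ a b) (inʳ e) = forkEdge-refork b e

edgeHalf-refork : ∀ {Γ : OperadicGraph} {P P′ : Vertex Γ → Bool} {r} (T : Tree Γ r) (e : Fork (shapeOf P T)) s →
                  edgeHalf P′ T (refork T e) s ≡ edgeHalf P T e s
edgeHalf-refork {Γ} T e true  = cong (inv Γ) (forkEdge-refork T e)
edgeHalf-refork     T e false = forkEdge-refork T e

markAt : ∀ {Γ : OperadicGraph} (P : Vertex Γ → Bool) {v r} {T : Tree Γ r} (i : v ∈ᵗ T) → P v ≡ true →
         ∃[ m ] markTip m ≡ position P i
markAt P {v} here eq with P v
markAt P {v} here refl | true = here , refl
markAt P (inˡ i) eq = let (m , eq′) = markAt P i eq in inˡ m , cong inˡ eq′
markAt P (inʳ i) eq = let (m , eq′) = markAt P i eq in inʳ m , cong inʳ eq′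

mark-true : ∀ {Γ : OperadicGraph} (P : Vertex Γ → Bool) {r} (T : Tree Γ r) (m : Mark (shapeOf P T)) →
            P (vertexAt P T (markTip m)) ≡ true
mark-true {Γ} P (tip v) m = trans (cong P (only (markTip m))) (flagged m)
  where
  only : ∀ x → vertexAt P (tip v) x ≡ v
  only here = refl

  flagged : ∀ {b} → Mark (tip b) → b ≡ true
  flagged here = refl
mark-true P (fork _ a b) (inˡ m) = mark-true P a m
mark-true P (fork _ a b) (inʳ m) = mark-true P b m

markTip-injective : ∀ {a} {m m′ : Mark a} → markTip m ≡ markTip m′ → m ≡ m′
markTip-injective {m = here}  {here}  _  = refl
markTip-injective {m = inˡ _} {inˡ _} eq = cong inˡ (markTip-injective (inˡ-injectiveᵗ eq))
markTip-injective {m = inʳ _} {inʳ _} eq = cong inʳ (markTip-injective (inʳ-injectiveᵗ eq))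
markTip-injective {m = inˡ _} {inʳ _} ()
markTip-injective {m = inʳ _} {inˡ _} ()

module Marked (q : GenusGraph) {r : Vertex (graph q)} (T : Tree (graph q) r) (distinct : Distinct T)
              (covers : ∀ v → v ∈ᵗ T) where
  private
    Γ = graph q
    module G = GraphProperties Γ
    module HF = Finite (finite-HalfEdge Γ)
    module GF = Finite (finite-Σ (genus q))

  OnTree : HalfEdge Γ → Set
  OnTree h = ∃[ e ] ∃[ s ] edgeHalf (λ _ → false) T e s ≡ h

  onTree? : ∀ h → Dec (OnTree h)
  onTree? h = map′ (λ ((e , s) , eq) → e , s , eq) (λ (e , s , eq) → (e , s) , eq)
    (any?ᶠ (finite-×Bool (finite-Fork (shapeOf (λ _ → false) T))) (λ (e , s) → G._≟ₕ_ (edgeHalf (λ _ → false) T e s) h))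

  onTree-inv : ∀ {h} → OnTree (inv Γ h) → OnTree h
  onTree-inv {h} (e , s , eq) = e , not s ,
    trans (sym (inv-edgeHalf _ T e s)) (trans (cong (inv Γ) eq) (inv-involutive Γ h))

  onTree-edgeHalf : ∀ P e s → OnTree (edgeHalf P T e s)
  onTree-edgeHalf P e s = refork T e , s , edgeHalf-refork T e s

  onTree⇒edgeHalf : ∀ P {h} → OnTree h → ∃[ e ] ∃[ s ] edgeHalf P T e s ≡ h
  onTree⇒edgeHalf P (e , s , eq) = refork T e , s , trans (edgeHalf-refork T e s) eq

  fixed⇒¬onTree : ∀ {h} → inv Γ h ≡ h → ¬ OnTree h
  fixed⇒¬onTree fix (e , s , refl) = not-fixpoint s
    (proj₂ (edgeHalf-injective _ T distinct e e (not s) s (trans (sym (inv-edgeHalf _ T e s)) fix)))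

  -- Selects one half of every edge outside the tree, by the convention of `#E`; the strict
  -- inequality excludes the leaves.
  LowerLoop : HalfEdge Γ → Set
  LowerLoop h = ¬ OnTree h × _<ₕ_ Γ h (inv Γ h)

  private
    module E = Enumeration (enumerate {P = LowerLoop ∘ HF.from}
      (λ i → ¬? (onTree? (HF.from i)) ×-dec _<ₕ?_ Γ (HF.from i) (inv Γ (HF.from i))))

  treeType : Type
  treeType = #L Γ , E.size , GF.size

  loop : Fin E.size → HalfEdge Γ
  loop j = HF.from (E.enum j)

  loop-lower : ∀ j → LowerLoop (loop j)
  loop-lower = E.sound

  loop-injective : ∀ {j j′} → loop j ≡ loop j′ → j ≡ j′
  loop-injective eq = mono⇒injective E.mono (HF.from-injective eq)

  loop-complete : ∀ h → LowerLoop h → ∃[ j ] loop j ≡ h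
  loop-complete h l = let (j , eq) = E.complete (HF.to h) (subst LowerLoop (sym (HF.from-to h)) l) in
    j , trans (cong HF.from eq) (HF.from-to h)

  halfMark : HalfMark treeType → HalfEdge Γ
  halfMark (inj₁ k)           = leaf Γ k
  halfMark (inj₂ (j , true))  = loop j
  halfMark (inj₂ (j , false)) = inv Γ (loop j)

  halfMark-¬onTree : ∀ m → ¬ OnTree (halfMark m)
  halfMark-¬onTree (inj₁ k)           = fixed⇒¬onTree (leaf-fixed Γ k)
  halfMark-¬onTree (inj₂ (j , true))  = proj₁ (loop-lower j)
  halfMark-¬onTree (inj₂ (j , false)) = proj₁ (loop-lower j) ∘ onTree-inv

  private
    loop-¬fixed : ∀ j → inv Γ (loop j) ≢ loop j
    loop-¬fixed j eq = G.<ₕ-irrefl (loop j) (subst (_<ₕ_ Γ (loop j)) eq (proj₂ (loop-lower j)))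

    loop-¬inv : ∀ j j′ → loop j ≢ inv Γ (loop j′)
    loop-¬inv j j′ eq = G.<ₕ-asym (loop j′) (loop j) (subst (_<ₕ_ Γ (loop j′)) (sym eq) (proj₂ (loop-lower j′)))
      (subst (_<ₕ_ Γ (loop j)) (trans (cong (inv Γ) eq) (inv-involutive Γ (loop j′))) (proj₂ (loop-lower j)))

    leaf-¬loop : ∀ k j → leaf Γ k ≢ loop j
    leaf-¬loop k j eq = loop-¬fixed j (subst (λ h → inv Γ h ≡ h) eq (leaf-fixed Γ k))

    leaf-¬inv : ∀ k j → leaf Γ k ≢ inv Γ (loop j)
    leaf-¬inv k j eq = leaf-¬loop k j (trans (sym (leaf-fixed Γ k)) (trans (cong (inv Γ) eq) (inv-involutive Γ (loop j))))

  halfMark-injective : ∀ m m′ → halfMark m ≡ halfMark m′ → m ≡ m′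
  halfMark-injective (inj₁ k)           (inj₁ k′)           eq = cong inj₁ (leaf-injective Γ eq)
  halfMark-injective (inj₂ (j , true))  (inj₂ (j′ , true))  eq = cong (λ j → inj₂ (j , true)) (loop-injective eq)
  halfMark-injective (inj₂ (j , false)) (inj₂ (j′ , false)) eq = cong (λ j → inj₂ (j , false)) (loop-injective (G.inv-injective eq))
  halfMark-injective (inj₁ k)           (inj₂ (j , true))   eq = contradiction eq (leaf-¬loop k j)
  halfMark-injective (inj₁ k)           (inj₂ (j , false))  eq = contradiction eq (leaf-¬inv k j)
  halfMark-injective (inj₂ (j , true))  (inj₁ k)            eq = contradiction (sym eq) (leaf-¬loop k j)
  halfMark-injective (inj₂ (j , false)) (inj₁ k)            eq = contradiction (sym eq) (leaf-¬inv k j)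
  halfMark-injective (inj₂ (j , true))  (inj₂ (j′ , false)) eq = contradiction eq (loop-¬inv j j′)
  halfMark-injective (inj₂ (j , false)) (inj₂ (j′ , true))  eq = contradiction (sym eq) (loop-¬inv j′ j)

  halfMark-complete : ∀ h → ¬ OnTree h → ∃[ m ] halfMark m ≡ h
  halfMark-complete h ¬tree = by-cases (G.<ₕ-cover h (inv Γ h))
    where
    by-cases : _<ₕ_ Γ h (inv Γ h) ⊎ _<ₕ_ Γ (inv Γ h) h ⊎ inv Γ h ≡ h → ∃[ m ] halfMark m ≡ h
    by-cases (inj₁ lt) = let (j , eq) = loop-complete h (¬tree , lt) in inj₂ (j , true) , eq
    by-cases (inj₂ (inj₁ gt)) =
      let (j , eq) = loop-complete (inv Γ h) (¬tree ∘ onTree-inv , subst (_<ₕ_ Γ (inv Γ h)) (sym (inv-involutive Γ h)) gt)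
      in inj₂ (j , false) , trans (cong (inv Γ) eq) (inv-involutive Γ h)
    by-cases (inj₂ (inj₂ fix)) = let (k , eq) = fixed⇒leaf Γ h fix in inj₁ k , eq

  halfMark-flip : ∀ m → inv Γ (halfMark m) ≡ halfMark (flip {treeType} m)
  halfMark-flip (inj₁ k)           = leaf-fixed Γ k
  halfMark-flip (inj₂ (j , true))  = refl
  halfMark-flip (inj₂ (j , false)) = inv-involutive Γ (loop j)

  markVertex : Marking treeType → Vertex Γ
  markVertex (inj₁ m) = t Γ (halfMark m)
  markVertex (inj₂ j) = proj₁ (GF.from j)

  marked? : ∀ v → Dec (∃[ m ] markVertex m ≡ v)
  marked? v = any?ᶠ (finite-Marking treeType) (λ m → markVertex m Fin.≟ v)

  isMarked : Vertex Γ → Bool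
  isMarked v = does (marked? v)

  markOf : ∀ m → ∃[ k ] markTip k ≡ position isMarked (covers (markVertex m))
  markOf m = markAt isMarked (covers (markVertex m)) (dec-true (marked? (markVertex m)) (m , refl))

  at : Tip (shapeOf isMarked T) → Vertex Γ
  at = vertexAt isMarked T

  at-injective : ∀ {x y} → at x ≡ at y → x ≡ y
  at-injective = vertexAt-injective isMarked T distinct

  at-markOf : ∀ m → at (markTip (proj₁ (markOf m))) ≡ markVertex m
  at-markOf m = trans (cong at (proj₂ (markOf m))) (vertexAt-position isMarked (covers (markVertex m)))

  markedTree : MarkedTree
  markedTree = record
    { type = treeType
    ; shape = shapeOf isMarked T
    ; place = proj₁ ∘ markOf
    ; place-surjective = λ k → let (m , eq) = true⇒ (marked? (at (markTip k))) (mark-true isMarked T k) in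
        m , markTip-injective (at-injective (trans (at-markOf m) eq))
    }
    where
    true⇒ : ∀ {A : Set} (d : Dec A) → does d ≡ true → A
    true⇒ (yes a) _ = a

  private
    c = markedTree

  toHalf : Half c → HalfEdge Γ
  toHalf (inj₁ (e , s)) = edgeHalf isMarked T e s
  toHalf (inj₂ m)       = halfMark m

  toHalf-injective : ∀ z z′ → toHalf z ≡ toHalf z′ → z ≡ z′
  toHalf-injective (inj₁ (e , s)) (inj₁ (e′ , s′)) eq =
    let (p , p′) = edgeHalf-injective isMarked T distinct e e′ s s′ eq in cong₂ (λ e s → inj₁ (e , s)) p p′
  toHalf-injective (inj₂ m) (inj₂ m′) eq = cong inj₂ (halfMark-injective m m′ eq)
  toHalf-injective (inj₁ (e , s)) (inj₂ m) eq =
    contradiction (subst OnTree eq (onTree-edgeHalf isMarked e s)) (halfMark-¬onTree m)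
  toHalf-injective (inj₂ m) (inj₁ (e , s)) eq =
    contradiction (subst OnTree (sym eq) (onTree-edgeHalf isMarked e s)) (halfMark-¬onTree m)

  toHalf-surjective : ∀ h → ∃[ z ] toHalf z ≡ h
  toHalf-surjective h = by-cases (onTree? h)
    where
    by-cases : Dec (OnTree h) → ∃[ z ] toHalf z ≡ h
    by-cases (yes tree) = let (e , s , eq) = onTree⇒edgeHalf isMarked tree in inj₁ (e , s) , eq
    by-cases (no ¬tree) = let (m , eq) = halfMark-complete h ¬tree in inj₂ m , eq

  t-toHalf : ∀ z → t Γ (toHalf z) ≡ at (base c z)
  t-toHalf (inj₁ (e , s)) = t-edgeHalf isMarked T e s
  t-toHalf (inj₂ m)       = sym (at-markOf (inj₁ m))

  inv-toHalf : ∀ z → inv Γ (toHalf z) ≡ toHalf (opposite c z)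
  inv-toHalf (inj₁ (e , s)) = inv-edgeHalf isMarked T e s
  inv-toHalf (inj₂ m)       = halfMark-flip m

  markedTree-iso : GraphIso (real c) q
  markedTree-iso = record
    { onV = onV
    ; offV = offV
    ; off-on-V = off-on-V
    ; on-off-V = λ w → trans (cong at (unvert-vert c _)) (vertexAt-position isMarked (covers w))
    ; onH = λ z → toHalf (unhalf c z)
    ; offH = λ h → half c (proj₁ (toHalf-surjective h))
    ; off-on-H = λ z → trans (cong (half c) (toHalf-injective _ _ (proj₂ (toHalf-surjective (toHalf (unhalf c z)))))) (half-unhalf c z)
    ; on-off-H = λ h → trans (cong toHalf (unhalf-half c _)) (proj₂ (toHalf-surjective h))
    ; onH-t = λ z → trans (t-toHalf (unhalf c z)) (cong at (sym (unvert-t c z)))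
    ; onH-inv = λ z → trans (inv-toHalf (unhalf c z)) (cong toHalf (sym (trans (cong (unhalf c) (inv-unhalf c z)) (unhalf-half c _))))
    ; #L-iso = #L-real c
    ; onH-leaf = λ k k′ eq → cong toHalf (sym (trans (cong (unhalf c) (leaf-half c k k′ eq)) (unhalf-half c _)))
    ; genus-iso = λ v → ℕ.≤-antisym
        (subst (λ w → genus q (onV v) ℕ.≤ genus (real c) w) (off-on-V v) (fibre-≤ (gen c ∘ GF.to) offV gen-injective over-offV (onV v)))
        (fibre-≤ (GF.from ∘ ungen c) onV ungen-injective over-onV v)
    }
    where
    onV : Vertex (graph (real c)) → Vertex Γ
    onV v = at (unvert c v)

    offV : Vertex Γ → Vertex (graph (real c))
    offV w = vert c (position isMarked (covers w))

    off-on-V : ∀ v → offV (onV v) ≡ v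
    off-on-V v = trans (cong (vert c) (at-injective (vertexAt-position isMarked (covers (onV v))))) (vert-unvert c v)

    onV-gen : ∀ j → onV (proj₁ (gen c j)) ≡ proj₁ (GF.from j)
    onV-gen j = trans (cong onV (t-gen c j)) (trans (cong at (unvert-vert c _)) (at-markOf (inj₂ j)))

    over-onV : ∀ z → proj₁ (GF.from (ungen c z)) ≡ onV (proj₁ z)
    over-onV z = trans (sym (onV-gen (ungen c z))) (cong (onV ∘ proj₁) (gen-ungen c z))

    over-offV : ∀ y → proj₁ (gen c (GF.to y)) ≡ offV (proj₁ y)
    over-offV y = trans (sym (off-on-V _)) (cong offV (trans (onV-gen (GF.to y)) (cong proj₁ (GF.from-to y))))

    ungen-injective : ∀ {z z′} → GF.from (ungen c z) ≡ GF.from (ungen c z′) → z ≡ z′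
    ungen-injective {z} {z′} eq = trans (sym (gen-ungen c z)) (trans (cong (gen c) (GF.from-injective eq)) (gen-ungen c z′))

    gen-injective : ∀ {y y′} → gen c (GF.to y) ≡ gen c (GF.to y′) → y ≡ y′
    gen-injective {y} {y′} eq = GF.to-injective
      (trans (sym (ungen-gen c (GF.to y))) (trans (cong (ungen c) eq) (ungen-gen c (GF.to y′))))

realize-essentiallySurjective : EssentiallySurjective realize
realize-essentiallySurjective q =
  let (T , distinct , covers) = spanningTree (connected q) (Fin.fromℕ< (nonempty q)) in
  Marked.markedTree q T distinct covers , graphIso⇒isomorphic (Marked.markedTree-iso q T distinct covers)

theorem3p13 : IsQuasiGröbner numOpᵒᵖ
theorem3p13 = record
  { C = markedTrees
  ; isGröbner = markedTrees-isGröbner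
  ; Φ = realize
  ; essentiallySurjective = realize-essentiallySurjective
  ; propertyF = realize-propertyF
  }
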